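{- Let $t$ be a positive integer. Then there exists a positive integer $\kappa(t)$ such that if a graph $G$ satisfies the following conditions: (i) $d(x)>\kappa(t)$ holds for all $x\in V(G)$; (ii) $\bar d(G_x)\le \frac{d(x)-\kappa(t)}{t}$ holds for all $x\in V(G)$; (iii) $\lambda_{\min}(G)\ge -t-1$; then $G$ is the intersection graph of some linear $(t+1)$-uniform hypergraph.
   Context: All graphs are finite, undirected and simple. $d(x)$ is the degree of $x$ in $G$, $G_x$ is the subgraph of $G$ induced on the set of neighbors of $x$, $\bar d(G_x)$ is the average degree of the graph $G_x$, and $\lambda_{\min}(G)$ is the smallest eigenvalue of the adjacency matrix of $G$. A hypergraph $H$ is a pair $(X,E)$ with $X$ a finite set (vertices) and $E$ a set of non-empty subsets of $X$ (edges). It is $h$-uniform ($h\ge 2$) if every edge has cardinality $h$; it is linear if every pair of distinct vertices is contained in at most one edge. The intersection graph of $H=(X,E)$ is the graph with vertex set $E$ in which two distinct edges $e,e'\in E$ are adjacent iff $e\cap e'\ne\emptyset$. Graphs are identified up to isomorphism. -}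

module Defs where

open import Level using (0ℓ)
open import Data.Bool.Base using (if_then_else_)
open import Data.Fin.Base using (Fin)
open import Data.Fin.Properties using (_≟_)
open import Data.Fin.Subset using (Subset; Nonempty; _∩_; ∣_∣) renaming (_∈_ to _∈ₛ_)
open import Data.Fin.Subset.Properties using (nonempty?; ∩-comm)
open import Data.Integer.Base as ℤ using (ℤ; +_)
open import Data.List.Base using (List; length; filter; allFin; lookup; map)
open import Data.List.Membership.Propositional using (_∈_)
open import Data.List.Relation.Unary.All using (All)
open import Data.List.Relation.Unary.Unique.Propositional using (Unique)
open import Data.Nat.ListAction using (sum)
open import Data.Nat.Base as ℕ using (ℕ; zero; suc)
import Data.Nat.Properties as ℕₚ
open import Data.Product.Base using (∃-syntax; _×_; _,_)
open import Data.Rational.Base as ℚ using (ℚ; 0ℚ; 1ℚ; 1/_)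
import Data.Rational.Properties as ℚₚ
open import Algebra.Bundles using (module CommutativeMonoid)
open import Algebra.Properties.AbelianGroup ℚₚ.+-0-abelianGroup using (xyx⁻¹≈y)
open import Algebra.Properties.CommutativeSemigroup
  (CommutativeMonoid.commutativeSemigroup ℚₚ.+-0-commutativeMonoid) using (interchange)
open import Data.Vec.Functional using (Vector; foldr)
open import Function.Base using (_∘_)
open import Function.Bundles using (_↔_; _⇔_; Inverse)
open import Relation.Binary.Core using (Rel)
open import Relation.Binary.Definitions using (Decidable; Symmetric; Irreflexive)
open import Relation.Binary.PropositionalEquality
  using (_≡_; _≢_; sym; trans; cong; cong₂; subst; module ≡-Reasoning)
open import Relation.Nullary using (¬_; does)
open import Relation.Nullary.Decidable using (¬?; _×-dec_)

-- ℝ consists of Cauchy sequences of rationals; equality of reals is _≃_,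
-- not _≡_.

IsCauchy : (ℕ → ℚ) → Set
IsCauchy x = ∀ ε → 0ℚ ℚ.< ε →
  ∃[ N ] (∀ m n → N ℕ.≤ m → N ℕ.≤ n → ℚ.∣ x m ℚ.- x n ∣ ℚ.< ε)

record ℝ : Set where
  constructor mkℝ
  field
    seq    : ℕ → ℚ
    cauchy : IsCauchy seq

open ℝ public

infix 4 _≃_ _≤ℝ_

_≃_ : Rel ℝ 0ℓ
x ≃ y = ∀ ε → 0ℚ ℚ.< ε →
  ∃[ N ] (∀ n → N ℕ.≤ n → ℚ.∣ seq x n ℚ.- seq y n ∣ ℚ.< ε)

_≤ℝ_ : Rel ℝ 0ℓ
x ≤ℝ y = ∀ ε → 0ℚ ℚ.< ε →
  ∃[ N ] (∀ n → N ℕ.≤ n → seq x n ℚ.< seq y n ℚ.+ ε)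

private
  split : ∀ A B → .{{ℚ.Positive A}} → .{{ℚ.Positive B}} → ∀ ε → 0ℚ ℚ.< ε →
    ∃[ δ ] 0ℚ ℚ.< δ × A ℚ.* δ ℚ.+ B ℚ.* δ ≡ ε
  split A B ε 0<ε = δ , ℚₚ.positive⁻¹ δ {{δ-pos}} , eq
    where
    C = A ℚ.+ B
    instance
      C-pos : ℚ.Positive C
      C-pos = ℚₚ.pos+pos⇒pos A B
      C-nonZero : ℚ.NonZero C
      C-nonZero = ℚₚ.pos⇒nonZero C
      ε-pos : ℚ.Positive ε
      ε-pos = ℚ.positive 0<ε
      C⁻¹-pos : ℚ.Positive (1/ C)
      C⁻¹-pos = ℚₚ.1/pos⇒pos C
    δ = 1/ C ℚ.* ε
    δ-pos : ℚ.Positive δ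
    δ-pos = ℚₚ.pos*pos⇒pos (1/ C) ε
    open ≡-Reasoning
    eq : A ℚ.* δ ℚ.+ B ℚ.* δ ≡ ε
    eq = begin
      A ℚ.* δ ℚ.+ B ℚ.* δ   ≡⟨ ℚₚ.*-distribʳ-+ δ A B ⟨
      C ℚ.* (1/ C ℚ.* ε)    ≡⟨ ℚₚ.*-assoc C (1/ C) ε ⟨
      (C ℚ.* 1/ C) ℚ.* ε    ≡⟨ cong (ℚ._* ε) (ℚₚ.*-inverseʳ C) ⟩
      1ℚ ℚ.* ε              ≡⟨ ℚₚ.*-identityˡ ε ⟩
      ε                     ∎

  halve : ∀ ε → 0ℚ ℚ.< ε → ∃[ δ ] 0ℚ ℚ.< δ × δ ℚ.+ δ ≡ ε
  halve ε 0<ε with δ , 0<δ , eq ← split 1ℚ 1ℚ ε 0<ε =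
    δ , 0<δ , trans (sym (cong₂ ℚ._+_ (ℚₚ.*-identityˡ δ) (ℚₚ.*-identityˡ δ))) eq

  +-cauchy : ∀ {x y} → IsCauchy x → IsCauchy y → IsCauchy (λ n → x n ℚ.+ y n)
  +-cauchy {x} {y} cx cy ε 0<ε
    with δ , 0<δ , δ+δ≡ε ← halve ε 0<ε
    with M , x-close ← cx δ 0<δ
    with N , y-close ← cy δ 0<δ
    = M ℕ.⊔ N , λ m n p q → begin-strict
      ℚ.∣ (x m ℚ.+ y m) ℚ.- (x n ℚ.+ y n) ∣
        ≡⟨ cong ℚ.∣_∣ (regroup (x m) (y m) (x n) (y n)) ⟩
      ℚ.∣ (x m ℚ.- x n) ℚ.+ (y m ℚ.- y n) ∣
        ≤⟨ ℚₚ.∣p+q∣≤∣p∣+∣q∣ (x m ℚ.- x n) (y m ℚ.- y n) ⟩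
      ℚ.∣ x m ℚ.- x n ∣ ℚ.+ ℚ.∣ y m ℚ.- y n ∣
        <⟨ ℚₚ.+-mono-<
             (x-close m n (ℕₚ.m⊔n≤o⇒m≤o M N p) (ℕₚ.m⊔n≤o⇒m≤o M N q))
             (y-close m n (ℕₚ.m⊔n≤o⇒n≤o M N p) (ℕₚ.m⊔n≤o⇒n≤o M N q)) ⟩
      δ ℚ.+ δ
        ≡⟨ δ+δ≡ε ⟩
      ε ∎
    where
    open ℚₚ.≤-Reasoning
    regroup : ∀ a b c d → (a ℚ.+ b) ℚ.- (c ℚ.+ d) ≡ (a ℚ.- c) ℚ.+ (b ℚ.- d)
    regroup a b c d = begin-equality
      (a ℚ.+ b) ℚ.- (c ℚ.+ d)
        ≡⟨ cong (λ r → (a ℚ.+ b) ℚ.+ r) (ℚₚ.neg-distrib-+ c d) ⟩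
      (a ℚ.+ b) ℚ.+ (ℚ.- c ℚ.+ ℚ.- d)
        ≡⟨ interchange a b (ℚ.- c) (ℚ.- d) ⟩
      (a ℚ.- c) ℚ.+ (b ℚ.- d) ∎

  cauchy⇒bounded : ∀ {x} → IsCauchy x →
    ∃[ B ] ℚ.Positive B × ∃[ N ] (∀ n → N ℕ.≤ n → ℚ.∣ x n ∣ ℚ.≤ B)
  cauchy⇒bounded {x} cx with N , close ← cx 1ℚ (ℚₚ.positive⁻¹ 1ℚ)
    = ℚ.∣ x N ∣ ℚ.+ 1ℚ
    , ℚ.positive (ℚₚ.+-mono-≤-< (ℚₚ.0≤∣p∣ (x N)) (ℚₚ.positive⁻¹ 1ℚ))
    , N
    , λ n N≤n → begin
      ℚ.∣ x n ∣
        ≡⟨ cong ℚ.∣_∣ (regroup (x n) (x N)) ⟩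
      ℚ.∣ x N ℚ.+ (x n ℚ.- x N) ∣
        ≤⟨ ℚₚ.∣p+q∣≤∣p∣+∣q∣ (x N) (x n ℚ.- x N) ⟩
      ℚ.∣ x N ∣ ℚ.+ ℚ.∣ x n ℚ.- x N ∣
        ≤⟨ ℚₚ.+-monoʳ-≤ ℚ.∣ x N ∣ (ℚₚ.<⇒≤ (close n N N≤n ℕₚ.≤-refl)) ⟩
      ℚ.∣ x N ∣ ℚ.+ 1ℚ ∎
    where
    open ℚₚ.≤-Reasoning
    regroup : ∀ a b → a ≡ b ℚ.+ (a ℚ.- b)
    regroup a b = begin-equality
      a                    ≡⟨ xyx⁻¹≈y b a ⟨
      (b ℚ.+ a) ℚ.- b      ≡⟨ ℚₚ.+-assoc b a (ℚ.- b) ⟩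
      b ℚ.+ (a ℚ.- b)      ∎

  scaled-< : ∀ {p q r δ} → .{{ℚ.Positive r}} → ℚ.∣ p ∣ ℚ.≤ r → ℚ.∣ q ∣ ℚ.< δ →
    ℚ.∣ p ℚ.* q ∣ ℚ.< r ℚ.* δ
  scaled-< {p} {q} {r} {δ} p≤r q<δ = begin-strict
    ℚ.∣ p ℚ.* q ∣        ≡⟨ ℚₚ.∣p*q∣≡∣p∣*∣q∣ p q ⟩
    ℚ.∣ p ∣ ℚ.* ℚ.∣ q ∣  ≤⟨ ℚₚ.*-monoʳ-≤-nonNeg ℚ.∣ q ∣ {{ℚₚ.∣-∣-nonNeg q}} p≤r ⟩
    r ℚ.* ℚ.∣ q ∣        <⟨ ℚₚ.*-monoʳ-<-pos r q<δ ⟩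
    r ℚ.* δ              ∎
    where open ℚₚ.≤-Reasoning

  product-close : ∀ a b c d A B δ → .{{ℚ.Positive A}} → .{{ℚ.Positive B}} →
    ℚ.∣ a ∣ ℚ.≤ A → ℚ.∣ d ∣ ℚ.≤ B → ℚ.∣ a ℚ.- c ∣ ℚ.< δ → ℚ.∣ b ℚ.- d ∣ ℚ.< δ →
    ℚ.∣ a ℚ.* b ℚ.- c ℚ.* d ∣ ℚ.< A ℚ.* δ ℚ.+ B ℚ.* δ
  product-close a b c d A B δ a≤A d≤B a-c<δ b-d<δ = begin-strict
    ℚ.∣ a ℚ.* b ℚ.- c ℚ.* d ∣
      ≡⟨ cong ℚ.∣_∣ regroup ⟩
    ℚ.∣ a ℚ.* (b ℚ.- d) ℚ.+ d ℚ.* (a ℚ.- c) ∣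
      ≤⟨ ℚₚ.∣p+q∣≤∣p∣+∣q∣ (a ℚ.* (b ℚ.- d)) (d ℚ.* (a ℚ.- c)) ⟩
    ℚ.∣ a ℚ.* (b ℚ.- d) ∣ ℚ.+ ℚ.∣ d ℚ.* (a ℚ.- c) ∣
      <⟨ ℚₚ.+-mono-< (scaled-< {a} {b ℚ.- d} a≤A b-d<δ)
                     (scaled-< {d} {a ℚ.- c} d≤B a-c<δ) ⟩
    A ℚ.* δ ℚ.+ B ℚ.* δ ∎
    where
    open ℚₚ.≤-Reasoning
    *-distribˡ-- : ∀ a b c → a ℚ.* (b ℚ.- c) ≡ a ℚ.* b ℚ.- a ℚ.* c
    *-distribˡ-- a b c = begin-equality
      a ℚ.* (b ℚ.- c)              ≡⟨ ℚₚ.*-distribˡ-+ a b (ℚ.- c) ⟩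
      a ℚ.* b ℚ.+ a ℚ.* (ℚ.- c)    ≡⟨ cong (λ r → a ℚ.* b ℚ.+ r) (ℚₚ.neg-distribʳ-* a c) ⟨
      a ℚ.* b ℚ.- a ℚ.* c          ∎
    cancel : ∀ p q r → p ℚ.- r ≡ (p ℚ.- q) ℚ.+ (q ℚ.- r)
    cancel p q r = begin-equality
      p ℚ.- r                          ≡⟨ cong (ℚ._- r) (xyx⁻¹≈y q p) ⟨
      ((q ℚ.+ p) ℚ.- q) ℚ.- r          ≡⟨ cong (ℚ._- r) (ℚₚ.+-assoc q p (ℚ.- q)) ⟩
      (q ℚ.+ (p ℚ.- q)) ℚ.- r          ≡⟨ cong (ℚ._- r) (ℚₚ.+-comm q (p ℚ.- q)) ⟩
      ((p ℚ.- q) ℚ.+ q) ℚ.- r          ≡⟨ ℚₚ.+-assoc (p ℚ.- q) q (ℚ.- r) ⟩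
      (p ℚ.- q) ℚ.+ (q ℚ.- r)          ∎
    regroup : a ℚ.* b ℚ.- c ℚ.* d ≡ a ℚ.* (b ℚ.- d) ℚ.+ d ℚ.* (a ℚ.- c)
    regroup = begin-equality
      a ℚ.* b ℚ.- c ℚ.* d
        ≡⟨ cancel (a ℚ.* b) (a ℚ.* d) (c ℚ.* d) ⟩
      (a ℚ.* b ℚ.- a ℚ.* d) ℚ.+ (a ℚ.* d ℚ.- c ℚ.* d)
        ≡⟨ cong (λ r → (a ℚ.* b ℚ.- a ℚ.* d) ℚ.+ r)
             (cong₂ ℚ._-_ (ℚₚ.*-comm a d) (ℚₚ.*-comm c d)) ⟩
      (a ℚ.* b ℚ.- a ℚ.* d) ℚ.+ (d ℚ.* a ℚ.- d ℚ.* c)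
        ≡⟨ cong₂ ℚ._+_ (*-distribˡ-- a b d) (*-distribˡ-- d a c) ⟨
      a ℚ.* (b ℚ.- d) ℚ.+ d ℚ.* (a ℚ.- c) ∎

  *-cauchy : ∀ {x y} → IsCauchy x → IsCauchy y → IsCauchy (λ n → x n ℚ.* y n)
  *-cauchy {x} {y} cx cy ε 0<ε =
    let A , A-pos , I , x-bound = cauchy⇒bounded {x} cx
        B , B-pos , J , y-bound = cauchy⇒bounded {y} cy
        δ , 0<δ , eq            = split A B {{A-pos}} {{B-pos}} ε 0<ε
        K , x-close             = cx δ 0<δ
        L , y-close             = cy δ 0<δ
    in (I ℕ.⊔ J) ℕ.⊔ (K ℕ.⊔ L) , λ m n p q →
      let I⊔J≤m = ℕₚ.m⊔n≤o⇒m≤o (I ℕ.⊔ J) (K ℕ.⊔ L) p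
          K⊔L≤m = ℕₚ.m⊔n≤o⇒n≤o (I ℕ.⊔ J) (K ℕ.⊔ L) p
          I⊔J≤n = ℕₚ.m⊔n≤o⇒m≤o (I ℕ.⊔ J) (K ℕ.⊔ L) q
          K⊔L≤n = ℕₚ.m⊔n≤o⇒n≤o (I ℕ.⊔ J) (K ℕ.⊔ L) q
      in subst (ℚ.∣ x m ℚ.* y m ℚ.- x n ℚ.* y n ∣ ℚ.<_) eq
           (product-close (x m) (y m) (x n) (y n) A B δ {{A-pos}} {{B-pos}}
             (x-bound m (ℕₚ.m⊔n≤o⇒m≤o I J I⊔J≤m))
             (y-bound n (ℕₚ.m⊔n≤o⇒n≤o I J I⊔J≤n))
             (x-close m n (ℕₚ.m⊔n≤o⇒m≤o K L K⊔L≤m) (ℕₚ.m⊔n≤o⇒m≤o K L K⊔L≤n))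
             (y-close m n (ℕₚ.m⊔n≤o⇒n≤o K L K⊔L≤m) (ℕₚ.m⊔n≤o⇒n≤o K L K⊔L≤n)))

  const-cauchy : ∀ q → IsCauchy (λ _ → q)
  const-cauchy q ε 0<ε =
    0 , λ _ _ _ _ → subst (λ r → ℚ.∣ r ∣ ℚ.< ε) (sym (ℚₚ.+-inverseʳ q)) 0<ε

infixl 6 _+ℝ_
infixl 7 _*ℝ_

_+ℝ_ : ℝ → ℝ → ℝ
x +ℝ y = mkℝ (λ n → seq x n ℚ.+ seq y n) (+-cauchy {seq x} {seq y} (cauchy x) (cauchy y))

_*ℝ_ : ℝ → ℝ → ℝ
x *ℝ y = mkℝ (λ n → seq x n ℚ.* seq y n) (*-cauchy {seq x} {seq y} (cauchy x) (cauchy y))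

fromℚ : ℚ → ℝ
fromℚ q = mkℝ (λ _ → q) (const-cauchy q)

fromℤ : ℤ → ℝ
fromℤ z = fromℚ (z ℚ./ 1)

0ℝ 1ℝ : ℝ
0ℝ = fromℚ 0ℚ
1ℝ = fromℚ 1ℚ

Matrix : ℕ → Set
Matrix n = Fin n → Fin n → ℝ

_*ᵥ_ : ∀ {n} → Matrix n → Vector ℝ n → Vector ℝ n
(M *ᵥ v) i = foldr _+ℝ_ 0ℝ (λ j → M i j *ℝ v j)

IsEigenvalue : ∀ {n} → Matrix n → ℝ → Set
IsEigenvalue M μ =
  ∃[ v ] ¬ (∀ i → v i ≃ 0ℝ) × (∀ i → (M *ᵥ v) i ≃ μ *ℝ v i)

-- A real symmetric matrix has only real eigenvalues, so for such matrices
-- nothing is lost by looking only at real μ and real eigenvectors.  The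
-- 0 × 0 matrix has no eigenvalue, hence no smallest one.
IsSmallestEigenvalue : ∀ {n} → Matrix n → ℝ → Set
IsSmallestEigenvalue M μ =
  IsEigenvalue M μ × (∀ ν → IsEigenvalue M ν → μ ≤ℝ ν)

record Graph : Set₁ where
  field
    order  : ℕ
    Adj    : Rel (Fin order) 0ℓ
    adj?   : Decidable Adj
    symm   : Symmetric Adj
    irrefl : Irreflexive _≡_ Adj

  V : Set
  V = Fin order

  neighbours : V → List V
  neighbours x = filter (adj? x) (allFin order)

  degree : V → ℕ
  degree x = length (neighbours x)

open Graph public

record _≅_ (G H : Graph) : Set where
  field
    bijection : V G ↔ V H
    adj⇔adj   : ∀ x y →
      Adj G x y ⇔ Adj H (Inverse.to bijection x) (Inverse.to bijection y)

adjacencyMatrix : (G : Graph) → Matrix (order G)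
adjacencyMatrix G i j = if does (adj? G i j) then 1ℝ else 0ℝ

-- The vertices are the positions in the list, so this is the induced
-- subgraph provided the list has no repetitions.
inducedOn : (G : Graph) → List (V G) → Graph
inducedOn G xs = record
  { order  = length xs
  ; Adj    = λ i j → Adj G (lookup xs i) (lookup xs j)
  ; adj?   = λ i j → adj? G (lookup xs i) (lookup xs j)
  ; symm   = symm G
  ; irrefl = irrefl G ∘ cong (lookup xs)
  }

localGraph : (G : Graph) → V G → Graph
localGraph G x = inducedOn G (neighbours G x)

degreeSum : Graph → ℕ
degreeSum G = sum (map (degree G) (allFin (order G)))

-- The graph without vertices is given average degree 0.
averageDegree : Graph → ℚ
averageDegree G with order G
... | zero        = 0ℚ
... | n@(suc _)   = + degreeSum G ℚ./ n

record Hypergraph : Set where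
  field
    size     : ℕ
    edges    : List (Subset size)
    distinct : Unique edges
    nonempty : All Nonempty edges

  Uniform : ℕ → Set
  Uniform h = All (λ e → ∣ e ∣ ≡ h) edges

  Linear : Set
  Linear = ∀ x y → x ≢ y → ∀ {e e′} → e ∈ edges → e′ ∈ edges →
    x ∈ₛ e → y ∈ₛ e → x ∈ₛ e′ → y ∈ₛ e′ → e ≡ e′

open Hypergraph public

-- Vertices are positions in the edge list; as the edges are pairwise
-- distinct, different positions are different edges.
intersectionGraph : Hypergraph → Graph
intersectionGraph H = record
  { order  = length (edges H)
  ; Adj    = λ i j → i ≢ j × Nonempty (edge i ∩ edge j)
  ; adj?   = λ i j → ¬? (i ≟ j) ×-dec nonempty? (edge i ∩ edge j)
  ; symm   = λ {i} {j} (i≢j , meet) →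
      i≢j ∘ sym , subst Nonempty (∩-comm (edge i) (edge j)) meet
  ; irrefl = λ i≡j (i≢j , _) → i≢j i≡j
  }
  where
  edge : Fin (length (edges H)) → Subset (size H)
  edge = lookup (edges H)

-- Put k = t + 1.  Symmetric elimination over ℚ together with bisection constructs
-- the smallest eigenvalue of the adjacency matrix A as a Cauchy sequence; that it is
-- attained holds up to double negation, which suffices for the decidable conclusion
-- that A + kI is positive semidefinite on integer vectors.  Evaluating this form on
-- combinations of characteristic vectors yields the combinatorics: a vertex is
-- adjacent either to almost all or to few vertices of a large clique, and the
-- neighbourhood of a vertex has no large independent set, hence by Ramsey's theorem
-- large cliques.  Around every vertex x one can choose k large cliques of neighbours
-- F₁, …, F_k which are almost unjoined: if a choice of at most t such cliques could
-- not be extended, all but boundedly many neighbours of x would fall into at most t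
-- classes that are nearly cliques, and counting edges would contradict the sparsity
-- of the local graph at x.  The form is bounded by a constant multiple of M on
-- M x − Σ Fᵢ, where M = |Fᵢ|, which forces each neighbour of x to be attached to
-- exactly one Fᵢ and each other vertex to none.  The sets of vertices attached to the
-- Fᵢ behave like the lines through x: they do not depend on the choice of the base
-- point x on them, so the vertices of G become the edges of the k-uniform linear
-- hypergraph whose points are these lines.

module Submission where

open import Defs
open import Data.Integer.Base as ℤ using (+_; 1ℤ)
open import Data.Nat.Base as ℕ using (ℕ; NonZero)
open import Data.Product.Base using (∃-syntax; _×_; _,_)
open import Data.Rational.Base as ℚ using (ℚ)

-- Condition (iii) quantifies over every `μ` that is a smallest eigenvalue, so it says something
-- only once such a `μ` is at hand, and the undecidable order of Cauchy reals blocks the usual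
-- spectral theorem. Therefore one elimination is written for ordered rings whose trichotomy lives
-- in a monad: over the rationals it decides and steers the bisection; over the reals it runs under
-- double negation and shows that the limit is attained, because a strict bound at the limit would
-- contradict the vectors kept by the bisection. In the combinatorial half the constants `c₀`, `m₁`,
-- `M`, `R`, `κ` form a ladder: each is chosen against errors built from the earlier ones, and all
-- depend on `t` alone, so `κ` is fixed before the graph. Integer inequalities are certified: a sum
-- of nonnegative terms is identified by the ring solver with the claim, or with `- 1ℤ` where a
-- contradiction is sought.

-- Symmetric elimination for quadratic forms over an ordered ring

module QuadraticForms where

  open import Algebra.Bundles using (CommutativeRing; RawRing)
  open import Algebra.Solver.Ring.AlmostCommutativeRing using (AlmostCommutativeRing; fromCommutativeRing; _-Raw-AlmostCommutative⟶_)
  import Algebra.Solver.Ring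
  import Algebra.Properties.Semiring.Mult
  import Algebra.Properties.Semiring.Sum
  import Algebra.Properties.Ring
  open import Data.Empty using (⊥-elim)
  open import Data.Fin.Base using (Fin; zero; suc)
  open import Data.Maybe.Base using (Maybe; just; nothing)
  open import Data.Nat.Base as ℕ using (ℕ; zero; suc)
  import Data.Nat.Properties as ℕₚ
  open import Data.Product.Base using (∃-syntax; _×_; _,_)
  open import Data.Product.Properties using (≡-dec)
  open import Data.Sum.Base using (_⊎_; inj₁; inj₂; [_,_])
  open import Data.Vec.Functional as Vector using (Vector)
  open import Function.Base using (_∘_)
  open import Level using (0ℓ)
  open import Relation.Binary.PropositionalEquality as ≡ using (_≡_)
  import Relation.Binary.Reasoning.Setoid
  open import Relation.Nullary using (¬_; yes; no)

  -- Opposite terms only cancel in normal forms with decidable coefficients, hence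
  -- integer ones; the pair (p , q) stands for p − q.
  module IntegerCoefficients (R : CommutativeRing 0ℓ 0ℓ) where
    open CommutativeRing R
    open Algebra.Properties.Semiring.Mult semiring using (×-homo-+; ×1-homo-*; ×-homo-1)
    open Algebra.Properties.Ring ring using (-‿distribˡ-*; -‿distribʳ-*; -‿involutive; -0#≈0#)
    open import Algebra.Properties.AbelianGroup +-abelianGroup using (⁻¹-∙-comm)
    open import Algebra.Properties.CommutativeSemigroup +-commutativeSemigroup using (interchange)
    open import Algebra.Definitions.RawMonoid +-rawMonoid using () renaming (_×_ to _·_)
    open Relation.Binary.Reasoning.Setoid setoid

    private
      -- The solver compares normal forms syntactically, so coefficients are kept reduced.
      reduce : ℕ → ℕ → ℕ × ℕ
      reduce (suc p) (suc q) = reduce p q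
      reduce p q = p , q

      differences : RawRing 0ℓ 0ℓ
      differences = record
        { Carrier = ℕ × ℕ
        ; _≈_ = _≡_
        ; _+_ = λ (p , q) (r , s) → reduce (p ℕ.+ r) (q ℕ.+ s)
        ; _*_ = λ (p , q) (r , s) → reduce (p ℕ.* r ℕ.+ q ℕ.* s) (p ℕ.* s ℕ.+ q ℕ.* r)
        ; -_  = λ (p , q) → q , p
        ; 0#  = 0 , 0
        ; 1#  = 1 , 0
        }

      ring′ : AlmostCommutativeRing 0ℓ 0ℓ
      ring′ = fromCommutativeRing R

      ι : ℕ → Carrier
      ι n = n · 1#

      ⟦_⟧′ : ℕ × ℕ → Carrier
      ⟦ p , q ⟧′ = ι p - ι q

      -- The first two cases make constants denote 0# and 1# on the nose.
      ⟦_⟧ : ℕ × ℕ → Carrier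
      ⟦ 0 , 0 ⟧ = 0#
      ⟦ 1 , 0 ⟧ = 1#
      ⟦ x ⟧ = ⟦ x ⟧′

      ⟦⟧≈⟦⟧′ : ∀ x → ⟦ x ⟧ ≈ ⟦ x ⟧′
      ⟦⟧≈⟦⟧′ (0 , 0) = sym (-‿inverseʳ 0#)
      ⟦⟧≈⟦⟧′ (1 , 0) = sym (trans (+-cong (×-homo-1 1#) -0#≈0#) (+-identityʳ 1#))
      ⟦⟧≈⟦⟧′ (0 , suc _) = refl
      ⟦⟧≈⟦⟧′ (1 , suc _) = refl
      ⟦⟧≈⟦⟧′ (suc (suc _) , 0) = refl
      ⟦⟧≈⟦⟧′ (suc (suc _) , suc _) = refl

      reduce-correct : ∀ p q → ⟦ reduce p q ⟧′ ≈ ⟦ p , q ⟧′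
      reduce-correct zero    q       = refl
      reduce-correct (suc p) zero    = refl
      reduce-correct (suc p) (suc q) = begin
        ⟦ reduce p q ⟧′              ≈⟨ reduce-correct p q ⟩
        ι p - ι q                    ≈⟨ sym (+-identityˡ _) ⟩
        0# + (ι p - ι q)             ≈⟨ +-congʳ (sym (-‿inverseʳ 1#)) ⟩
        (1# - 1#) + (ι p - ι q)      ≈⟨ interchange _ _ _ _ ⟩
        (1# + ι p) + (- 1# - ι q)    ≈⟨ +-congˡ (⁻¹-∙-comm _ _) ⟩
        ι (suc p) - ι (suc q)        ∎

      -- The homomorphism laws are proved for the uniform `⟦_⟧′`; this carries them to `⟦_⟧`, whose
      -- two special cases would otherwise multiply the case distinctions.
      lift₂ : ∀ {_∙_ : Carrier → Carrier → Carrier} →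
        (∀ {x x′ y y′} → x ≈ x′ → y ≈ y′ → x ∙ y ≈ x′ ∙ y′) →
        ∀ x y z → ⟦ z ⟧′ ≈ ⟦ x ⟧′ ∙ ⟦ y ⟧′ → ⟦ z ⟧ ≈ ⟦ x ⟧ ∙ ⟦ y ⟧
      lift₂ ∙-cong x y z eq = trans (⟦⟧≈⟦⟧′ z)
        (trans eq (sym (∙-cong (⟦⟧≈⟦⟧′ x) (⟦⟧≈⟦⟧′ y))))

      +-homo : ∀ x y → ⟦ RawRing._+_ differences x y ⟧′ ≈ ⟦ x ⟧′ + ⟦ y ⟧′
      +-homo (p , q) (r , s) = begin
        ⟦ reduce (p ℕ.+ r) (q ℕ.+ s) ⟧′    ≈⟨ reduce-correct (p ℕ.+ r) _ ⟩
        ι (p ℕ.+ r) - ι (q ℕ.+ s)          ≈⟨ +-cong (×-homo-+ 1# p r) (-‿cong (×-homo-+ 1# q s)) ⟩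
        (ι p + ι r) - (ι q + ι s)          ≈⟨ +-congˡ (sym (⁻¹-∙-comm (ι q) (ι s))) ⟩
        (ι p + ι r) + (- ι q + - ι s)      ≈⟨ interchange (ι p) (ι r) (- ι q) (- ι s) ⟩
        (ι p - ι q) + (ι r - ι s)          ∎

      ι-*-+ : ∀ a b c d → ι (a ℕ.* b ℕ.+ c ℕ.* d) ≈ ι a * ι b + ι c * ι d
      ι-*-+ a b c d = trans (×-homo-+ 1# (a ℕ.* b) (c ℕ.* d)) (+-cong (×1-homo-* a b) (×1-homo-* c d))

      *-homo : ∀ x y → ⟦ RawRing._*_ differences x y ⟧′ ≈ ⟦ x ⟧′ * ⟦ y ⟧′
      *-homo (p , q) (r , s) = begin
        ⟦ reduce (p ℕ.* r ℕ.+ q ℕ.* s) (p ℕ.* s ℕ.+ q ℕ.* r) ⟧′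
          ≈⟨ reduce-correct (p ℕ.* r ℕ.+ q ℕ.* s) _ ⟩
        ι (p ℕ.* r ℕ.+ q ℕ.* s) - ι (p ℕ.* s ℕ.+ q ℕ.* r)
          ≈⟨ +-cong (ι-*-+ p r q s) (-‿cong (trans (ι-*-+ p s q r) (+-comm _ _))) ⟩
        (P * R′ + Q * S) - (Q * R′ + P * S)
          ≈⟨ +-congˡ (sym (⁻¹-∙-comm _ _)) ⟩
        (P * R′ + Q * S) + (- (Q * R′) + - (P * S))
          ≈⟨ interchange _ _ _ _ ⟩
        (P * R′ + - (Q * R′)) + (Q * S + - (P * S))
          ≈⟨ +-cong (+-congˡ (-‿distribˡ-* Q R′))
               (trans (+-comm _ _) (+-cong (-‿distribʳ-* P S)
                 (trans (sym (-‿involutive _))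
                   (trans (-‿cong (-‿distribʳ-* Q S)) (-‿distribˡ-* Q (- S)))))) ⟩
        (P * R′ + - Q * R′) + (P * - S + - Q * - S)
          ≈⟨ +-cong (sym (distribʳ R′ P (- Q))) (sym (distribʳ (- S) P (- Q))) ⟩
        (P - Q) * R′ + (P - Q) * - S
          ≈⟨ sym (distribˡ (P - Q) R′ (- S)) ⟩
        (P - Q) * (R′ - S) ∎
        where
        P = ι p
        Q = ι q
        R′ = ι r
        S = ι s

      morphism : differences -Raw-AlmostCommutative⟶ ring′
      morphism = record
        { ⟦_⟧    = ⟦_⟧
        ; +-homo = λ x y → lift₂ +-cong x y (RawRing._+_ differences x y) (+-homo x y)
        ; *-homo = λ x y → lift₂ *-cong x y (RawRing._*_ differences x y) (*-homo x y)
        ; -‿homo = λ (p , q) → begin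
            ⟦ q , p ⟧          ≈⟨ ⟦⟧≈⟦⟧′ (q , p) ⟩
            ι q - ι p          ≈⟨ +-comm _ _ ⟩
            - ι p + ι q        ≈⟨ +-congˡ (sym (-‿involutive _)) ⟩
            - ι p + - - ι q    ≈⟨ ⁻¹-∙-comm _ _ ⟩
            - (ι p - ι q)      ≈⟨ -‿cong (sym (⟦⟧≈⟦⟧′ (p , q))) ⟩
            - ⟦ p , q ⟧        ∎
        ; 0-homo = refl
        ; 1-homo = refl
        }

      _≟′_ : ∀ x y → Maybe (⟦ x ⟧ ≈ ⟦ y ⟧)
      x ≟′ y with ≡-dec ℕₚ._≟_ ℕₚ._≟_ x y
      ... | yes eq = just (reflexive (≡.cong ⟦_⟧ eq))
      ... | no _   = nothing

    open Algebra.Solver.Ring differences ring′ morphism _≟′_ public using (solve; _:=_; _:+_; _:*_; _:-_; :-_; con)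

    :1 : ∀ {n} → Algebra.Solver.Ring.Polynomial differences ring′ morphism _≟′_ n
    :1 = con (1 , 0)

    :0 : ∀ {n} → Algebra.Solver.Ring.Polynomial differences ring′ morphism _≟′_ n
    :0 = con (0 , 0)

  -- Positivity rather than the order is primitive. Over the Cauchy reals it carries a rational gap,
  -- whereas `¬ Pos (- x)` is a purely negative notion of nonnegativity; `pos-+-nonneg` lets the two
  -- be added.
  record OrderedRing : Set₁ where
    field
      commutativeRing : CommutativeRing 0ℓ 0ℓ
    open CommutativeRing commutativeRing public
    field
      Pos          : Carrier → Set
      pos-resp     : ∀ {x y} → x ≈ y → Pos x → Pos y
      pos-1        : Pos 1#
      pos-asym     : ∀ {x} → Pos x → ¬ Pos (- x)
      pos-+-nonneg : ∀ {x y} → Pos x → ¬ Pos (- y) → Pos (x + y)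
      pos-*        : ∀ {x y} → Pos x → Pos y → Pos (x * y)
      -- The trichotomy holds inside a monad T: the identity for the rationals,
      -- double negation for the reals.
      T            : Set → Set
      return       : ∀ {A} → A → T A
      _>>=_        : ∀ {A B} → T A → (A → T B) → T B
      run          : ∀ {A} → T A → ¬ ¬ A
      trichotomy   : ∀ x → T (Pos x ⊎ x ≈ 0# ⊎ Pos (- x))

  module Forms (F : OrderedRing) where
    open OrderedRing F hiding (zero)
    open Algebra.Properties.Semiring.Sum semiring
    open Algebra.Properties.Ring ring using (-0#≈0#; -‿distribʳ-*; -‿distribˡ-*)
    open IntegerCoefficients commutativeRing
    open Relation.Binary.Reasoning.Setoid setoid

    NonNeg : Carrier → Set
    NonNeg x = ¬ Pos (- x)

    nonneg-resp : ∀ {x y} → x ≈ y → NonNeg x → NonNeg y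
    nonneg-resp x≈y x≥0 = x≥0 ∘ pos-resp (-‿cong (sym x≈y))

    pos⇒nonneg : ∀ {x} → Pos x → NonNeg x
    pos⇒nonneg = pos-asym

    ≈0⇒nonneg : ∀ {x} → x ≈ 0# → NonNeg x
    ≈0⇒nonneg x≈0 -x>0 = pos-asym 0>0 (pos-resp (sym -0#≈0#) 0>0)
      where 0>0 = pos-resp (trans (-‿cong x≈0) -0#≈0#) -x>0

    -- The goal is a negation, so the trichotomy may be used through `run` although it holds only
    -- inside `T`.
    nonneg-elim : ∀ {x z} → NonNeg x → (Pos x ⊎ x ≈ 0# → NonNeg z) → NonNeg z
    nonneg-elim {x} x≥0 f -z>0 = run (trichotomy x) λ
      { (inj₁ x>0) → f (inj₁ x>0) -z>0
      ; (inj₂ (inj₁ x≈0)) → f (inj₂ x≈0) -z>0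
      ; (inj₂ (inj₂ -x>0)) → x≥0 -x>0 }

    pos-+ : ∀ {x y} → Pos x → Pos y → Pos (x + y)
    pos-+ x>0 y>0 = pos-+-nonneg x>0 (pos⇒nonneg y>0)

    nonneg-+ : ∀ {x y} → NonNeg x → NonNeg y → NonNeg (x + y)
    nonneg-+ {x} {y} x≥0 y≥0 = nonneg-elim x≥0 λ
      { (inj₁ x>0) → pos⇒nonneg (pos-+-nonneg x>0 y≥0)
      ; (inj₂ x≈0) → nonneg-resp (trans (sym (+-identityˡ y)) (+-congʳ (sym x≈0))) y≥0 }

    nonneg-* : ∀ {x y} → NonNeg x → NonNeg y → NonNeg (x * y)
    nonneg-* {x} {y} x≥0 y≥0 = nonneg-elim x≥0 λ
      { (inj₂ x≈0) → ≈0⇒nonneg (trans (*-congʳ x≈0) (zeroˡ y))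
      ; (inj₁ x>0) → nonneg-elim y≥0 λ
        { (inj₂ y≈0) → ≈0⇒nonneg (trans (*-congˡ y≈0) (zeroʳ x))
        ; (inj₁ y>0) → pos⇒nonneg (pos-* x>0 y>0) } }

    pos-square : ∀ {x} → Pos x ⊎ Pos (- x) → Pos (x * x)
    pos-square (inj₁ x>0) = pos-* x>0 x>0
    pos-square {x} (inj₂ -x>0) =
      pos-resp (solve 1 (λ x → (:- x) :* (:- x) := x :* x) refl x) (pos-* -x>0 -x>0)

    nonneg-square : ∀ x → NonNeg (x * x)
    nonneg-square x -x²>0 = run (trichotomy x) λ
      { (inj₁ x>0) → pos⇒nonneg (pos-square (inj₁ x>0)) -x²>0
      ; (inj₂ (inj₁ x≈0)) → ≈0⇒nonneg (trans (*-congʳ x≈0) (zeroˡ x)) -x²>0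
      ; (inj₂ (inj₂ -x>0)) → pos⇒nonneg (pos-square (inj₂ -x>0)) -x²>0 }

    pos-*-cancel : ∀ {a x} → Pos a → NonNeg (a * x) → NonNeg x
    pos-*-cancel {a} {x} a>0 ax≥0 -x>0 =
      ax≥0 (pos-resp (sym (-‿distribʳ-* a x)) (pos-* a>0 -x>0))

    infixl 6 _⊕_
    _⊕_ = nonneg-+

    Square : ℕ → Set
    Square n = Fin n → Fin n → Carrier

    infixl 8 _∙_
    -- The product binds tighter than multiplication: `v ∙ w * v ∙ w` is the square of an inner
    -- product.
    _∙_ : ∀ {n} → Vector Carrier n → Vector Carrier n → Carrier
    v ∙ w = sum λ i → v i * w i

    norm² : ∀ {n} → Vector Carrier n → Carrier
    norm² w = w ∙ w

    form : ∀ {n} → Square n → Vector Carrier n → Carrier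
    form M w = w ∙ λ i → M i ∙ w

    IsSymmetric : ∀ {n} → Square n → Set
    IsSymmetric M = ∀ i j → M i j ≈ M j i

    minor : ∀ {n} → Square (suc n) → Square n
    minor M i j = M (suc i) (suc j)

    row : ∀ {n} → Square (suc n) → Vector Carrier n
    row M j = M zero (suc j)

    infixr 5 _◂_
    _◂_ : ∀ {n} → Carrier → Vector Carrier n → Vector Carrier (suc n)
    _◂_ = Vector._∷_

    ∙-cong : ∀ {n} {v v′ w w′ : Vector Carrier n} →
      (∀ i → v i ≈ v′ i) → (∀ i → w i ≈ w′ i) → v ∙ w ≈ v′ ∙ w′
    ∙-cong p q = sum-cong-≋ λ i → *-cong (p i) (q i)

    ∙-scaleʳ : ∀ {n} a (v w : Vector Carrier n) → v ∙ (λ i → a * w i) ≈ a * v ∙ w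
    ∙-scaleʳ a v w = begin
      sum (λ i → v i * (a * w i))
        ≈⟨ sum-cong-≋ (λ i → solve 3 (λ x a y → x :* (a :* y) := a :* (x :* y)) refl (v i) a (w i)) ⟩
      sum (λ i → a * (v i * w i))
        ≈⟨ sym (*-distribˡ-sum a (λ i → v i * w i)) ⟩
      a * v ∙ w ∎

    ∙-+ʳ : ∀ {n} (v w w′ : Vector Carrier n) → v ∙ (λ i → w i + w′ i) ≈ v ∙ w + v ∙ w′
    ∙-+ʳ v w w′ = begin
      sum (λ i → v i * (w i + w′ i))
        ≈⟨ sum-cong-≋ (λ i → distribˡ (v i) (w i) (w′ i)) ⟩
      sum (λ i → v i * w i + v i * w′ i)
        ≈⟨ ∑-distrib-+ (λ i → v i * w i) (λ i → v i * w′ i) ⟩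
      v ∙ w + v ∙ w′ ∎

    ∙-comm : ∀ {n} (v w : Vector Carrier n) → v ∙ w ≈ w ∙ v
    ∙-comm v w = sum-cong-≋ λ i → *-comm (v i) (w i)

    ∙-zeroʳ : ∀ {n} (v : Vector Carrier n) → v ∙ (λ _ → 0#) ≈ 0#
    ∙-zeroʳ {n} v = trans (sum-cong-≋ λ i → zeroʳ (v i)) (sum-replicate-zero n)

    form-∷ : ∀ {n} (M : Square (suc n)) → IsSymmetric M → ∀ x w →
      form M (x ◂ w) ≈ M zero zero * (x * x) + (row M ∙ w + row M ∙ w) * x + form (minor M) w
    form-∷ M symm x w = begin
      x * (a * x + row M ∙ w) + w ∙ (λ i → M (suc i) zero * x + minor M i ∙ w)
        ≈⟨ +-congˡ (trans (∙-+ʳ w _ _) (+-congʳ (trans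
             (∙-cong {w′ = λ i → x * row M i} (λ _ → refl)
                λ i → trans (*-congʳ (symm (suc i) zero)) (*-comm _ _))
             (trans (∙-scaleʳ x w (row M)) (*-congˡ (∙-comm w (row M))))))) ⟩
      x * (a * x + row M ∙ w) + (x * row M ∙ w + form (minor M) w)
        ≈⟨ solve 4 (λ a x l f → x :* (a :* x :+ l) :+ (x :* l :+ f)
             := a :* (x :* x) :+ (l :+ l) :* x :+ f) refl a x (row M ∙ w) _ ⟩
      a * (x * x) + (row M ∙ w + row M ∙ w) * x + form (minor M) w ∎
      where
      a = M zero zero

    form-zero : ∀ {n} (M : Square n) → form M (λ _ → 0#) ≈ 0#
    form-zero M = trans (∙-comm (λ _ → 0#) (λ i → M i ∙ λ _ → 0#)) (∙-zeroʳ (λ i → M i ∙ λ _ → 0#))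

    single : ∀ {n} → Fin n → Carrier → Vector Carrier n
    single zero    c = c ◂ λ _ → 0#
    single (suc j) c = 0# ◂ single j c

    ∙-single : ∀ {n} (v : Vector Carrier n) j c → v ∙ single j c ≈ v j * c
    ∙-single v zero    c = trans (+-congˡ (∙-zeroʳ (v ∘ suc))) (+-identityʳ _)
    ∙-single v (suc j) c = trans (+-cong (zeroʳ _) (∙-single (v ∘ suc) j c)) (+-identityˡ _)

    form-single : ∀ {n} (M : Square n) j c → form M (single j c) ≈ c * (M j j * c)
    form-single M j c = trans
      (∙-comm (single j c) _)
      (trans (∙-single (λ i → M i ∙ single j c) j c)
        (trans (*-congʳ (∙-single (M j) j c)) (*-comm _ _)))

    norm²-nonneg : ∀ {n} (w : Vector Carrier n) → NonNeg (norm² w)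
    norm²-nonneg {zero}  w = ≈0⇒nonneg refl
    norm²-nonneg {suc n} w = nonneg-square (w zero) ⊕ norm²-nonneg (w ∘ suc)

    single-swap : ∀ {n} (i j : Fin n) c → single i c j ≈ single j c i
    single-swap zero    zero    c = refl
    single-swap zero    (suc j) c = refl
    single-swap (suc i) zero    c = refl
    single-swap (suc i) (suc j) c = single-swap i j c

    shift : ∀ {n} → Square n → Carrier → Square n
    shift M c i j = M i j - single i c j

    shift-symmetric : ∀ {n} (M : Square n) → IsSymmetric M → ∀ c → IsSymmetric (shift M c)
    shift-symmetric M symm c i j = +-cong (symm i j) (-‿cong (single-swap i j c))

    shift-∙ : ∀ {n} (M : Square n) c i w → shift M c i ∙ w ≈ M i ∙ w - c * w i
    shift-∙ M c i w = begin
      shift M c i ∙ w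
        ≈⟨ ∙-comm (shift M c i) w ⟩
      w ∙ (λ j → M i j - single i c j)
        ≈⟨ ∙-+ʳ w (M i) (λ j → - single i c j) ⟩
      w ∙ M i + w ∙ (λ j → - single i c j)
        ≈⟨ +-cong (∙-comm w (M i)) (∙-cong {v = w} (λ _ → refl) λ j →
             solve 1 (λ x → :- x := (:- :1) :* x) refl (single i c j)) ⟩
      M i ∙ w + w ∙ (λ j → - 1# * single i c j)
        ≈⟨ +-congˡ (trans (∙-scaleʳ (- 1#) w (single i c)) (*-congˡ (∙-single w i c))) ⟩
      M i ∙ w + - 1# * (w i * c)
        ≈⟨ solve 3 (λ m x c → m :+ (:- :1) :* (x :* c) := m :- c :* x) refl (M i ∙ w) (w i) c ⟩
      M i ∙ w - c * w i ∎

    form-shift : ∀ {n} (M : Square n) c w → form (shift M c) w ≈ form M w - c * norm² w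
    form-shift M c w = begin
      w ∙ (λ i → shift M c i ∙ w)
        ≈⟨ ∙-cong {v = w} (λ _ → refl) (λ i → trans (shift-∙ M c i w)
             (solve 3 (λ m c x → m :- c :* x := m :+ (:- c) :* x) refl (M i ∙ w) c (w i))) ⟩
      w ∙ (λ i → M i ∙ w + - c * w i)
        ≈⟨ ∙-+ʳ w (λ i → M i ∙ w) (λ i → - c * w i) ⟩
      form M w + w ∙ (λ i → - c * w i)
        ≈⟨ +-congˡ (trans (∙-scaleʳ (- c) w w) (sym (-‿distribˡ-* c (norm² w)))) ⟩
      form M w - c * norm² w ∎

    norm²-pos : ∀ {n} (w : Vector Carrier n) i → Pos (w i) ⊎ Pos (- w i) → Pos (norm² w)
    norm²-pos w zero    p = pos-+-nonneg (pos-square p) (norm²-nonneg (w ∘ suc))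
    norm²-pos w (suc i) p = pos-resp (+-comm _ _)
      (pos-+-nonneg (norm²-pos (w ∘ suc) i p) (nonneg-square (w zero)))

    -- Cauchy-Schwarz with an unspecified constant is enough. The induction step is (c x + r)² + (c
    -- x - r)² = 2 c² x² + 2 r², with c x the new term and r the product of the tails.
    ∙-bounded : ∀ {n} (v : Vector Carrier n) →
      ∃[ K ] NonNeg K × ∀ w → NonNeg (K * norm² w - v ∙ w * v ∙ w)
    ∙-bounded {zero} v = 0# , ≈0⇒nonneg refl , λ w →
      ≈0⇒nonneg (solve 0 (:0 :* :0 :- :0 :* :0 := :0) refl)
    ∙-bounded {suc n} v with K , K≥0 , bound ← ∙-bounded (v ∘ suc) =
      c * c + c * c + (K + K) ,
      nonneg-square c ⊕ nonneg-square c ⊕ (K≥0 ⊕ K≥0) ,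
      λ w → nonneg-resp
        (solve 5 (λ c K x N r →
            (c :* c :+ c :* c) :* N :+ (K :+ K) :* (x :* x)
              :+ ((K :* N :- r :* r) :+ (K :* N :- r :* r)) :+ (c :* x :- r) :* (c :* x :- r)
            := (c :* c :+ c :* c :+ (K :+ K)) :* (x :* x :+ N) :- (c :* x :+ r) :* (c :* x :+ r))
          refl c K (w zero) (norm² (w ∘ suc)) (v ∘ suc ∙ w ∘ suc))
        (nonneg-* (nonneg-square c ⊕ nonneg-square c) (norm²-nonneg (w ∘ suc))
          ⊕ nonneg-* (K≥0 ⊕ K≥0) (nonneg-square (w zero))
          ⊕ (bound (w ∘ suc) ⊕ bound (w ∘ suc)) ⊕ nonneg-square _)
      where c = v zero

    -- Supplies the left end of the first bracket of the bisection.
    form-bounded-below : ∀ {n} (M : Square n) → IsSymmetric M →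
      ∃[ K ] NonNeg K × ∀ w → NonNeg (K * norm² w + form M w)
    form-bounded-below {zero} M symm = 0# , ≈0⇒nonneg refl , λ w →
      ≈0⇒nonneg (solve 0 (:0 :* :0 :+ :0 := :0) refl)
    form-bounded-below {suc n} M symm
      with K , K≥0 , bound ← ∙-bounded (row M)
         | L , L≥0 , below ← form-bounded-below (minor M) (λ i j → symm (suc i) (suc j)) =
      a * a + 1# + 1# + (K + L) ,
      C≥0 ,
      λ w → let x = w zero; w′ = w ∘ suc; N≥0 = norm²-nonneg w′; x²≥0 = nonneg-square x
                B = bound w′; l = row M ∙ w′ in
        -- Doubling turns a² + a + 1 into the sum of squares (a + 1)² + a² + 1, which absorbs a
        -- pivot of either sign without fractions.
        pos-*-cancel 2>0 (nonneg-resp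
          (trans
            (solve 7 (λ a K L x N l f →
                (a :+ :1) :* (a :+ :1) :* (x :* x) :+ (a :* a) :* (x :* x) :+ x :* x
                  :+ ((K :+ L) :+ (K :+ L)) :* (x :* x)
                  :+ ((a :* a :+ :1 :+ :1) :* N :+ (a :* a :+ :1 :+ :1) :* N)
                  :+ ((K :* N :- l :* l) :+ (K :* N :- l :* l))
                  :+ ((L :* N :+ f) :+ (L :* N :+ f)) :+ ((x :+ l) :* (x :+ l) :+ (x :+ l) :* (x :+ l))
                := (:1 :+ :1) :* ((a :* a :+ :1 :+ :1 :+ (K :+ L)) :* (x :* x :+ N)
                     :+ (a :* (x :* x) :+ (l :+ l) :* x :+ f)))
              refl a K L x (norm² w′) l (form (minor M) w′))
            (*-congˡ (+-congˡ (sym (form-∷′ w)))))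
          (nonneg-* (nonneg-square (a + 1#)) x²≥0 ⊕ nonneg-* a²≥0 x²≥0 ⊕ x²≥0
            ⊕ nonneg-* (K≥0 ⊕ L≥0 ⊕ (K≥0 ⊕ L≥0)) x²≥0
            ⊕ (nonneg-* (a²≥0 ⊕ 1≥0 ⊕ 1≥0) N≥0 ⊕ nonneg-* (a²≥0 ⊕ 1≥0 ⊕ 1≥0) N≥0)
            ⊕ (B ⊕ B) ⊕ (below w′ ⊕ below w′) ⊕ (nonneg-square (x + l) ⊕ nonneg-square (x + l))))
      where
      a = M zero zero
      form-∷′ = λ w → form-∷ M symm (w zero) (w ∘ suc)
      2>0 = pos-+ pos-1 pos-1
      1≥0 = pos⇒nonneg pos-1
      a²≥0 = nonneg-square a
      C≥0 = a²≥0 ⊕ 1≥0 ⊕ 1≥0 ⊕ (K≥0 ⊕ L≥0)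

    -- `Definite` is a lower bound by p / K times the squared norm, written without division. The
    -- cases of `Signature` correspond to a negative, zero or positive smallest eigenvalue.
    Indefinite Semidefinite Kernel Definite : ∀ {n} → Square n → Set
    Indefinite M = ∃[ w ] Pos (- form M w)
    Semidefinite M = ∀ w → NonNeg (form M w)
    Kernel M = ∃[ v ] (∃[ i ] (Pos (v i) ⊎ Pos (- v i))) × ∀ i → M i ∙ v ≈ 0#
    Definite M = ∃[ p ] ∃[ K ] Pos p × Pos K × ∀ w → NonNeg (K * form M w - p * norm² w)

    Signature : ∀ {n} → Square n → Set
    Signature M = Indefinite M ⊎ Semidefinite M × (Kernel M ⊎ Definite M)

    module NegativePivot {n} (M : Square (suc n)) (symm : IsSymmetric M) where
      signature : Pos (- M zero zero) → Signature M
      signature -a>0 = inj₁ (1# ◂ (λ _ → 0#) , pos-resp (-‿cong (sym eq)) -a>0)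
        where
        a = M zero zero
        eq : form M (1# ◂ λ _ → 0#) ≈ a
        eq = trans (form-∷ M symm 1# _) (trans
          (+-cong (+-congˡ (*-congʳ (+-cong (∙-zeroʳ (row M)) (∙-zeroʳ (row M))))) (form-zero (minor M)))
          (solve 1 (λ a → a :* (:1 :* :1) :+ (:0 :+ :0) :* :1 :+ :0 := a) refl a))

    module ZeroPivot {n} (M : Square (suc n)) (symm : IsSymmetric M) (a≈0 : M zero zero ≈ 0#) where
      form-∷₀ : ∀ x w → form M (x ◂ w) ≈ (row M ∙ w + row M ∙ w) * x + form (minor M) w
      form-∷₀ x w = trans (form-∷ M symm x w)
        (+-congʳ (trans (+-congʳ (trans (*-congʳ a≈0) (zeroˡ _))) (+-identityˡ _)))

      indefinite : ∀ j → Pos (row M j) ⊎ Pos (- row M j) → Indefinite M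
      -- With 2 b at place j the form is 4 b² (s + d), so s = -(d + 1) makes it -4 b² whatever d is.
      indefinite j b≉0 = s ◂ single j (b + b) , pos-resp (sym (trans (-‿cong eq)
          (solve 1 (λ y → :- (:- y) := y) refl _))) (pos-* 4>0 (pos-square b≉0))
        where
        b = row M j
        d = M (suc j) (suc j)
        s = - (d + 1#)
        2>0 = pos-+ pos-1 pos-1
        4>0 = pos-+ 2>0 2>0
        eq : form M (s ◂ single j (b + b)) ≈ - ((1# + 1# + (1# + 1#)) * (b * b))
        eq = trans (form-∷₀ s _) (trans
          (+-cong (*-congʳ (+-cong (∙-single (row M) j _) (∙-single (row M) j _)))
            (form-single (minor M) j (b + b)))
          (solve 2 (λ b d → (b :* (b :+ b) :+ b :* (b :+ b)) :* (:- (d :+ :1))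
              :+ (b :+ b) :* (d :* (b :+ b)) := :- ((:1 :+ :1 :+ (:1 :+ :1)) :* (b :* b)))
            refl b d))

      module ZeroRow (b≈0 : ∀ j → row M j ≈ 0#) where
        form-minor : ∀ x w → form M (x ◂ w) ≈ form (minor M) w
        form-minor x w = trans (form-∷₀ x w) (trans
          (+-congʳ (trans (*-congʳ (+-cong row∙w≈0 row∙w≈0)) (solve 1 (λ x → (:0 :+ :0) :* x := :0) refl x)))
          (+-identityˡ _))
          where
          row∙w≈0 : row M ∙ w ≈ 0#
          row∙w≈0 = trans (∙-comm (row M) w) (trans (∙-cong (λ _ → refl) b≈0) (∙-zeroʳ w))

        column≈0 : ∀ i → M i zero ≈ 0#
        column≈0 zero    = a≈0
        column≈0 (suc i) = trans (symm (suc i) zero) (b≈0 i)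

        signature : Signature (minor M) → Signature M
        signature (inj₁ (w , p)) = inj₁ (0# ◂ w , pos-resp (-‿cong (sym (form-minor 0# w))) p)
        -- With pivot and row both zero, the first unit vector lies in the kernel, whatever the
        -- minor is.
        signature (inj₂ (psd , _)) = inj₂
          ( (λ w → nonneg-resp (sym (form-minor (w zero) (w ∘ suc))) (psd (w ∘ suc)))
          , inj₁ ( single zero 1# , (zero , inj₁ pos-1)
                 , λ i → trans (∙-single (M i) zero 1#) (trans (*-identityʳ _) (column≈0 i))))

    module PositivePivot {n} (M : Square (suc n)) (symm : IsSymmetric M) (a>0 : Pos (M zero zero)) where
      a = M zero zero

      -- The Schur complement, multiplied by the pivot in order to avoid division.
      schur : Square n
      schur i j = a * minor M i j - row M i * row M j

      schur-symmetric : IsSymmetric schur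
      schur-symmetric i j = +-cong (*-congˡ (symm (suc i) (suc j))) (-‿cong (*-comm _ _))

      schur-∙ : ∀ i w → schur i ∙ w ≈ a * minor M i ∙ w - row M i * row M ∙ w
      schur-∙ i w = begin
        schur i ∙ w
          ≈⟨ sum-cong-≋ (λ j → solve 5 (λ a m r r′ x → (a :* m :- r :* r′) :* x
               := x :* (a :* m) :+ x :* ((:- r) :* r′)) refl a (minor M i j) (row M i) (row M j) (w j)) ⟩
        sum (λ j → w j * (a * minor M i j) + w j * (- row M i * row M j))
          ≈⟨ ∑-distrib-+ (λ j → w j * (a * minor M i j)) _ ⟩
        w ∙ (λ j → a * minor M i j) + w ∙ (λ j → - row M i * row M j)
          ≈⟨ +-cong (∙-scaleʳ a w _) (∙-scaleʳ (- row M i) w _) ⟩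
        a * w ∙ minor M i + - row M i * w ∙ row M
          ≈⟨ +-cong (*-congˡ (∙-comm w _)) (*-congˡ (∙-comm w _)) ⟩
        a * minor M i ∙ w + - row M i * row M ∙ w
          ≈⟨ +-congˡ (sym (-‿distribˡ-* _ _)) ⟩
        a * minor M i ∙ w - row M i * row M ∙ w ∎

      form-schur : ∀ w → form schur w ≈ a * form (minor M) w - row M ∙ w * row M ∙ w
      form-schur w = begin
        w ∙ (λ i → schur i ∙ w)
          ≈⟨ ∙-cong (λ _ → refl) (λ i → trans (schur-∙ i w)
               (+-congˡ (solve 2 (λ r l → :- (r :* l) := (:- l) :* r) refl (row M i) (row M ∙ w)))) ⟩
        w ∙ (λ i → a * minor M i ∙ w + - (row M ∙ w) * row M i)
          ≈⟨ ∙-+ʳ w _ _ ⟩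
        w ∙ (λ i → a * minor M i ∙ w) + w ∙ (λ i → - (row M ∙ w) * row M i)
          ≈⟨ +-cong (∙-scaleʳ a w _) (∙-scaleʳ (- (row M ∙ w)) w _) ⟩
        a * form (minor M) w + - (row M ∙ w) * w ∙ row M
          ≈⟨ +-congˡ (trans (*-congˡ (∙-comm w _)) (sym (-‿distribˡ-* _ _))) ⟩
        a * form (minor M) w - row M ∙ w * row M ∙ w ∎

      form-completed : ∀ x w →
        a * form M (x ◂ w) ≈ (a * x + row M ∙ w) * (a * x + row M ∙ w) + form schur w
      form-completed x w = trans (*-congˡ (form-∷ M symm x w)) (trans
        (solve 4 (λ a x l f → a :* (a :* (x :* x) :+ (l :+ l) :* x :+ f)
            := (a :* x :+ l) :* (a :* x :+ l) :+ (a :* f :- l :* l)) refl a x (row M ∙ w) (form (minor M) w))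
        (+-congˡ (sym (form-schur w))))

      -- The first coordinate makes the square in `form-completed` vanish; scaling the others by `a`
      -- avoids a division.
      lift : Vector Carrier n → Vector Carrier (suc n)
      lift w = - (row M ∙ w) ◂ λ i → a * w i

      form-lift : ∀ w → form M (lift w) ≈ a * form schur w
      form-lift w = begin
        form M (lift w)
          ≈⟨ form-∷ M symm _ _ ⟩
        a * (- l * - l) + (row M ∙ aw + row M ∙ aw) * - l + form (minor M) aw
          ≈⟨ +-cong (+-congˡ (*-congʳ (+-cong (∙-scaleʳ a _ w) (∙-scaleʳ a _ w))))
               (trans (trans (∙-comm aw _) (∙-scaleʳ a _ w)) (*-congˡ (trans (∙-comm _ w)
                 (trans (∙-cong (λ _ → refl) λ i → ∙-scaleʳ a (minor M i) w) (∙-scaleʳ a w _))))) ⟩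
        a * (- l * - l) + (a * l + a * l) * - l + a * (a * form (minor M) w)
          ≈⟨ solve 3 (λ a l f → a :* ((:- l) :* (:- l)) :+ (a :* l :+ a :* l) :* (:- l) :+ a :* (a :* f)
               := a :* (a :* f :- l :* l)) refl a l _ ⟩
        a * (a * form (minor M) w - l * l)
          ≈⟨ *-congˡ (sym (form-schur w)) ⟩
        a * form schur w ∎
        where
        l = row M ∙ w
        aw : Vector Carrier n
        aw i = a * w i

      lift-kernel : ∀ v → (∀ i → schur i ∙ v ≈ 0#) → ∀ i → M i ∙ lift v ≈ 0#
      lift-kernel v Sv≈0 zero = trans (+-congˡ (∙-scaleʳ a (row M) v))
        (solve 2 (λ a l → a :* (:- l) :+ a :* l := :0) refl a (row M ∙ v))
      lift-kernel v Sv≈0 (suc i) = begin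
        M (suc i) zero * - l + minor M i ∙ (λ j → a * v j)
          ≈⟨ +-cong (*-congʳ (symm (suc i) zero)) (∙-scaleʳ a (minor M i) v) ⟩
        row M i * - l + a * minor M i ∙ v
          ≈⟨ trans (+-comm _ _) (+-congˡ (sym (-‿distribʳ-* _ _))) ⟩
        a * minor M i ∙ v - row M i * l
          ≈⟨ trans (sym (schur-∙ i v)) (Sv≈0 i) ⟩
        0# ∎
        where l = row M ∙ v

      -- With y = a x + l, the identity (y - l)² + (y + l)² = 2 y² + 2 l² bounds (a x)². Then l² is
      -- at most K times the squared norm of the tail, and that norm is at most L f / p. The two
      -- constants collect these factors.
      definite : Semidefinite schur → Definite schur → Definite M
      definite psd (p , L , p>0 , L>0 , bound) with K , K≥0 , cs ← ∙-bounded (row M) =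
        a * a * p , (p + p + (a * a + (K + K)) * L) * a ,
        pos-* (pos-* a>0 a>0) p>0 ,
        pos-* (pos-+ (pos-+ p>0 p>0) (pos-* (pos-+-nonneg (pos-* a>0 a>0) (K≥0 ⊕ K≥0)) L>0)) a>0 ,
        λ w → let x = w zero; w′ = w ∘ suc; l = row M ∙ w′; N = norm² w′; f = form schur w′
                  p≥0 = pos⇒nonneg p>0 ; a² = nonneg-square a; y = a * x + l in
          nonneg-resp
            (trans (solve 8 (λ a p L K x l N f →
                (p :+ p) :* f :+ (a :* a :+ (K :+ K)) :* L :* ((a :* x :+ l) :* (a :* x :+ l))
                  :+ (a :* a :+ (K :+ K)) :* (L :* f :- p :* N)
                  :+ (p :+ p) :* (K :* N :- l :* l)
                  :+ p :* ((a :* x :+ l :+ l) :* (a :* x :+ l :+ l))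
                := (p :+ p :+ (a :* a :+ (K :+ K)) :* L) :* ((a :* x :+ l) :* (a :* x :+ l) :+ f)
                  :- a :* a :* p :* (x :* x :+ N)) refl a p L K x l N f)
              (+-congʳ (trans (*-congˡ (sym (form-completed x w′))) (sym (*-assoc _ a _)))))
            (nonneg-* (p≥0 ⊕ p≥0) (psd w′)
              ⊕ nonneg-* (nonneg-* (a² ⊕ (K≥0 ⊕ K≥0)) (pos⇒nonneg L>0)) (nonneg-square y)
              ⊕ nonneg-* (a² ⊕ (K≥0 ⊕ K≥0)) (bound w′)
              ⊕ nonneg-* (p≥0 ⊕ p≥0) (cs w′)
              ⊕ nonneg-* p≥0 (nonneg-square (a * x + l + l)))

      signature : Signature schur → Signature M
      signature (inj₁ (w , p)) = inj₁ (lift w , pos-resp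
        (trans (sym (-‿distribʳ-* a _)) (-‿cong (sym (form-lift w)))) (pos-* a>0 p))
      signature (inj₂ (psd , rest)) = inj₂
        ( (λ w → pos-*-cancel a>0 (nonneg-resp (sym (form-completed (w zero) (w ∘ suc)))
            (nonneg-square _ ⊕ psd (w ∘ suc))))
        , [ (λ (v , (i , vᵢ≉0) , Sv≈0) → inj₁ (lift v , (suc i , scaled vᵢ≉0) , lift-kernel v Sv≈0))
          , inj₂ ∘ definite psd ] rest)
        where
        scaled : ∀ {x} → Pos x ⊎ Pos (- x) → Pos (a * x) ⊎ Pos (- (a * x))
        scaled (inj₁ p) = inj₁ (pos-* a>0 p)
        scaled (inj₂ p) = inj₂ (pos-resp (sym (-‿distribʳ-* a _)) (pos-* a>0 p))

    apart-or-zero : ∀ {n} (b : Vector Carrier n) →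
      T ((∃[ j ] (Pos (b j) ⊎ Pos (- b j))) ⊎ ∀ j → b j ≈ 0#)
    apart-or-zero {zero} b = return (inj₂ λ ())
    apart-or-zero {suc n} b = trichotomy (b zero) >>= λ
      { (inj₁ p) → return (inj₁ (zero , inj₁ p))
      ; (inj₂ (inj₂ p)) → return (inj₁ (zero , inj₂ p))
      ; (inj₂ (inj₁ b₀≈0)) → apart-or-zero (b ∘ suc) >>= λ
        { (inj₁ (j , p)) → return (inj₁ (suc j , p))
        ; (inj₂ b≈0) → return (inj₂ λ { zero → b₀≈0 ; (suc j) → b≈0 j }) } }

    signature : ∀ {n} (M : Square n) → IsSymmetric M → T (Signature M)
    signature {zero} M symm = return (inj₂
      ( (λ w → ≈0⇒nonneg refl)
      , inj₂ (1# , 1# , pos-1 , pos-1 , λ w → ≈0⇒nonneg (solve 0 (:1 :* :0 :- :1 :* :0 := :0) refl))))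
    signature {suc n} M symm = trichotomy (M zero zero) >>= λ
      { (inj₂ (inj₂ -a>0)) → return (NegativePivot.signature M symm -a>0)
      ; (inj₁ a>0) → signature (PositivePivot.schur M symm a>0) (PositivePivot.schur-symmetric M symm a>0)
          >>= λ s → return (PositivePivot.signature M symm a>0 s)
      ; (inj₂ (inj₁ a≈0)) → apart-or-zero (row M) >>= λ
        { (inj₁ (j , b≉0)) → return (inj₁ (ZeroPivot.indefinite M symm a≈0 j b≉0))
        ; (inj₂ b≈0) → signature (minor M) (λ i j → symm (suc i) (suc j))
            >>= λ s → return (ZeroPivot.ZeroRow.signature M symm a≈0 b≈0 s) } }

    BoundedBelow : ∀ {n} → Square n → Carrier → Set
    BoundedBelow M c = ∀ w → NonNeg (form M w - c * norm² w)

    Eigenvector : ∀ {n} → Square n → Carrier → Vector Carrier n → Set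
    Eigenvector M c v = (∃[ i ] (Pos (v i) ⊎ Pos (- v i))) × ∀ i → M i ∙ v ≈ c * v i

    StrictlyBounded : ∀ {n} → Square n → Carrier → Set
    StrictlyBounded M c = ∃[ p ] ∃[ K ] Pos p × Pos K ×
      ∀ w → NonNeg (K * (form M w - c * norm² w) - p * norm² w)

    -- Elimination is applied to `shift M c`: a kernel vector is an eigenvector for `c`, and
    -- definiteness is a bound with room to spare.
    attained-or-strict : ∀ {n} (M : Square n) → IsSymmetric M → ∀ c → BoundedBelow M c →
      T ((∃[ v ] Eigenvector M c v) ⊎ StrictlyBounded M c)
    attained-or-strict M symm c bound =
      signature (shift M c) (shift-symmetric M symm c) >>= λ s → return (cases s)
      where
      cases : Signature (shift M c) → (∃[ v ] Eigenvector M c v) ⊎ StrictlyBounded M c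
      cases (inj₁ (w , p)) = ⊥-elim (bound w (pos-resp (-‿cong (form-shift M c w)) p))
      cases (inj₂ (_ , inj₁ (v , v≉0 , Sv≈0))) = inj₁ (v , v≉0 , λ i →
        trans (solve 2 (λ x y → x := (x :- y) :+ y) refl (M i ∙ v) (c * v i))
          (trans (+-congʳ (trans (sym (shift-∙ M c i v)) (Sv≈0 i))) (+-identityˡ _)))
      cases (inj₂ (_ , inj₂ (p , K , p>0 , K>0 , f))) = inj₂ (p , K , p>0 , K>0 , λ w →
        nonneg-resp (+-congʳ (*-congˡ (form-shift M c w))) (f w))

    eigenvalue-bound : ∀ {n} (M : Square n) c → BoundedBelow M c →
      ∀ ν v → Eigenvector M ν v → NonNeg (ν - c)
    eigenvalue-bound M c bound ν v ((i , vᵢ≉0) , Mv≈νv) = pos-*-cancel (norm²-pos v i vᵢ≉0)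
      (nonneg-resp
        (trans (+-congʳ (trans (∙-cong {v = v} (λ _ → refl) Mv≈νv) (∙-scaleʳ ν v v)))
          (solve 3 (λ x y n → x :* n :- y :* n := n :* (x :- y)) refl ν c (norm² v)))
        (bound v))

-- Cauchy reals and rationals as ordered rings

module RealNumbers where

  open QuadraticForms
  open import Algebra.Bundles using (CommutativeRing)
  open import Data.Empty using (⊥-elim)
  open import Data.Integer.Base using (+_)
  open import Data.Nat.Base as ℕ using (ℕ)
  import Data.Nat.Properties as ℕₚ
  open import Data.Product.Base using (∃-syntax; _×_; _,_; proj₁; proj₂)
  open import Data.Rational.Base as ℚ using (ℚ; 0ℚ; 1ℚ; ½; 1/_; _<_; _≤_; _+_; _-_; _*_; -_; ∣_∣)
  import Data.Rational.Properties as ℚₚ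
  open import Data.Sum.Base using (_⊎_; inj₁; inj₂)
  open import Function.Base using (_∘_; id)
  open import Level using (0ℓ)
  open import Relation.Binary.Definitions using (tri<; tri≈; tri>)
  open import Relation.Binary.PropositionalEquality as ≡ using (_≡_; refl; sym; trans; cong; subst)
  open import Relation.Nullary using (¬_; yes; no)

  private module ℚ-solver = IntegerCoefficients ℚₚ.+-*-commutativeRing
  open ℚ-solver using (solve; _:=_; _:+_; _:*_; _:-_; :-_; :0)

  0<-+ : ∀ {p q} → 0ℚ < p → 0ℚ < q → 0ℚ < p + q
  0<-+ = ℚₚ.+-mono-<

  0<-+-≤ : ∀ {p q} → 0ℚ < p → 0ℚ ≤ q → 0ℚ < p + q
  0<-+-≤ = ℚₚ.+-mono-<-≤

  0≤-+ : ∀ {p q} → 0ℚ ≤ p → 0ℚ ≤ q → 0ℚ ≤ p + q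
  0≤-+ = ℚₚ.+-mono-≤

  0<-* : ∀ {p q} → 0ℚ < p → 0ℚ < q → 0ℚ < p * q
  0<-* {p} {q} 0<p 0<q = ℚₚ.positive⁻¹ (p * q)
    {{ℚₚ.pos*pos⇒pos p {{ℚ.positive 0<p}} q {{ℚ.positive 0<q}}}}

  0≤-* : ∀ {p q} → 0ℚ ≤ p → 0ℚ ≤ q → 0ℚ ≤ p * q
  0≤-* {p} {q} 0≤p 0≤q = ℚₚ.nonNegative⁻¹ (p * q)
    {{ℚₚ.nonNeg*nonNeg⇒nonNeg p {{ℚ.nonNegative 0≤p}} q {{ℚ.nonNegative 0≤q}}}}

  <⇒0<- : ∀ {p q} → p < q → 0ℚ < q - p
  <⇒0<- {p} {q} p<q = subst (_< q - p) (ℚₚ.+-inverseʳ p) (ℚₚ.+-monoˡ-< (- p) p<q)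

  ≤⇒0≤- : ∀ {p q} → p ≤ q → 0ℚ ≤ q - p
  ≤⇒0≤- {p} {q} p≤q = subst (_≤ q - p) (ℚₚ.+-inverseʳ p) (ℚₚ.+-monoˡ-≤ (- p) p≤q)

  private
    p+[q-p] : ∀ p q → p + (q - p) ≡ q
    p+[q-p] = solve 2 (λ p q → p :+ (q :- p) := q) refl

  0<-⇒< : ∀ {p q} → 0ℚ < q - p → p < q
  0<-⇒< {p} {q} 0<q-p = ≡.subst₂ _<_ (ℚₚ.+-identityʳ p) (p+[q-p] p q) (ℚₚ.+-monoʳ-< p 0<q-p)

  0≤-⇒≤ : ∀ {p q} → 0ℚ ≤ q - p → p ≤ q
  0≤-⇒≤ {p} {q} 0≤q-p = ≡.subst₂ _≤_ (ℚₚ.+-identityʳ p) (p+[q-p] p q) (ℚₚ.+-monoʳ-≤ p 0≤q-p)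

  -- Used for certificates: a visibly positive expression is transported along an identity found by
  -- the ring solver.
  by< : ∀ {p q} → p ≡ q → 0ℚ < p → 0ℚ < q
  by< refl = id

  by≤ : ∀ {p q} → p ≡ q → 0ℚ ≤ p → 0ℚ ≤ q
  by≤ refl = id

  ¬0<⇒0≤ : ∀ {p} → ¬ 0ℚ < - p → 0ℚ ≤ p
  ¬0<⇒0≤ {p} ¬0<-p = ℚₚ.≮⇒≥ λ p<0 → ¬0<-p (by< (ℚₚ.+-identityˡ (- p)) (<⇒0<- p<0))

  0≤⇒¬0< : ∀ {p} → 0ℚ ≤ p → ¬ 0ℚ < - p
  0≤⇒¬0< {p} 0≤p 0<-p = ℚₚ.<-irrefl refl (by< (ℚₚ.+-inverseˡ p) (0<-+-≤ 0<-p 0≤p))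

  ∣∣<⇒< : ∀ {x ε} → ∣ x ∣ < ε → 0ℚ < ε - x × 0ℚ < ε + x
  ∣∣<⇒< {x} {ε} ∣x∣<ε = upper x ∣x∣<ε ,
    by< (cong (λ y → ε + y) (⁻¹-involutive x)) (upper (- x) (subst (_< ε) (sym (ℚₚ.∣-p∣≡∣p∣ x)) ∣x∣<ε))
    where
    open import Algebra.Properties.AbelianGroup ℚₚ.+-0-abelianGroup using (⁻¹-involutive)
    p≤∣p∣ : ∀ p → p ≤ ∣ p ∣
    p≤∣p∣ p with ℚₚ.≤-total 0ℚ p
    ... | inj₁ 0≤p = ℚₚ.≤-reflexive (sym (ℚₚ.0≤p⇒∣p∣≡p 0≤p))
    ... | inj₂ p≤0 = ℚₚ.≤-trans p≤0 (ℚₚ.0≤∣p∣ p)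
    upper : ∀ x → ∣ x ∣ < ε → 0ℚ < ε - x
    upper x lt = <⇒0<- (ℚₚ.≤-<-trans (p≤∣p∣ x) lt)

  <⇒∣∣< : ∀ {x ε} → 0ℚ < ε - x → 0ℚ < ε + x → ∣ x ∣ < ε
  <⇒∣∣< {x} {ε} p q with ℚₚ.∣p∣≡p∨∣p∣≡-p x
  ... | inj₁ eq = subst (_< ε) (sym eq) (0<-⇒< p)
  ... | inj₂ eq = subst (_< ε) (sym eq) (0<-⇒< (by< (solve 2 (λ e x → e :+ x := e :- (:- x)) refl ε x) q))

  0<½ : 0ℚ < ½
  0<½ = ℚₚ.positive⁻¹ ½

  0<1 : 0ℚ < 1ℚ
  0<1 = ℚₚ.positive⁻¹ 1ℚ

  half+half : ∀ x → ½ * x + ½ * x ≡ x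
  half+half x = trans (sym (ℚₚ.*-distribʳ-+ x ½ ½)) (ℚₚ.*-identityˡ x)

  halve : ∀ {ε} → 0ℚ < ε → ∃[ δ ] 0ℚ < δ × δ + δ ≡ ε
  halve {ε} 0<ε = ½ * ε , 0<-* 0<½ 0<ε , half+half ε

  divide : ∀ {b ε} → 0ℚ < b → 0ℚ < ε → ∃[ δ ] 0ℚ < δ × b * δ ≡ ε
  divide {b} {ε} 0<b 0<ε =
    1/ b * ε , 0<-* (ℚₚ.positive⁻¹ (1/ b) {{ℚₚ.1/pos⇒pos b}}) 0<ε ,
    trans (sym (ℚₚ.*-assoc b (1/ b) ε)) (trans (cong (_* ε) (ℚₚ.*-inverseʳ b)) (ℚₚ.*-identityˡ ε))
    where
    instance
      b-pos : ℚ.Positive b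
      b-pos = ℚ.positive 0<b
      b-nonZero : ℚ.NonZero b
      b-nonZero = ℚₚ.pos⇒nonZero b

  Eventually : (ℕ → Set) → Set
  Eventually P = ∃[ N ] (∀ n → N ℕ.≤ n → P n)

  always : ∀ {P : ℕ → Set} → (∀ n → P n) → Eventually P
  always p = 0 , λ n _ → p n

  both : ∀ {P Q R : ℕ → Set} → (∀ n → P n → Q n → R n) → Eventually P → Eventually Q → Eventually R
  both f (M , p) (N , q) = M ℕ.⊔ N , λ n le →
    f n (p n (ℕₚ.m⊔n≤o⇒m≤o M N le)) (q n (ℕₚ.m⊔n≤o⇒n≤o M N le))

  map′ : ∀ {P Q : ℕ → Set} → (∀ n → P n → Q n) → Eventually P → Eventually Q
  map′ f (M , p) = M , λ n le → f n (p n le)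

  some : ∀ {P : ℕ → Set} → Eventually P → ∃[ n ] P n
  some (N , p) = N , p N ℕₚ.≤-refl

  Null : (ℕ → ℚ) → Set
  Null x = ∀ ε → 0ℚ < ε → Eventually λ n → ∣ x n ∣ < ε

  null-resp : ∀ {x y} → (∀ n → x n ≡ y n) → Null x → Null y
  null-resp x≡y nx ε 0<ε = map′ (λ n → subst (λ z → ∣ z ∣ < ε) (x≡y n)) (nx ε 0<ε)

  null-neg : ∀ {x} → Null x → Null (-_ ∘ x)
  null-neg {x} nx ε 0<ε = map′ (λ n → subst (_< ε) (sym (ℚₚ.∣-p∣≡∣p∣ (x n)))) (nx ε 0<ε)

  null-+ : ∀ {x y} → Null x → Null y → Null (λ n → x n + y n)
  null-+ {x} {y} nx ny ε 0<ε with δ , 0<δ , refl ← halve 0<ε =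
    both (λ n p q → ℚₚ.≤-<-trans (ℚₚ.∣p+q∣≤∣p∣+∣q∣ (x n) (y n)) (ℚₚ.+-mono-< p q)) (nx δ 0<δ) (ny δ 0<δ)

  Bounded : (ℕ → ℚ) → Set
  Bounded x = ∃[ B ] 0ℚ < B × Eventually λ n → ∣ x n ∣ < B

  bounded : ∀ x → Bounded (seq x)
  bounded x with N , close ← cauchy x 1ℚ 0<1 =
    B , ℚₚ.+-mono-≤-< (ℚₚ.0≤∣p∣ (seq x N)) 0<1 , N , λ n N≤n → subst (λ z → ∣ z ∣ < B)
      (p+[q-p] (seq x N) (seq x n))
      (ℚₚ.≤-<-trans (ℚₚ.∣p+q∣≤∣p∣+∣q∣ (seq x N) (seq x n - seq x N))
        (ℚₚ.+-monoʳ-< ∣ seq x N ∣ (close n N N≤n ℕₚ.≤-refl)))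
    where B = ∣ seq x N ∣ + 1ℚ

  null-* : ∀ {x y} → Bounded x → Null y → Null (λ n → x n * y n)
  null-* {x} {y} (B , 0<B , bx) ny ε 0<ε with δ , 0<δ , refl ← divide 0<B 0<ε =
    both (λ n p q → subst (_< B * δ) (sym (ℚₚ.∣p*q∣≡∣p∣*∣q∣ (x n) (y n))) (0<-⇒<
      (by< (solve 4 (λ B d x y → (B :- x) :* d :+ x :* (d :- y) := B :* d :- x :* y) refl
          B δ ∣ x n ∣ ∣ y n ∣)
        (0<-+-≤ (0<-* (<⇒0<- p) 0<δ) (0≤-* (ℚₚ.0≤∣p∣ (x n)) (ℚₚ.<⇒≤ (<⇒0<- q)))))))
      bx (ny δ 0<δ)

  infix 8 -ℝ_
  -ℝ_ : ℝ → ℝ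
  -ℝ x = mkℝ (λ n → - seq x n) λ ε 0<ε → let N , close = cauchy x ε 0<ε in
    N , λ m n p q → subst (_< ε)
      (trans (sym (ℚₚ.∣-p∣≡∣p∣ _)) (cong ∣_∣ (solve 2 (λ a b → :- (a :- b) := (:- a) :- (:- b)) refl (seq x m) (seq x n))))
      (close m n p q)

  ≡⇒≃ : ∀ x y → (∀ n → seq x n ≡ seq y n) → x ≃ y
  ≡⇒≃ x y eq ε 0<ε = always λ n → subst (λ z → ∣ z ∣ < ε)
    (trans (sym (ℚₚ.+-inverseʳ (seq x n))) (cong (λ z → seq x n - z) (eq n))) 0<ε

  ≃-sym : ∀ {x y} → x ≃ y → y ≃ x
  ≃-sym {x} {y} p = null-resp (λ n → solve 2 (λ a b → :- (a :- b) := b :- a) refl (seq x n) (seq y n)) (null-neg p)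

  ≃-trans : ∀ {x y z} → x ≃ y → y ≃ z → x ≃ z
  ≃-trans {x} {y} {z} p q = null-resp
    (λ n → solve 3 (λ a b c → (a :- b) :+ (b :- c) := a :- c) refl (seq x n) (seq y n) (seq z n)) (null-+ p q)

  +ℝ-cong : ∀ {x x′ y y′} → x ≃ x′ → y ≃ y′ → x +ℝ y ≃ x′ +ℝ y′
  +ℝ-cong {x} {x′} {y} {y′} p q = null-resp
    (λ n → solve 4 (λ a b c d → (a :- b) :+ (c :- d) := (a :+ c) :- (b :+ d)) refl
      (seq x n) (seq x′ n) (seq y n) (seq y′ n)) (null-+ p q)

  *ℝ-cong : ∀ {x x′ y y′} → x ≃ x′ → y ≃ y′ → x *ℝ y ≃ x′ *ℝ y′
  *ℝ-cong {x} {x′} {y} {y′} p q = null-resp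
    (λ n → solve 4 (λ a b c d → a :* (c :- d) :+ d :* (a :- b) := a :* c :- b :* d) refl
      (seq x n) (seq x′ n) (seq y n) (seq y′ n))
    (null-+ (null-* (bounded x) q) (null-* (bounded y′) p))

  -ℝ-cong : ∀ {x y} → x ≃ y → -ℝ x ≃ -ℝ y
  -ℝ-cong {x} {y} p = null-resp
    (λ n → solve 2 (λ a b → :- (a :- b) := (:- a) :- (:- b)) refl (seq x n) (seq y n)) (null-neg p)

  ℝ-commutativeRing : CommutativeRing 0ℓ 0ℓ
  ℝ-commutativeRing = record
    { Carrier = ℝ ; _≈_ = _≃_ ; _+_ = _+ℝ_ ; _*_ = _*ℝ_ ; -_ = -ℝ_ ; 0# = 0ℝ ; 1# = 1ℝ
    ; isCommutativeRing = record
      { isRing = record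
        { +-isAbelianGroup = record
          { isGroup = record
            { isMonoid = record
              { isSemigroup = record
                { isMagma = record
                  { isEquivalence = record
                    { refl = λ {x} → ≡⇒≃ x x λ _ → refl
                    ; sym = λ {x} {y} → ≃-sym {x} {y}
                    ; trans = λ {x} {y} {z} → ≃-trans {x} {y} {z} }
                  ; ∙-cong = λ {x} {x′} {y} {y′} → +ℝ-cong {x} {x′} {y} {y′} }
                ; assoc = λ x y z → ≡⇒≃ ((x +ℝ y) +ℝ z) (x +ℝ (y +ℝ z)) λ n → ℚₚ.+-assoc (seq x n) (seq y n) (seq z n) }
              ; identity = (λ x → ≡⇒≃ (0ℝ +ℝ x) x λ n → ℚₚ.+-identityˡ (seq x n))
                         , (λ x → ≡⇒≃ (x +ℝ 0ℝ) x λ n → ℚₚ.+-identityʳ (seq x n)) }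
            ; inverse = (λ x → ≡⇒≃ (-ℝ x +ℝ x) 0ℝ λ n → ℚₚ.+-inverseˡ (seq x n))
                      , (λ x → ≡⇒≃ (x +ℝ -ℝ x) 0ℝ λ n → ℚₚ.+-inverseʳ (seq x n))
            ; ⁻¹-cong = λ {x} {y} → -ℝ-cong {x} {y} }
          ; comm = λ x y → ≡⇒≃ (x +ℝ y) (y +ℝ x) λ n → ℚₚ.+-comm (seq x n) (seq y n) }
        ; *-cong = λ {x} {x′} {y} {y′} → *ℝ-cong {x} {x′} {y} {y′}
        ; *-assoc = λ x y z → ≡⇒≃ ((x *ℝ y) *ℝ z) (x *ℝ (y *ℝ z)) λ n → ℚₚ.*-assoc (seq x n) (seq y n) (seq z n)
        ; *-identity = (λ x → ≡⇒≃ (1ℝ *ℝ x) x λ n → ℚₚ.*-identityˡ (seq x n))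
                     , (λ x → ≡⇒≃ (x *ℝ 1ℝ) x λ n → ℚₚ.*-identityʳ (seq x n))
        ; distrib = (λ x y z → ≡⇒≃ (x *ℝ (y +ℝ z)) (x *ℝ y +ℝ x *ℝ z) λ n → ℚₚ.*-distribˡ-+ (seq x n) (seq y n) (seq z n))
                  , (λ x y z → ≡⇒≃ ((y +ℝ z) *ℝ x) (y *ℝ x +ℝ z *ℝ x) λ n → ℚₚ.*-distribʳ-+ (seq x n) (seq y n) (seq z n)) }
      ; *-comm = λ x y → ≡⇒≃ (x *ℝ y) (y *ℝ x) λ n → ℚₚ.*-comm (seq x n) (seq y n) } }

  Posℝ : ℝ → Set
  Posℝ x = ∃[ ε ] 0ℚ < ε × Eventually λ n → 0ℚ < seq x n - ε

  -- One late term decides, since the order of the rationals does: if it lies below -2 γ while all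
  -- later terms stay within γ of it, then -x is positive with gap γ.
  ¬pos-neg⇒nonneg : ∀ {x} → ¬ Posℝ (-ℝ x) → ∀ ε → 0ℚ < ε → Eventually λ n → 0ℚ < ε + seq x n
  ¬pos-neg⇒nonneg {x} ¬-x>0 ε 0<ε
    with δ , 0<δ , refl ← halve 0<ε
    with γ , 0<γ , refl ← halve 0<δ
    with N , close ← cauchy x γ 0<γ
    with (seq x N + (γ + γ)) ℚₚ.<? 0ℚ
  ... | yes x<-δ = ⊥-elim (¬-x>0 (γ , 0<γ , N , λ n N≤n →
          by< (solve 3 (λ g a b → (:0 :- (a :+ (g :+ g))) :+ (g :- (b :- a)) := (:- b) :- g) refl
                γ (seq x N) (seq x n))
            (0<-+ (<⇒0<- x<-δ) (proj₁ (∣∣<⇒< (close n N N≤n ℕₚ.≤-refl))))))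
  ... | no x≮-δ = N , λ n N≤n →
          by< (solve 3 (λ g a b → (g :+ (b :- a)) :+ g :+ (a :+ (g :+ g)) := (g :+ g) :+ (g :+ g) :+ b) refl
                γ (seq x N) (seq x n))
            (0<-+-≤ (0<-+ (proj₂ (∣∣<⇒< (close n N N≤n ℕₚ.≤-refl))) 0<γ) (ℚₚ.≮⇒≥ x≮-δ))

  nonneg-terms : ∀ {x} → (∀ n → 0ℚ ≤ seq x n) → ¬ Posℝ (-ℝ x)
  nonneg-terms {x} x≥0 (ε , 0<ε , ev) with n , p ← some ev =
    ℚₚ.<-irrefl refl (by< (solve 2 (λ x e → (:- x) :- e :+ e :+ x := :0) refl (seq x n) ε)
      (0<-+-≤ (0<-+ p 0<ε) (x≥0 n)))

  ℝ-orderedRing : OrderedRing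
  ℝ-orderedRing = record
    { commutativeRing = ℝ-commutativeRing
    ; Pos = Posℝ
    ; pos-resp = λ {x} {y} x≃y (ε , 0<ε , ev) →
        let δ , 0<δ , δ+δ≡ε = halve 0<ε in
        δ , 0<δ , both (λ n p q → by<
            (trans (cong (λ e → seq x n - e + (δ - (seq x n - seq y n))) (sym δ+δ≡ε))
              (solve 3 (λ x y d → x :- (d :+ d) :+ (d :- (x :- y)) := y :- d) refl (seq x n) (seq y n) δ))
            (0<-+ p (proj₁ (∣∣<⇒< q))))
          ev (x≃y δ 0<δ)
    ; pos-1 = ½ , 0<½ , always λ _ → 0<½
    ; pos-asym = λ {x} (ε , 0<ε , p) (δ , 0<δ , q) →
        let n , r = some (both (λ n p q → 0<-+ (0<-+ p q) (0<-+ 0<ε 0<δ)) p q) in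
        ℚₚ.<-irrefl refl (by< (solve 3 (λ x e d → x :- e :+ ((:- x) :- d) :+ (e :+ d) := :0) refl (seq x n) ε δ) r)
    ; pos-+-nonneg = λ {x} {y} (ε , 0<ε , p) y≥0 →
        let δ , 0<δ , δ+δ≡ε = halve 0<ε in
        δ , 0<δ , both (λ n p q → by<
            (trans (cong (λ e → seq x n - e + (δ + seq y n)) (sym δ+δ≡ε))
              (solve 3 (λ x y d → x :- (d :+ d) :+ (d :+ y) := x :+ y :- d) refl (seq x n) (seq y n) δ))
            (0<-+ p q))
          p (¬pos-neg⇒nonneg {y} y≥0 δ 0<δ)
    ; pos-* = λ {x} {y} (ε , 0<ε , p) (δ , 0<δ , q) →
        ε * δ , 0<-* 0<ε 0<δ , both (λ n p q → by<
            (solve 4 (λ x y e d → (x :- e) :* (y :- d) :+ (e :* (y :- d) :+ (x :- e) :* d) := x :* y :- e :* d) refl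
              (seq x n) (seq y n) ε δ)
            (0<-+ (0<-* p q) (0<-+ (0<-* 0<ε q) (0<-* p 0<δ))))
          p q
    ; T = λ A → ¬ ¬ A
    ; return = λ a k → k a
    ; _>>=_ = λ m f k → m λ a → f a k
    ; run = id
    -- If both signs are refuted, the terms are eventually within every ε of 0 from either side,
    -- which is `x ≃ 0ℝ`.
    ; trichotomy = λ x k → k (inj₂ (inj₁ λ ε 0<ε → both
        (λ n p q → <⇒∣∣<
          (by< (solve 2 (λ e x → e :+ (:- x) := e :- (x :- :0)) refl ε (seq x n)) p)
          (by< (solve 2 (λ e x → e :+ x := e :+ (x :- :0)) refl ε (seq x n)) q))
        (¬pos-neg⇒nonneg { -ℝ x} (λ (ε , 0<ε , ev) → k (inj₁ (ε , 0<ε , map′ (λ n → by<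
          (solve 2 (λ e x → (:- (:- x)) :- e := x :- e) refl ε (seq x n))) ev))) ε 0<ε)
        (¬pos-neg⇒nonneg {x} (λ p → k (inj₂ (inj₂ p))) ε 0<ε)))
    }

  ℚ-orderedRing : OrderedRing
  ℚ-orderedRing = record
    { commutativeRing = ℚₚ.+-*-commutativeRing
    ; Pos = 0ℚ <_
    ; pos-resp = by<
    ; pos-1 = 0<1
    ; pos-asym = λ p → 0≤⇒¬0< (ℚₚ.<⇒≤ p)
    ; pos-+-nonneg = λ p q → 0<-+-≤ p (¬0<⇒0≤ q)
    ; pos-* = 0<-*
    ; T = id
    ; return = id
    ; _>>=_ = λ a f → f a
    ; run = λ a k → k a
    ; trichotomy = λ x → compare x (ℚₚ.<-cmp x 0ℚ)
    }
    where
    compare : ∀ x → _ → 0ℚ < x ⊎ x ≡ 0ℚ ⊎ 0ℚ < - x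
    compare x (tri< x<0 _ _) = inj₂ (inj₂ (by< (ℚₚ.+-identityˡ (- x)) (<⇒0<- x<0)))
    compare x (tri≈ _ x≡0 _) = inj₂ (inj₁ x≡0)
    compare x (tri> _ _ 0<x) = inj₁ 0<x

-- The smallest eigenvalue by bisection

module SmallestEigenvalues where

  open QuadraticForms
  open RealNumbers

  open import Data.Fin.Base using (zero; suc)
  open import Data.Integer.Base as ℤ using (ℤ; +_; 1ℤ; 0ℤ)
  import Data.Integer.Properties as ℤₚ
  open import Data.Nat.Base as ℕ using (ℕ; zero; suc)
  import Data.Nat.Properties as ℕₚ
  open import Data.Product.Base using (∃-syntax; _×_; _,_; proj₁; proj₂)
  open import Data.Rational.Base as ℚ using (ℚ; 0ℚ; 1ℚ; ½; _<_; _≤_; mkℚ; _+_; _-_; _*_; -_; ∣_∣)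
  import Data.Rational.Properties as ℚₚ
  import Data.Rational.Unnormalised.Base as ℚᵘ
  import Data.Rational.Unnormalised.Properties as ℚᵘₚ
  open import Data.Sum.Base using (_⊎_; inj₁; inj₂)
  open import Data.Vec.Functional using (Vector)
  open import Function.Base using (_∘_)
  open import Relation.Binary.PropositionalEquality using (_≡_; refl; sym; trans; cong; cong₂; subst)
  open import Relation.Nullary using (¬_)

  private module ℚ-solver = IntegerCoefficients ℚₚ.+-*-commutativeRing
  open ℚ-solver using (solve; _:=_; _:+_; _:*_; _:-_; :-_; :0; :1)

  open Forms ℚ-orderedRing using
    (Square; IsSymmetric; form; norm²; Indefinite; Semidefinite; shift; form-shift; shift-symmetric;
     signature; form-bounded-below; norm²-nonneg; single; form-single; nonneg-resp; _∙_)
  open import Algebra.Properties.CommutativeMonoid.Sum ℚₚ.+-0-commutativeMonoid using (sum-cong-≗)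
  module Real where
    open Forms ℝ-orderedRing public
    open OrderedRing ℝ-orderedRing public

  -- Unfolding the normalisation in _/_ on open terms is prohibitively slow.
  opaque
    ι : ℤ → ℚ
    ι z = z ℚ./ 1

    ι-def : ∀ z → ι z ≡ z ℚ./ 1
    ι-def z = refl

    ι-1 : ι 1ℤ ≡ 1ℚ
    ι-1 = refl

    ι-0 : ι 0ℤ ≡ 0ℚ
    ι-0 = refl

    toℚᵘ-ι : ∀ z → ℚ.toℚᵘ (ι z) ℚᵘ.≃ ℚᵘ.mkℚᵘ z 0
    toℚᵘ-ι z = ℚₚ.toℚᵘ-fromℚᵘ (ℚᵘ.mkℚᵘ z 0)

    ι-+ : ∀ y z → ι (y ℤ.+ z) ≡ ι y + ι z
    ι-+ y z = ℚₚ.toℚᵘ-injective (begin-equality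
      ℚ.toℚᵘ (ι (y ℤ.+ z))                   ≃⟨ toℚᵘ-ι (y ℤ.+ z) ⟩
      ℚᵘ.mkℚᵘ (y ℤ.+ z) 0                    ≃⟨ ℚᵘ.*≡* (cong (ℤ._* 1ℤ) (cong₂ ℤ._+_ (sym (ℤₚ.*-identityʳ y)) (sym (ℤₚ.*-identityʳ z)))) ⟩
      ℚᵘ.mkℚᵘ y 0 ℚᵘ.+ ℚᵘ.mkℚᵘ z 0           ≃⟨ ℚᵘₚ.+-cong (toℚᵘ-ι y) (toℚᵘ-ι z) ⟨
      ℚ.toℚᵘ (ι y) ℚᵘ.+ ℚ.toℚᵘ (ι z)         ≃⟨ ℚₚ.toℚᵘ-homo-+ (ι y) (ι z) ⟨
      ℚ.toℚᵘ (ι y + ι z)                     ∎)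
      where open ℚᵘₚ.≤-Reasoning

    ι-* : ∀ y z → ι (y ℤ.* z) ≡ ι y * ι z
    ι-* y z = ℚₚ.toℚᵘ-injective (begin-equality
      ℚ.toℚᵘ (ι (y ℤ.* z))                   ≃⟨ toℚᵘ-ι (y ℤ.* z) ⟩
      ℚᵘ.mkℚᵘ y 0 ℚᵘ.* ℚᵘ.mkℚᵘ z 0           ≃⟨ ℚᵘₚ.*-cong (toℚᵘ-ι y) (toℚᵘ-ι z) ⟨
      ℚ.toℚᵘ (ι y) ℚᵘ.* ℚ.toℚᵘ (ι z)         ≃⟨ ℚₚ.toℚᵘ-homo-* (ι y) (ι z) ⟨
      ℚ.toℚᵘ (ι y * ι z)                     ∎)
      where open ℚᵘₚ.≤-Reasoning

    ι-reflects-nonneg : ∀ z → 0ℚ ≤ ι z → 0ℤ ℤ.≤ z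
    ι-reflects-nonneg z 0≤ιz with ℚᵘₚ.≤-respʳ-≃ (toℚᵘ-ι z) (ℚₚ.toℚᵘ-mono-≤ 0≤ιz)
    ... | ℚᵘ.*≤* 0≤z*1 = subst (0ℤ ℤ.≤_) (ℤₚ.*-identityʳ z) 0≤z*1

    ι-preserves-≤ : ∀ {y z} → y ℤ.≤ z → ι y ≤ ι z
    ι-preserves-≤ {y} {z} y≤z = ℚₚ.toℚᵘ-cancel-≤ (ℚᵘₚ.≤-respʳ-≃ (ℚᵘₚ.≃-sym (toℚᵘ-ι z))
      (ℚᵘₚ.≤-respˡ-≃ (ℚᵘₚ.≃-sym (toℚᵘ-ι y)) (ℚᵘ.*≤* (ℤₚ.*-monoʳ-≤-nonNeg 1ℤ y≤z))))

    archimedean : ∀ q → ∃[ N ] q ≤ ι (+ N)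
    archimedean q@(mkℚ (+ n) d _) = n , ℚₚ.toℚᵘ-cancel-≤ (ℚᵘₚ.≤-respʳ-≃ (ℚᵘₚ.≃-sym (toℚᵘ-ι (+ n)))
      (ℚᵘ.*≤* (ℤₚ.*-monoˡ-≤-nonNeg (+ n) (ℤ.+≤+ (ℕ.s≤s ℕ.z≤n)))))
    archimedean q@(mkℚ ℤ.-[1+ n ] d _) = 0 , ℚₚ.toℚᵘ-cancel-≤ (ℚᵘ.*≤* ℤ.-≤+)

  -- The arithmetic of `excess-negative`. The negated excess is l ((y + η) s - f) + (p - l (y + η -
  -- x)) s: the first summand exceeds γ times the gap, and the second is nonnegative because y ≤ x
  -- and l η < C δ < p.
  strict-margin : ∀ {l p γ C δ η x y f s} →
    0ℚ < γ → 0ℚ < C → 0ℚ ≤ s → 0ℚ < (y + η) * s - f →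
    0ℚ < l - γ → 0ℚ < C - l → 0ℚ < p - C * δ → 0ℚ < δ - η → 0ℚ < η → 0ℚ ≤ x - y →
    0ℚ < - (l * (f - x * s) - p * s) - γ * ((y + η) * s - f)
  strict-margin {l} {p} {γ} {C} {δ} {η} {x} {y} {f} {s} 0<γ 0<C 0≤s 0<g γ<l l<C Cδ<p η<δ 0<η y≤x =
    by< (solve 7 (λ l γ p x z f s →
          (l :- γ) :* (z :* s :- f) :+ (p :- l :* (z :- x)) :* s
            := (:- (l :* (f :- x :* s) :- p :* s)) :- γ :* (z :* s :- f)) refl
        l γ p x (y + η) f s)
      (0<-+-≤ (0<-* γ<l 0<g) (0≤-* 0≤p-l[y+η-x] 0≤s))
    where
    0<l : 0ℚ < l
    0<l = by< (solve 2 (λ l g → (l :- g) :+ g := l) refl l γ) (0<-+ γ<l 0<γ)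
    0<p-Cη : 0ℚ < p - C * η
    0<p-Cη = by< (solve 4 (λ p c d h → (p :- c :* d) :+ c :* (d :- h) := p :- c :* h) refl p C δ η)
      (0<-+ Cδ<p (0<-* 0<C η<δ))
    0<p-lη : 0ℚ < p - l * η
    0<p-lη = by< (solve 4 (λ p c l h → (p :- c :* h) :+ (c :- l) :* h := p :- l :* h) refl p C l η)
      (0<-+ 0<p-Cη (0<-* l<C 0<η))
    0≤p-l[y+η-x] : 0ℚ ≤ p - l * (y + η - x)
    0≤p-l[y+η-x] = by≤ (solve 5 (λ p l h x y → (p :- l :* h) :+ l :* (x :- y) := p :- l :* (y :+ h :- x)) refl p l η x y)
      (0≤-+ (ℚₚ.<⇒≤ 0<p-lη) (0≤-* (ℚₚ.<⇒≤ 0<l) y≤x))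

  module SmallestEigenvalue {n} (A : Square (suc n)) (symm : IsSymmetric A) (hollow : ∀ i → A i i ≡ 0ℚ)
    (B : Matrix (suc n)) (B≡A : ∀ i j m → seq (B i j) m ≡ A i j) where

    PSD : ℚ → Set
    PSD q = ∀ w → 0ℚ ≤ form A w - q * norm² w

    Witness : ℚ → Set
    Witness q = ∃[ w ] 0ℚ < q * norm² w - form A w

    0≤norm² : ∀ {n} (w : Vector ℚ n) → 0ℚ ≤ norm² w
    0≤norm² w = ¬0<⇒0≤ (norm²-nonneg w)

    decide : ∀ q → PSD q ⊎ Witness q
    decide q with signature (shift A q) (shift-symmetric A symm q)
    ... | inj₁ (w , p) = inj₂ (w , by<
            (trans (cong -_ (form-shift A q w)) (solve 2 (λ f x → :- (f :- x) := x :- f) refl (form A w) (q * norm² w))) p)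
    ... | inj₂ (psd , _) = inj₁ λ w → by≤ (form-shift A q w) (¬0<⇒0≤ (psd w))

    opaque
      K : ℚ
      K = proj₁ (form-bounded-below A symm)

      0≤K : 0ℚ ≤ K
      0≤K = ¬0<⇒0≤ (proj₁ (proj₂ (form-bounded-below A symm)))

      K-bound : ∀ w → 0ℚ ≤ K * norm² w + form A w
      K-bound w = ¬0<⇒0≤ (proj₂ (proj₂ (form-bounded-below A symm)) w)

    h : ℕ → ℚ
    h zero    = K + 1ℚ
    h (suc n) = ½ * h n

    0<h : ∀ n → 0ℚ < h n
    0<h zero    = ℚₚ.+-mono-≤-< 0≤K 0<1
    0<h (suc n) = 0<-* 0<½ (0<h n)

    -- The upper end keeps a vector whose Rayleigh quotient lies below it; these vectors later
    -- refute a strict bound at the limit.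
    record Bracket (n : ℕ) : Set where
      constructor bracket
      field
        point   : ℚ
        below   : PSD point
        above   : Witness (point + h n)
    open Bracket

    start : Bracket 0
    start = bracket (- K)
      (λ w → by≤ (solve 3 (λ k n f → k :* n :+ f := f :- (:- k) :* n) refl K (norm² w) (form A w))
        (K-bound w))
      -- The diagonal vanishes, so the first unit vector has form 0, which lies below the upper end
      -- -K + (K + 1) = 1.
      (e , by< (sym (trans (cong₂ (λ x y → x * norm² e - y)
          (solve 1 (λ k → (:- k) :+ (k :+ :1) := :1) refl K)
          (trans (form-single A zero 1ℚ) (cong (λ x → 1ℚ * (x * 1ℚ)) (hollow zero))))
          (trans (solve 1 (λ x → :1 :* x :- :1 :* (:0 :* :1) := x) refl (norm² e)) refl))) 0<norm²)
      where
      e : Vector ℚ (suc n)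
      e = single zero 1ℚ
      0<norm² : 0ℚ < norm² e
      0<norm² = Forms.norm²-pos ℚ-orderedRing e zero (inj₁ 0<1)

    refine : ∀ {n} → Bracket n → Bracket (suc n)
    refine {n} (bracket q psd wit) with decide (q + ½ * h n)
    ... | inj₁ psd′ = bracket (q + ½ * h n) psd′ (subst Witness
            (trans (cong (λ x → q + x) (sym (half+half (h n)))) (sym (ℚₚ.+-assoc q (½ * h n) (½ * h n)))) wit)
    ... | inj₂ wit′ = bracket q psd wit′

    refine-increasing : ∀ {n} (b : Bracket n) → point b ≤ point (refine b)
    refine-increasing {n} (bracket q psd wit) with decide (q + ½ * h n)
    ... | inj₁ _ = 0≤-⇒≤ (by≤ (solve 2 (λ q x → x := (q :+ x) :- q) refl q (½ * h n)) (ℚₚ.<⇒≤ (0<h (suc n))))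
    ... | inj₂ _ = ℚₚ.≤-refl

    below<above : ∀ {q r} → PSD q → Witness r → q < r
    below<above {q} {r} psd (w , 0<rw) = ℚₚ.≰⇒> λ r≤q → ℚₚ.<-irrefl refl
      (by< (solve 4 (λ q r n f → (r :* n :- f) :+ (f :- q :* n) :+ (q :- r) :* n := :0) refl
          q r (norm² w) (form A w))
        (0<-+-≤ (0<-+-≤ 0<rw (psd w)) (0≤-* (≤⇒0≤- r≤q) (0≤norm² w))))

    opaque
      brackets : ∀ n → Bracket n
      brackets zero    = start
      brackets (suc n) = refine (brackets n)

      a : ℕ → ℚ
      a n = point (brackets n)

      a-increasing : ∀ {m n} → m ℕ.≤ n → a m ≤ a n
      a-increasing {m} m≤n = go (ℕₚ.≤⇒≤′ m≤n)
        where
        go : ∀ {n} → m ℕ.≤′ n → a m ≤ a n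
        go ℕ.≤′-refl     = ℚₚ.≤-refl
        go (ℕ.≤′-step p) = ℚₚ.≤-trans (go p) (refine-increasing (brackets _))

      a-bounded : ∀ m n → a m < a n + h n
      a-bounded m n = below<above (below (brackets m)) (above (brackets n))

      below-a : ∀ n → PSD (a n)
      below-a n = below (brackets n)

      above-a : ∀ n → Witness (a n + h n)
      above-a n = above (brackets n)

    -- Halving beats 1 / (n + 1), and this linear rate is all that the Archimedean property needs.
    h-decay : ∀ n → ι (+ suc n) * h n ≤ h 0
    h-decay zero    = ℚₚ.≤-reflexive (trans (cong (_* h 0) ι-1) (ℚₚ.*-identityˡ (h 0)))
    h-decay (suc n) = 0≤-⇒≤ (by≤
        (trans (solve 4 (λ s c i x → s :* ((c :- i :* x) :+ (c :- i :* x) :+ (i :- :1) :* x)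
            := (s :* c :+ s :* c) :- (:1 :+ i) :* (s :* x)) refl ½ (h 0) i (h n))
          (cong₂ (λ x y → x - y * (½ * h n)) (half+half (h 0))
            (sym (trans (ι-+ 1ℤ (+ suc n)) (cong (_+ i) ι-1)))))
      (0≤-* (ℚₚ.<⇒≤ 0<½) (0≤-+ (0≤-+ d d) (0≤-* (≤⇒0≤- 1≤i) (ℚₚ.<⇒≤ (0<h n))))))
      where
      i = ι (+ suc n)
      d = ≤⇒0≤- (h-decay n)
      1≤i = subst (_≤ i) ι-1 (ι-preserves-≤ {1ℤ} (ℤ.+≤+ (ℕ.s≤s ℕ.z≤n)))

    opaque
      h-null : ∀ ε → 0ℚ < ε → Eventually λ n → 0ℚ < ε - h n
      h-null ε 0<ε with δ , 0<δ , refl ← divide (0<h 0) 0<ε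
        -- `y` is h 0 / ε, so by `h-decay` every n ≥ `y` makes h n smaller than ε.
        with y , 0<y , δy≡1 ← divide 0<δ 0<1
        with N , y≤N ← archimedean y = N , λ n N≤n →
          let i = ι (+ suc n)
              0<i-y : 0ℚ < i - y
              0<i-y = by<
                (trans (solve 2 (λ j y → :1 :+ (j :- y) := (:1 :+ j) :- y) refl (ι (+ n)) y)
                  (cong (_- y) (trans (cong (_+ ι (+ n)) (sym ι-1)) (sym (ι-+ 1ℤ (+ n))))))
                (0<-+-≤ 0<1 (≤⇒0≤- (ℚₚ.≤-trans y≤N (ι-preserves-≤ (ℤ.+≤+ N≤n)))))
          in 0<-*-cancel (ℚₚ.<⇒≤ (by< (solve 2 (λ i y → (i :- y) :+ y := i) refl i y) (0<-+ 0<i-y 0<y)))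
            (by< (trans (cong (λ e → h 0 * ((i - y) * δ) + (h 0 * e - i * h n))  (sym δy≡1))
                   (solve 5 (λ c i y d x → c :* ((i :- y) :* d) :+ (c :* (d :* y) :- i :* x)
                     := i :* (c :* d :- x)) refl (h 0) i y δ (h n)))
              (0<-+-≤ (0<-* (0<h 0) (0<-* 0<i-y 0<δ))
                (by≤ (cong (_- i * h n) (sym (ℚₚ.*-identityʳ (h 0)))) (≤⇒0≤- (h-decay n)))))
        where
        0<-*-cancel : ∀ {i x} → 0ℚ ≤ i → 0ℚ < i * x → 0ℚ < x
        0<-*-cancel {i} {x} 0≤i 0<ix = ℚₚ.≰⇒> λ x≤0 → ℚₚ.<-irrefl refl
          (by< (solve 2 (λ i x → i :* x :+ i :* (:0 :- x) := :0) refl i x)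
            (0<-+-≤ 0<ix (0≤-* 0≤i (≤⇒0≤- x≤0))))

    μ : ℝ
    μ = mkℝ a λ ε 0<ε → let N , small = h-null ε 0<ε in N , λ m n N≤m N≤n → <⇒∣∣<
      (by< (solve 5 (λ e x y z h → (e :- h) :+ ((z :+ h) :- x) :+ (y :- z) := e :- (x :- y)) refl
          ε (a m) (a n) (a N) (h N))
        (0<-+-≤ (0<-+ (small N ℕₚ.≤-refl) (<⇒0<- (a-bounded m N))) (≤⇒0≤- (a-increasing N≤n))))
      (by< (solve 5 (λ e x y z h → (e :- h) :+ ((z :+ h) :- y) :+ (x :- z) := e :+ (x :- y)) refl
          ε (a m) (a n) (a N) (h N))
        (0<-+-≤ (0<-+ (small N ℕₚ.≤-refl) (<⇒0<- (a-bounded n N))) (≤⇒0≤- (a-increasing N≤m))))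

    at : ∀ {k} → ℕ → Vector ℝ k → Vector ℚ k
    at m w i = seq (w i) m

    seq-∙ : ∀ {k} (v w : Vector ℝ k) m → seq (v Real.∙ w) m ≡ at m v ∙ at m w
    seq-∙ {zero}  v w m = refl
    seq-∙ {suc k} v w m = cong (λ x → seq (v zero) m * seq (w zero) m + x) (seq-∙ (v ∘ suc) (w ∘ suc) m)

    seq-form : ∀ w m → seq (Real.form B w) m ≡ form A (at m w)
    seq-form w m = trans (seq-∙ w (λ i → B i Real.∙ w) m) (sum-cong-≗ λ i → cong (seq (w i) m *_)
      (trans (seq-∙ (B i) w m) (sum-cong-≗ λ j → cong (_* seq (w j) m) (B≡A i j m))))

    B-symmetric : Real.IsSymmetric B
    B-symmetric i j = ≡⇒≃ (B i j) (B j i) λ m → trans (B≡A i j m) (trans (symm i j) (sym (B≡A j i m)))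

    shifted-terms : ∀ w m → seq (Real.form B w +ℝ -ℝ (μ *ℝ Real.norm² w)) m
      ≡ form A (at m w) - a m * norm² (at m w)
    shifted-terms w m = cong₂ (λ x y → x - a m * y) (seq-form w m) (seq-∙ w w m)

    -- Real sums are formed term by term, so the m-th term is the rational form at the m-th
    -- approximation of `w`, shifted by `a m`, and that shift is semidefinite.
    shifted-nonneg : Real.BoundedBelow B μ
    shifted-nonneg w = nonneg-terms {Real.form B w +ℝ -ℝ (μ *ℝ Real.norm² w)} λ m →
      by≤ (sym (shifted-terms w m)) (below-a m (at m w))

    0≯0 : ∀ {x} → x ≃ 0ℝ → ¬ Posℝ x
    0≯0 {x} x≃0 (ε , 0<ε , ev) = ℚₚ.<-irrefl refl (by< (solve 2 (λ e x → x :- e :+ (e :- (x :- :0)) := :0) refl ε (seq x k))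
      (0<-+ p (proj₁ (∣∣<⇒< q))))
      where
      e : Eventually λ m → 0ℚ < seq x m - ε × ∣ seq x m - 0ℚ ∣ < ε
      e = both (λ _ → _,_) ev (x≃0 ε 0<ε)
      k = proj₁ (some e)
      p = proj₁ (proj₂ (some e))
      q = proj₂ (proj₂ (some e))

    eigenvector⇒eigenvalue : ∀ v → Real.Eigenvector B μ v → IsEigenvalue B μ
    eigenvector⇒eigenvalue v ((i , vᵢ≉0) , Bv≃μv) = v , v≉0 vᵢ≉0 , Bv≃μv
      where
      v≉0 : Posℝ (v i) ⊎ Posℝ (-ℝ v i) → ¬ (∀ i → v i ≃ 0ℝ)
      v≉0 (inj₁ p) v≃0 = 0≯0 {v i} (v≃0 i) p
      v≉0 (inj₂ p) v≃0 = 0≯0 { -ℝ v i} (null-resp (λ m → solve 1 (λ x → :- (x :- :0) := (:- x) :- :0) refl (seq (v i) m))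
        (null-neg (v≃0 i))) p

    opaque
      -- A strict bound is tested at rational vectors only, where just `L`, `p` and `μ` vary along
      -- the sequence.
      excess : ℝ → ℝ → Vector ℚ (suc n) → ℝ
      excess p L w = L Real.* (Real.form B w′ Real.- μ Real.* Real.norm² w′) Real.- p Real.* Real.norm² w′
        where
        w′ : Vector ℝ (suc n)
        w′ i = fromℚ (w i)

      excess-terms : ∀ p L w m →
        seq (excess p L w) m ≡ seq L m * (form A w - a m * norm² w) - seq p m * norm² w
      excess-terms p L w m =
        cong₂ (λ x y → seq L m * x - seq p m * y) (shifted-terms w′ m) (seq-∙ w′ w′ m)
        where
        w′ : Vector ℝ (suc n)
        w′ i = fromℚ (w i)

      strict⇒excess-nonneg : Real.StrictlyBounded B μ →
        ∃[ p ] ∃[ L ] Posℝ p × Posℝ L × ∀ w → Real.NonNeg (excess p L w)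
      strict⇒excess-nonneg (p , L , p>0 , L>0 , bound) = p , L , p>0 , L>0 , λ w → bound λ i → fromℚ (w i)

    -- A uniform lower bound would survive replacing μ by the upper end of a
    -- sufficiently short bracket.
    excess-negative : ∀ p L → Posℝ p → Posℝ L → ∃[ w ] Posℝ (Real.- excess p L w)
    excess-negative p L (ε , 0<ε , p>ε) (γ , 0<γ , L>γ) = w , γ * g , 0<-* 0<γ 0<g , k ℕ.⊔ proj₁ later , λ m le →
      let k≤m = ℕₚ.m⊔n≤o⇒m≤o k (proj₁ later) le
          (p>ε , L>γ) , L<C = proj₂ later m (ℕₚ.m⊔n≤o⇒n≤o k (proj₁ later) le)
      in by< (cong (λ x → - x - γ * g) (sym (excess-terms p L w m)))
           (strict-margin {seq L m} {seq p m} {C = C} {δ} {h k} {a m} {a k} {form A w} {norm² w} 0<γ 0<C (0≤norm² w) 0<g L>γ (proj₁ (∣∣<⇒< L<C))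
             (by< (cong (λ x → seq p m - x) (sym Cδ≡ε)) p>ε) h<δ (0<h k) (≤⇒0≤- (a-increasing k≤m)))
      where
      C = proj₁ (bounded L)
      0<C = proj₁ (proj₂ (bounded L))
      δ = proj₁ (divide 0<C 0<ε)
      Cδ≡ε = proj₂ (proj₂ (divide 0<C 0<ε))
      k = proj₁ (some (h-null δ (proj₁ (proj₂ (divide 0<C 0<ε)))))
      h<δ = proj₂ (some (h-null δ (proj₁ (proj₂ (divide 0<C 0<ε)))))
      w = proj₁ (above-a k)
      g : ℚ
      g = (a k + h k) * norm² w - form A w
      0<g : 0ℚ < g
      0<g = proj₂ (above-a k)
      later : Eventually λ m → (0ℚ < seq p m - ε × 0ℚ < seq L m - γ) × ∣ seq L m ∣ < C
      later = both (λ _ → _,_) (both (λ _ → _,_) p>ε L>γ) (proj₂ (proj₂ (bounded L)))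

    ¬strict : ¬ Real.StrictlyBounded B μ
    ¬strict strict =
      let p , L , p>0 , L>0 , nonneg = strict⇒excess-nonneg strict
          w , neg = excess-negative p L p>0 L>0
      in nonneg w neg

    μ-minimal : ∀ ν → IsEigenvalue B ν → μ ≤ℝ ν
    μ-minimal ν (v , v≉0 , Bv≃νv) ε 0<ε = map′
        (λ m p → 0<-⇒< (by< (solve 3 (λ e x y → e :+ (y :- x) := (y :+ e) :- x) refl ε (a m) (seq ν m)) p))
        (¬pos-neg⇒nonneg {ν +ℝ -ℝ μ} ν≥μ ε 0<ε)
      where
      ν≥μ : ¬ Posℝ (-ℝ (ν +ℝ -ℝ μ))
      ν≥μ ν<μ = Real.apart-or-zero v λ
        { (inj₂ v≃0) → v≉0 v≃0
        ; (inj₁ vᵢ≉0) → Real.eigenvalue-bound B μ shifted-nonneg ν v (vᵢ≉0 , Bv≃νv) ν<μ }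

    smallest : ¬ ¬ IsSmallestEigenvalue B μ
    smallest k = Real.attained-or-strict B B-symmetric μ shifted-nonneg λ
      { (inj₁ (v , eig)) → k (eigenvector⇒eigenvalue v eig , μ-minimal)
      ; (inj₂ strict) → ¬strict strict }

    rayleigh : ∀ q → (∀ ν → IsSmallestEigenvalue B ν → fromℚ q ≤ℝ ν) →
      ∀ w → 0ℚ ≤ form A w - q * norm² w
    -- Rational inequalities are stable, so the double negation in `smallest` does no harm: a
    -- violation by g is refuted by approximating `μ` up to g / (norm² + 1).
    rayleigh q q≤μ w = ℚₚ.≮⇒≥ λ neg → smallest λ sm →
      let f = form A w ; s = norm² w
          g = q * s - f
          0<g : 0ℚ < g
          0<g = by< (solve 3 (λ f q s → :0 :- (f :- q :* s) := q :* s :- f) refl f q s) (<⇒0<- neg)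
          0<s+1 = ℚₚ.+-mono-≤-< (0≤norm² w) 0<1
          ε , 0<ε , eq = divide 0<s+1 0<g
          m , q<a+ε = some (q≤μ μ sm ε 0<ε)
      in ℚₚ.<-irrefl refl (by<
        (trans (solve 5 (λ e f x s q → e :+ (f :- x :* s) :+ (x :+ e :- q) :* s := (s :+ :1) :* e :- (q :* s :- f))
            refl ε f (a m) s q)
          (trans (cong (_- g) eq) (ℚₚ.+-inverseʳ g)))
        (0<-+-≤ (0<-+-≤ 0<ε (below-a m w)) (0≤-* (ℚₚ.<⇒≤ (<⇒0<- q<a+ε)) (0≤norm² w))))

-- Finite sums over lists, pigeonhole and Ramsey's theorem

module IntegerSums where

  open import Data.Bool.Base using (true; false; if_then_else_)
  open import Data.Empty using (⊥-elim)
  open import Data.Integer.Base as ℤ using (ℤ; +_; 0ℤ; 1ℤ; _+_; _-_; _*_; -_; _≤_)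
  import Data.Integer.Properties as ℤₚ
  open import Data.Integer.Tactic.RingSolver using (solve-∀)
  open import Data.Fin.Base using (Fin; zero; suc)
  open import Data.List.Base using (List; []; _∷_; _++_; length; filter; take)
  open import Data.List.Relation.Binary.Sublist.Propositional using (_⊆_; []; _∷_; _∷ʳ_; ⊆-trans; minimum)
  open import Data.List.Relation.Binary.Sublist.Propositional.Properties using (All-resp-⊆; filter-⊆)
  open import Data.List.Relation.Unary.All as All using (All; []; _∷_)
  import Data.List.Relation.Unary.All.Properties as Allₚ
  open import Data.List.Relation.Unary.AllPairs using (AllPairs; []; _∷_)
  import Data.List.Properties as Listₚ
  open import Data.Nat.Base as ℕ using (ℕ; zero; suc)
  import Data.Nat.Properties as ℕₚ
  open import Data.Product.Base using (∃-syntax; _×_; _,_)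
  open import Data.Sum.Base using (_⊎_; inj₁; inj₂)
  open import Function.Base using (_∘_)
  open import Level using (0ℓ)
  open import Relation.Binary.Core using (Rel)
  open import Relation.Binary.Definitions using (Decidable)
  open import Relation.Binary.PropositionalEquality using (_≡_; refl; sym; trans; cong; cong₂; subst)
  open import Relation.Nullary using (¬_; yes; no; does)
  open import Relation.Nullary.Decidable using (¬?)
  open import Relation.Unary as U using (Pred)

  ≤⇒0≤- : ∀ {i j} → i ≤ j → 0ℤ ≤ j - i
  ≤⇒0≤- = ℤₚ.i≤j⇒0≤j-i

  0≤-⇒≤ : ∀ {i j} → 0ℤ ≤ j - i → i ≤ j
  0≤-⇒≤ = ℤₚ.0≤i-j⇒j≤i

  by : ∀ {i j} → i ≡ j → 0ℤ ≤ i → 0ℤ ≤ j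
  by refl p = p

  infixl 6 _⊕_
  _⊕_ : ∀ {i j} → 0ℤ ≤ i → 0ℤ ≤ j → 0ℤ ≤ i + j
  _⊕_ = ℤₚ.+-mono-≤

  infixl 7 _⊗_
  _⊗_ : ∀ {i j} → 0ℤ ≤ i → 0ℤ ≤ j → 0ℤ ≤ i * j
  _⊗_ {+ m} {+ n} _ _ = subst (0ℤ ≤_) (ℤₚ.pos-* m n) (ℤ.+≤+ ℕ.z≤n)

  0≤+ : ∀ n → 0ℤ ≤ + n
  0≤+ n = ℤ.+≤+ ℕ.z≤n

  0≤square : ∀ i → 0ℤ ≤ i * i
  0≤square (+ n) = 0≤+ n ⊗ 0≤+ n
  0≤square ℤ.-[1+ n ] = ℤ.+≤+ ℕ.z≤n

  0≰-1 : ¬ 0ℤ ≤ - 1ℤ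
  0≰-1 ()

  i≤∣i∣ : ∀ i → i ≤ + ℤ.∣ i ∣
  i≤∣i∣ (+ n) = ℤₚ.≤-refl
  i≤∣i∣ ℤ.-[1+ n ] = ℤ.-≤+

  -- Turns a size condition on a natural number into the slack that a certificate consumes; the
  -- absolute value serves as an upper bound of `i`.
  ∣i∣<n⇒0≤n-i-1 : ∀ {i n} → ℤ.∣ i ∣ ℕ.< n → 0ℤ ≤ + n - i - 1ℤ
  ∣i∣<n⇒0≤n-i-1 {i} {n} lt = by (eq (+ n) i (+ ℤ.∣ i ∣)) (≤⇒0≤- (ℤ.+≤+ lt) ⊕ ≤⇒0≤- (i≤∣i∣ i))
    where
    eq : ∀ m e f → (m - (1ℤ + f)) + (f - e) ≡ m - e - 1ℤ
    eq = solve-∀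

  module _ {A : Set} where

    ∑ : List A → (A → ℤ) → ℤ
    ∑ []       f = 0ℤ
    ∑ (x ∷ xs) f = f x + ∑ xs f

    ∑-cong : ∀ xs {f g} → (∀ x → f x ≡ g x) → ∑ xs f ≡ ∑ xs g
    ∑-cong []       eq = refl
    ∑-cong (x ∷ xs) eq = cong₂ _+_ (eq x) (∑-cong xs eq)

    ∑-mono : ∀ {xs f g} → All (λ x → f x ≤ g x) xs → ∑ xs f ≤ ∑ xs g
    ∑-mono []       = ℤₚ.≤-refl
    ∑-mono (p ∷ ps) = ℤₚ.+-mono-≤ p (∑-mono ps)

    ∑-mono′ : ∀ xs {f g} → (∀ x → f x ≤ g x) → ∑ xs f ≤ ∑ xs g
    ∑-mono′ xs p = ∑-mono (All.universal p xs)

    ∑-zero : ∀ (xs : List A) → ∑ xs (λ _ → 0ℤ) ≡ 0ℤ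
    ∑-zero []       = refl
    ∑-zero (x ∷ xs) = trans (ℤₚ.+-identityˡ _) (∑-zero xs)

    ∑-const : ∀ (xs : List A) c → ∑ xs (λ _ → c) ≡ + length xs * c
    ∑-const []       c = sym (ℤₚ.*-zeroˡ c)
    ∑-const (x ∷ xs) c = trans (cong (λ s → c + s) (∑-const xs c)) (eq c (+ length xs))
      where
      eq : ∀ c l → c + l * c ≡ (1ℤ + l) * c
      eq = solve-∀

    ∑-lower : ∀ {xs : List A} {f c} → All (λ x → c ≤ f x) xs → + length xs * c ≤ ∑ xs f
    ∑-lower {xs} {f} {c} p = subst (_≤ ∑ xs f) (∑-const xs c) (∑-mono p)

    ∑-upper : ∀ {xs : List A} {f c} → All (λ x → f x ≤ c) xs → ∑ xs f ≤ + length xs * c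
    ∑-upper {xs} {f} {c} p = subst (∑ xs f ≤_) (∑-const xs c) (∑-mono p)

    ∑-distrib-+ : ∀ xs f g → ∑ xs (λ x → f x + g x) ≡ ∑ xs f + ∑ xs g
    ∑-distrib-+ []       f g = refl
    ∑-distrib-+ (x ∷ xs) f g = trans (cong (λ s → f x + g x + s) (∑-distrib-+ xs f g))
      (eq (f x) (g x) (∑ xs f) (∑ xs g))
      where
      eq : ∀ a b c d → a + b + (c + d) ≡ a + c + (b + d)
      eq = solve-∀

    ∑-*ˡ : ∀ xs c f → ∑ xs (λ x → c * f x) ≡ c * ∑ xs f
    ∑-*ˡ []       c f = sym (ℤₚ.*-zeroʳ c)
    ∑-*ˡ (x ∷ xs) c f = trans (cong (λ s → c * f x + s) (∑-*ˡ xs c f)) (sym (ℤₚ.*-distribˡ-+ c (f x) (∑ xs f)))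

    ∑-++ : ∀ xs ys f → ∑ (xs ++ ys) f ≡ ∑ xs f + ∑ ys f
    ∑-++ []       ys f = sym (ℤₚ.+-identityˡ _)
    ∑-++ (x ∷ xs) ys f = trans (cong (λ s → f x + s) (∑-++ xs ys f)) (sym (ℤₚ.+-assoc (f x) _ _))

    ∑-⊆ : ∀ {xs ys f} → (∀ x → 0ℤ ≤ f x) → xs ⊆ ys → ∑ xs f ≤ ∑ ys f
    ∑-⊆ f≥0 []         = ℤₚ.≤-refl
    ∑-⊆ f≥0 (y ∷ʳ p)   = subst (_≤ _) (ℤₚ.+-identityˡ _) (ℤₚ.+-mono-≤ (f≥0 y) (∑-⊆ f≥0 p))
    ∑-⊆ {f = f} f≥0 (_∷_ {x = x} refl p) = ℤₚ.+-monoʳ-≤ (f x) (∑-⊆ f≥0 p)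

    module _ {P : Pred A 0ℓ} (P? : U.Decidable P) where

      length-filter-∑ : ∀ xs → + length (filter P? xs) ≡ ∑ xs (λ x → if does (P? x) then 1ℤ else 0ℤ)
      length-filter-∑ [] = refl
      length-filter-∑ (x ∷ xs) with does (P? x)
      ... | true  = cong (λ s → 1ℤ + s) (length-filter-∑ xs)
      ... | false = trans (length-filter-∑ xs) (sym (ℤₚ.+-identityˡ _))

      ∑-partition : ∀ xs f → ∑ xs f ≡ ∑ (filter P? xs) f + ∑ (filter (¬? ∘ P?) xs) f
      ∑-partition [] f = refl
      ∑-partition (x ∷ xs) f with P? x
      ... | yes _ = trans (cong (λ s → f x + s) (∑-partition xs f)) (sym (ℤₚ.+-assoc (f x) _ _))
      ... | no _  = trans (cong (λ s → f x + s) (∑-partition xs f))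
        (eq (f x) (∑ (filter P? xs) f) (∑ (filter (¬? ∘ P?) xs) f))
        where
        eq : ∀ a b c → a + (b + c) ≡ b + (a + c)
        eq = solve-∀

      length-partition : ∀ xs → length xs ≡ length (filter P? xs) ℕ.+ length (filter (¬? ∘ P?) xs)
      length-partition [] = refl
      length-partition (x ∷ xs) with P? x
      ... | yes _ = cong suc (length-partition xs)
      ... | no _  = trans (cong suc (length-partition xs)) (sym (ℕₚ.+-suc _ _))

    AllPairs-⊆ : ∀ {R : Rel A 0ℓ} {xs ys} → xs ⊆ ys → AllPairs R ys → AllPairs R xs
    AllPairs-⊆ []         []       = []
    AllPairs-⊆ (_ ∷ʳ p)   (_ ∷ rs) = AllPairs-⊆ p rs
    AllPairs-⊆ (refl ∷ p) (r ∷ rs) = All-resp-⊆ p r ∷ AllPairs-⊆ p rs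

    length-take′ : ∀ {n} {xs : List A} → n ℕ.≤ length xs → length (take n xs) ≡ n
    length-take′ {n} {xs} n≤l = trans (Listₚ.length-take n xs) (ℕₚ.m≤n⇒m⊓n≡m n≤l)

    -- If the first class has fewer than m members, removing it leaves more than k m entries for the
    -- k other classes.
    pigeonhole : ∀ k m {P : Fin k → Pred A 0ℓ} (P? : ∀ j → U.Decidable (P j)) xs →
      All (λ x → ∃[ j ] P j x) xs → k ℕ.* m ℕ.< length xs →
      ∃[ j ] ∃[ ys ] ys ⊆ xs × All (P j) ys × m ℕ.≤ length ys
    pigeonhole zero m P? (x ∷ xs) ((() , _) ∷ _) k*m<l
    pigeonhole (suc k) m {P} P? xs ∃P k*m<l with m ℕₚ.≤? length (filter (P? zero) xs)
    ... | yes m≤l = zero , filter (P? zero) xs , filter-⊆ (P? zero) xs , Allₚ.all-filter (P? zero) xs , m≤l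
    ... | no m≰l =
      let j , ys , ys⊆ , Pys , m≤l = pigeonhole k m (λ j → P? (suc j)) rest
            (All.zipWith drop-zero (All-resp-⊆ (filter-⊆ _ xs) ∃P , Allₚ.all-filter (¬? ∘ P? zero) xs))
            (ℕₚ.+-cancelˡ-< m (k ℕ.* m) (length rest)
              (ℕₚ.<-trans (subst (m ℕ.+ k ℕ.* m ℕ.<_) (length-partition (P? zero) xs) k*m<l)
                (ℕₚ.+-monoˡ-< (length rest) (ℕₚ.≰⇒> m≰l))))
      in suc j , ys , ⊆-trans ys⊆ (filter-⊆ _ xs) , Pys , m≤l
      where
      rest = filter (¬? ∘ P? zero) xs
      drop-zero : ∀ {x} → (∃[ j ] P j x) × ¬ P zero x → ∃[ j ] P (suc j) x
      drop-zero ((zero , p) , ¬p) = ⊥-elim (¬p p)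
      drop-zero ((suc j , p) , _) = j , p

  ∑-swap : ∀ {A B : Set} (xs : List A) (ys : List B) (f : A → B → ℤ) →
    ∑ xs (λ x → ∑ ys (f x)) ≡ ∑ ys (λ y → ∑ xs (λ x → f x y))
  ∑-swap [] ys f = sym (∑-zero ys)
  ∑-swap (x ∷ xs) ys f = trans (cong (λ s → ∑ ys (f x) + s) (∑-swap xs ys f)) (sym (∑-distrib-+ ys (f x) (λ y → ∑ xs λ x → f x y)))

  ramseyBound : ℕ → ℕ → ℕ
  ramseyBound zero    b       = 0
  ramseyBound (suc a) zero    = 0
  ramseyBound (suc a) (suc b) = suc (ramseyBound a (suc b) ℕ.+ ramseyBound (suc a) b)

  module Ramsey {A : Set} {R : Rel A 0ℓ} (R? : Decidable R) where

    Homogeneous : ℕ → ℕ → List A → Set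
    Homogeneous a b xs =
      (∃[ ys ] ys ⊆ xs × AllPairs R ys × length ys ≡ a) ⊎
      (∃[ ys ] ys ⊆ xs × AllPairs (λ x y → ¬ R x y) ys × length ys ≡ b)

    -- The head joins the clique or the independent set according to whether enough of the tail is
    -- related to it.
    ramsey : ∀ a b xs → ramseyBound a b ℕ.≤ length xs → Homogeneous a b xs
    ramsey zero    b       xs _ = inj₁ ([] , minimum xs , [] , refl)
    ramsey (suc a) zero    xs _ = inj₂ ([] , minimum xs , [] , refl)
    ramsey (suc a) (suc b) (x ∷ xs) (ℕ.s≤s le) with ramseyBound a (suc b) ℕₚ.≤? length (filter (R? x) xs)
    ... | yes p = extend (ramsey a (suc b) (filter (R? x) xs) p)
      where
      extend : Homogeneous a (suc b) (filter (R? x) xs) → Homogeneous (suc a) (suc b) (x ∷ xs)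
      extend (inj₁ (ys , s , r , l)) = inj₁ (x ∷ ys , refl ∷ ⊆-trans s (filter-⊆ (R? x) xs) ,
        All-resp-⊆ s (Allₚ.all-filter (R? x) xs) ∷ r , cong suc l)
      extend (inj₂ (ys , s , r , l)) = inj₂ (ys , x ∷ʳ ⊆-trans s (filter-⊆ (R? x) xs) , r , l)
    ... | no ¬p = extend (ramsey (suc a) b far
        (ℕₚ.+-cancelˡ-≤ (ramseyBound a (suc b)) _ _ (ℕₚ.≤-trans le
          (subst (ℕ._≤ ramseyBound a (suc b) ℕ.+ length far) (sym (length-partition (R? x) xs))
            (ℕₚ.+-monoˡ-≤ (length far) (ℕₚ.<⇒≤ (ℕₚ.≰⇒> ¬p)))))))
      where
      far = filter (¬? ∘ R? x) xs
      extend : Homogeneous (suc a) b far → Homogeneous (suc a) (suc b) (x ∷ xs)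
      extend (inj₁ (ys , s , r , l)) = inj₁ (ys , x ∷ʳ ⊆-trans s (filter-⊆ _ xs) , r , l)
      extend (inj₂ (ys , s , r , l)) = inj₂ (x ∷ ys , refl ∷ ⊆-trans s (filter-⊆ _ xs) ,
        All-resp-⊆ s (Allₚ.all-filter (¬? ∘ R? x) xs) ∷ r , cong suc l)

-- From the eigenvalue bound to a semidefinite integer form

module GramForms where

  open QuadraticForms
  open RealNumbers using (ℚ-orderedRing)
  open SmallestEigenvalues
  open IntegerSums
  open import Data.Bool.Base using (if_then_else_; true; false)
  open import Data.Empty using (⊥-elim)
  open import Data.Fin.Base using (Fin; zero; suc)
  open import Data.Fin.Properties using (_≟_)
  open import Data.Integer.Base as ℤ using (ℤ; +_; 1ℤ; 0ℤ)
  open import Data.Integer.Tactic.RingSolver using (solve-∀)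
  open import Data.List.Base using (List; []; _∷_)
  open import Data.Nat.Base using (ℕ; zero; suc)
  import Data.Rational.Base as ℚ
  open import Data.Rational.Base using (ℚ; 0ℚ; 1ℚ)
  import Data.Rational.Properties as ℚₚ
  open import Data.Vec.Functional using (Vector)
  open import Relation.Binary.PropositionalEquality using (_≡_; _≢_; refl; sym; trans; cong; cong₂; subst; module ≡-Reasoning)
  open import Function.Bundles using (mk⇔)
  open import Relation.Nullary using (Dec; yes; no; does)
  open import Relation.Nullary.Decidable using (does-⇔; dec-false)

  -- Applied twice, it evaluates a 3 × 3 Gram matrix at (a, b, c).
  row : ℤ → ℤ → ℤ → ℤ → ℤ → ℤ → ℤ
  row a b c x y z = a ℤ.* x ℤ.+ (b ℤ.* y ℤ.+ c ℤ.* z)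

  module Weights (G : Graph) (k : ℕ) where

    -- The Gram matrix A + kI of the vertices.
    β : V G → V G → ℤ
    β x y = if does (x ≟ y) then + k else if does (adj? G x y) then 1ℤ else 0ℤ

    ⟨_,_⟩ : List (V G) → List (V G) → ℤ
    ⟨ S , T ⟩ = ∑ S λ x → ∑ T (β x)

    -- Lists stand for sums of unit vectors, repetitions counted. Three of them suffice, because the
    -- form is only evaluated at combinations of one vertex and at most two lists.
    PositiveSemidefinite : Set
    PositiveSemidefinite = ∀ a b c S T U → 0ℤ ℤ.≤ row a b c
      (row a b c ⟨ S , S ⟩ ⟨ S , T ⟩ ⟨ S , U ⟩)
      (row a b c ⟨ T , S ⟩ ⟨ T , T ⟩ ⟨ T , U ⟩)
      (row a b c ⟨ U , S ⟩ ⟨ U , T ⟩ ⟨ U , U ⟩)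

    ∑-row : ∀ a b c S (f g h : V G → ℤ) →
      ∑ S (λ x → row a b c (f x) (g x) (h x)) ≡ row a b c (∑ S f) (∑ S g) (∑ S h)
    ∑-row a b c S f g h = trans (∑-distrib-+ S (λ x → a ℤ.* f x) (λ x → b ℤ.* g x ℤ.+ c ℤ.* h x))
      (cong₂ ℤ._+_ (∑-*ˡ S a f) (trans (∑-distrib-+ S (λ x → b ℤ.* g x) (λ x → c ℤ.* h x))
        (cong₂ ℤ._+_ (∑-*ˡ S b g) (∑-*ˡ S c h))))

  module Characteristic {n : ℕ} where
    open Data.Rational.Base using (_+_; _*_)
    open Forms ℚ-orderedRing using (form; single; _∙_; ∙-comm; ∙-zeroʳ; ∙-single; ∙-+ʳ; ∙-scaleʳ)

    vec : List (Fin n) → Vector ℚ n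
    vec []      i = 0ℚ
    vec (x ∷ S) i = single x 1ℚ i + vec S i

    ∙-vec : ∀ v (f : Fin n → ℤ) S → (∀ i → v i ≡ ι (f i)) → v ∙ vec S ≡ ι (∑ S f)
    ∙-vec v f []      v≡ιf = trans (∙-zeroʳ v) (sym ι-0)
    ∙-vec v f (x ∷ S) v≡ιf = begin
      v ∙ vec (x ∷ S)                ≡⟨ ∙-+ʳ v (single x 1ℚ) (vec S) ⟩
      v ∙ single x 1ℚ + v ∙ vec S    ≡⟨ cong₂ _+_ (trans (∙-single v x 1ℚ) (trans (ℚₚ.*-identityʳ _) (v≡ιf x))) (∙-vec v f S v≡ιf) ⟩
      ι (f x) + ι (∑ S f)            ≡⟨ ι-+ (f x) (∑ S f) ⟨
      ι (∑ (x ∷ S) f)                ∎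
      where open ≡-Reasoning

    module Combination (a b c : ℤ) (S T U : List (Fin n)) where
      combination : Vector ℚ n
      combination i = ι a * vec S i + (ι b * vec T i + ι c * vec U i)

      ∙-combination : ∀ v (f : Fin n → ℤ) → (∀ i → v i ≡ ι (f i)) →
        v ∙ combination ≡ ι (row a b c (∑ S f) (∑ T f) (∑ U f))
      ∙-combination v f v≡ιf = begin
        v ∙ combination
          ≡⟨ trans (∙-+ʳ v (λ i → ι a * vec S i) (λ i → ι b * vec T i + ι c * vec U i))
               (cong₂ _+_ (part a S) (trans (∙-+ʳ v (λ i → ι b * vec T i) (λ i → ι c * vec U i))
                 (trans (cong₂ _+_ (part b T) (part c U)) (sym (ι-+ (b ℤ.* ∑ T f) (c ℤ.* ∑ U f)))))) ⟩
        ι (a ℤ.* ∑ S f) + ι (b ℤ.* ∑ T f ℤ.+ c ℤ.* ∑ U f)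
          ≡⟨ ι-+ (a ℤ.* ∑ S f) (b ℤ.* ∑ T f ℤ.+ c ℤ.* ∑ U f) ⟨
        ι (row a b c (∑ S f) (∑ T f) (∑ U f)) ∎
        where
        open ≡-Reasoning
        part : ∀ d W → v ∙ (λ i → ι d * vec W i) ≡ ι (d ℤ.* ∑ W f)
        part d W = trans (∙-scaleʳ (ι d) v (vec W)) (trans (cong (ι d *_) (∙-vec v f W v≡ιf)) (sym (ι-* d (∑ W f))))

      form-combination : ∀ M (β : Fin n → Fin n → ℤ) → (∀ i j → M i j ≡ ι (β i j)) →
        let g = λ i → row a b c (∑ S (β i)) (∑ T (β i)) (∑ U (β i)) in
        form M combination ≡ ι (row a b c (∑ S g) (∑ T g) (∑ U g))
      form-combination M β M≡ιβ = trans (∙-comm combination (λ i → M i ∙ combination))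
        (∙-combination _ _ λ i → ∙-combination (M i) (β i) (M≡ιβ i))

  module _ where
    open Data.Rational.Base using (_*_; _-_)
    open Forms ℚ-orderedRing using (Square; IsSymmetric; form; norm²; single)

    rayleigh : ∀ {n} (A : Square n) → IsSymmetric A → (∀ i → A i i ≡ 0ℚ) →
      (B : Matrix n) → (∀ i j m → seq (B i j) m ≡ A i j) →
      ∀ q → (∀ μ → IsSmallestEigenvalue B μ → fromℚ q ≤ℝ μ) → ∀ w → 0ℚ ℚ.≤ form A w - q * norm² w
    -- The empty matrix has no eigenvalue to appeal to, but its form is 0.
    rayleigh {zero}  A symm hollow B B≡A q q≤μ w =
      ℚₚ.≤-reflexive (sym (cong (λ x → 0ℚ - x) (ℚₚ.*-zeroʳ q)))
    rayleigh {suc n} A symm hollow B B≡A q q≤μ w = SmallestEigenvalue.rayleigh A symm hollow B B≡A q q≤μ w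

    single-diagonal : ∀ {n} (i : Fin n) q → single i q i ≡ q
    single-diagonal zero    q = refl
    single-diagonal (suc i) q = single-diagonal i q

    single-off-diagonal : ∀ {n} {i j : Fin n} q → i ≢ j → single i q j ≡ 0ℚ
    single-off-diagonal {i = zero}  {zero}  q i≢j = ⊥-elim (i≢j refl)
    single-off-diagonal {i = zero}  {suc j} q i≢j = refl
    single-off-diagonal {i = suc i} {zero}  q i≢j = refl
    single-off-diagonal {i = suc i} {suc j} q i≢j = single-off-diagonal q λ i≡j → i≢j (cong suc i≡j)

  module _ (G : Graph) (t : ℕ)
    (λmin : (μ : ℝ) → IsSmallestEigenvalue (adjacencyMatrix G) μ → fromℤ (ℤ.- + t ℤ.- 1ℤ) ≤ℝ μ) where
    open Weights G (suc t)
    open Data.Rational.Base using (_+_; _-_)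
    open Forms ℚ-orderedRing using (Square; IsSymmetric; form; shift; form-shift)

    private
      A : Square (order G)
      A i j = if does (adj? G i j) then 1ℚ else 0ℚ

      A-symmetric : IsSymmetric A
      A-symmetric i j = cong (λ b → if b then 1ℚ else 0ℚ)
        (does-⇔ (mk⇔ (symm G) (symm G)) (adj? G i j) (adj? G j i))

      A-hollow : ∀ i → A i i ≡ 0ℚ
      A-hollow i = cong (λ b → if b then 1ℚ else 0ℚ) (dec-false (adj? G i i) (irrefl G refl))

      adjacencyMatrix≡A : ∀ i j m → seq (adjacencyMatrix G i j) m ≡ A i j
      adjacencyMatrix≡A i j m = if-seq (does (adj? G i j))
        where
        if-seq : ∀ b → seq (if b then 1ℝ else 0ℝ) m ≡ (if b then 1ℚ else 0ℚ)
        if-seq true  = refl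
        if-seq false = refl

      q : ℤ
      q = ℤ.- + t ℤ.- 1ℤ

      q+k : + suc t ℤ.+ q ≡ 0ℤ
      q+k = eq (+ t)
        where
        eq : ∀ x → (1ℤ ℤ.+ x) ℤ.+ (ℤ.- x ℤ.- 1ℤ) ≡ 0ℤ
        eq = solve-∀

      ιq+ιk : 0ℚ - ι q ≡ ι (+ suc t)
      ιq+ιk = begin
        0ℚ - ι q                          ≡⟨ cong (_- ι q) (trans (sym ι-0) (trans (cong ι (sym q+k)) (ι-+ (+ suc t) q))) ⟩
        (ι (+ suc t) + ι q) - ι q         ≡⟨ ℚₚ.+-assoc (ι (+ suc t)) (ι q) (ℚ.- ι q) ⟩
        ι (+ suc t) + (ι q - ι q)         ≡⟨ cong (λ x → ι (+ suc t) + x) (ℚₚ.+-inverseʳ (ι q)) ⟩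
        ι (+ suc t) + 0ℚ                  ≡⟨ ℚₚ.+-identityʳ (ι (+ suc t)) ⟩
        ι (+ suc t)                       ∎
        where open ≡-Reasoning

      ι-if : ∀ b → (if b then 1ℚ else 0ℚ) ≡ ι (if b then 1ℤ else 0ℤ)
      ι-if true  = sym ι-1
      ι-if false = sym ι-0

      shift≡ιβ : ∀ i j → shift A (ι q) i j ≡ ι (β i j)
      shift≡ιβ i j = by-cases (i ≟ j)
        where
        by-cases : (d : Dec (i ≡ j)) → shift A (ι q) i j ≡
          ι (if does d then + suc t else if does (adj? G i j) then 1ℤ else 0ℤ)
        by-cases (yes refl) = trans (cong₂ _-_ (A-hollow i) (single-diagonal i (ι q))) ιq+ιk
        by-cases (no i≢j)   = trans (cong (λ x → A i j - x) (single-off-diagonal (ι q) i≢j))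
          (trans (ℚₚ.+-identityʳ (A i j)) (ι-if (does (adj? G i j))))

      0≤form : ∀ w → 0ℚ ℚ.≤ form (shift A (ι q)) w
      0≤form w = subst (0ℚ ℚ.≤_) (sym (form-shift A (ι q) w))
        (rayleigh A A-symmetric A-hollow (adjacencyMatrix G) adjacencyMatrix≡A (ι q)
          (λ μ sm → subst (λ r → fromℚ r ≤ℝ μ) (sym (ι-def q)) (λmin μ sm)) w)

    gram-positive : PositiveSemidefinite
    gram-positive a b c S T U = subst (0ℤ ℤ.≤_)
      (cong₃ (row a b c) (expand S) (expand T) (expand U))
      (ι-reflects-nonneg _ (subst (0ℚ ℚ.≤_) (form-combination (shift A (ι q)) β shift≡ιβ) (0≤form combination)))
      where
      open Characteristic.Combination {order G} a b c S T U
      expand : ∀ W → ∑ W (λ i → row a b c (∑ S (β i)) (∑ T (β i)) (∑ U (β i)))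
        ≡ row a b c ⟨ W , S ⟩ ⟨ W , T ⟩ ⟨ W , U ⟩
      expand W = ∑-row a b c W (λ i → ∑ S (β i)) (λ i → ∑ T (β i)) (λ i → ∑ U (β i))
      cong₃ : ∀ (f : ℤ → ℤ → ℤ → ℤ) {x x′ y y′ z z′} → x ≡ x′ → y ≡ y′ → z ≡ z′ → f x y z ≡ f x′ y′ z′
      cong₃ f refl refl refl = refl

-- The constants, and attachment of vertices to large cliques

module Cliques where

  open IntegerSums
  open GramForms using (row; module Weights)
  open import Data.Bool.Base using (true; false; if_then_else_; _∨_; not)
  open import Data.Empty using (⊥; ⊥-elim)
  open import Data.Fin.Base using (Fin; suc)
  open import Data.Fin.Properties using (_≟_)
  open import Data.Integer.Base as ℤ using (ℤ; +_; 1ℤ; 0ℤ; _+_; _-_; _*_; -_; _≤_)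
  import Data.Integer.Properties as ℤₚ
  open import Data.Integer.Tactic.RingSolver using (solve-∀)
  open import Data.List.Base using (List; []; _∷_; length; filter; take)
  open import Data.List.Relation.Binary.Sublist.Propositional using (_⊆_; []; _∷_)
  open import Data.List.Relation.Binary.Sublist.Propositional.Properties using (All-resp-⊆; filter-⊆; take-⊆)
  open import Data.List.Relation.Unary.All as All using (All; []; _∷_)
  import Data.List.Relation.Unary.All.Properties as Allₚ
  open import Data.List.Relation.Unary.AllPairs using (AllPairs; []; _∷_)
  open import Data.Nat.Base as ℕ using (ℕ; suc)
  import Data.Nat.Properties as ℕₚ
  open import Data.Product.Base using (_,_)
  open import Data.Sum.Base using (_⊎_; inj₁; inj₂)
  open import Function.Base using (_∘_)
  open import Relation.Binary.PropositionalEquality using (_≡_; _≢_; refl; sym; trans; cong; cong₂; subst)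
  open import Relation.Nullary using (Dec; ¬_; yes; no; does)
  open import Relation.Nullary.Decidable using (¬?; _⊎-dec_; dec-true; dec-false; does-⇔)
  open import Function.Bundles using (mk⇔)

  module Constants (t : ℕ) where

    K : ℤ
    K = + suc t

    0≤K : 0ℤ ≤ K
    0≤K = 0≤+ (suc t)

    0≤K-1 : 0ℤ ≤ K - 1ℤ
    0≤K-1 = ≤⇒0≤- (ℤ.+≤+ (ℕ.s≤s ℕ.z≤n))

    -- In `core` the form at (K + c) z - Σ S + Σ T is at most this number minus 2 m; the weight K +
    -- c of z is what leaves -2 m.
    excess : ℤ → ℤ
    excess c = K * ((K + c) * (K + c)) + (1ℤ + 1ℤ) * ((K + c) * (c * (1ℤ + K)))

    opaque
      threshold : ℕ → ℕ
      threshold c = suc ℤ.∣ excess (+ c) ∣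

      threshold-bound : ∀ {c m} → threshold c ℕ.≤ m → 0ℤ ≤ + m - excess (+ c) - 1ℤ
      threshold-bound {c} = ∣i∣<n⇒0≤n-i-1 {excess (+ c)}

    -- `c₀` serves for two parts of one clique, which are joined without exception; `m₁` for two
    -- cliques where each vertex of one misses at most `c₀` of the other.
    c₀ m₁ : ℕ
    c₀ = threshold 0
    m₁ = threshold c₀

    C : ℤ
    C = + c₀

    -- Beyond r M², the Gram form of r blocks has (K - 1) M from each block and at most K C M from
    -- each of the r (r - 1) ordered pairs, with r (r - 1) rounded up to r²; the factor M is left
    -- out.
    frameExcess : ℤ → ℤ
    frameExcess r = r * (K - 1ℤ) + r * (r * (K * C))

    -- E bounds the norm of the vector M x − Σ F attached to a frame at x.
    E s e : ℤ
    E = frameExcess K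
    s = E + 1ℤ
    e = C + C + K * (K * C)

    0≤KC : 0ℤ ≤ K * C
    0≤KC = 0≤K ⊗ 0≤+ c₀

    0≤E : 0ℤ ≤ E
    0≤E = 0≤K ⊗ 0≤K-1 ⊕ 0≤K ⊗ (0≤K ⊗ 0≤KC)

    0≤s : 0ℤ ≤ s
    0≤s = 0≤E ⊕ 0≤+ 1

    private
      M₀ : ℕ
      M₀ = ℤ.∣ (s + s) * e + K * (s * s) ∣

    opaque
      -- Large enough for three purposes: blocks admit the comparisons of cliques at size `m₁`, the
      -- pigeonhole in `transfer` leaves `m₁` vertices on one line, and `defect-bounded` absorbs its
      -- error.
      M : ℕ
      M = suc (m₁ ℕ.+ ((suc t ℕ.* m₁ ℕ.+ c₀) ℕ.+ M₀))

      m₁≤M : m₁ ℕ.≤ M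
      m₁≤M = ℕₚ.m≤n⇒m≤1+n (ℕₚ.m≤m+n _ _)

      km₁+c₀<M : suc t ℕ.* m₁ ℕ.+ c₀ ℕ.< M
      km₁+c₀<M = ℕ.s≤s (ℕₚ.m≤n⇒m≤o+n m₁ (ℕₚ.m≤m+n _ M₀))

      error<M : 0ℤ ≤ + M - ((s + s) * e + K * (s * s)) - 1ℤ
      error<M = ∣i∣<n⇒0≤n-i-1 {(s + s) * e + K * (s * s)} (ℕ.s≤s (ℕₚ.m≤n⇒m≤o+n m₁ (ℕₚ.m≤n+m M₀ (suc t ℕ.* m₁ ℕ.+ c₀))))

      1≤M : 1 ℕ.≤ M
      1≤M = ℕ.s≤s ℕ.z≤n

    opaque
      -- k² + 1 is the size of an independent set of neighbours that `claw-free` excludes.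
      R : ℕ
      R = ramseyBound M (suc (suc t ℕ.* suc t))

      R-def : R ≡ ramseyBound M (suc (suc t ℕ.* suc t))
      R-def = refl

    -- Read off from `counting`: the neighbours outside all classes cost 2 R, the slack in `weight`
    -- costs t R, the vertices near themselves cost t, and the final 1 makes the contradiction
    -- strict.
    κ : ℕ
    κ = suc (R ℕ.+ R ℕ.+ t ℕ.* R ℕ.+ t)

  module Geometry (G : Graph) (t : ℕ) (psd : Weights.PositiveSemidefinite G (suc t)) where
    open Weights G (suc t) using (β; ⟨_,_⟩)
    open Constants t

    Near : V G → V G → Set
    Near x y = x ≡ y ⊎ Adj G x y

    near? : ∀ x y → Dec (Near x y)
    near? x y = (x ≟ y) ⊎-dec adj? G x y

    -- Attachment is counted with these indicators, positivity is stated with `β`; the sandwich ν ≤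
    -- β ≤ K ν passes between the two.
    ν ν̄ : V G → V G → ℤ
    ν x y = if does (near? x y) then 1ℤ else 0ℤ
    ν̄ x y = if does (near? x y) then 0ℤ else 1ℤ

    private
      indicator : ∀ b → 0ℤ ≤ (if b then 1ℤ else 0ℤ)
      indicator true  = 0≤+ 1
      indicator false = 0≤+ 0

      co-indicator : ∀ b → 0ℤ ≤ (if b then 0ℤ else 1ℤ)
      co-indicator true  = 0≤+ 0
      co-indicator false = 0≤+ 1

      complementary : ∀ b → (if b then 1ℤ else 0ℤ) + (if b then 0ℤ else 1ℤ) ≡ 1ℤ
      complementary true  = refl
      complementary false = refl

      ν≤β-bool : ∀ b c → (if b ∨ c then 1ℤ else 0ℤ) ≤ (if b then K else if c then 1ℤ else 0ℤ)
      ν≤β-bool true  c     = ℤ.+≤+ (ℕ.s≤s ℕ.z≤n)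
      ν≤β-bool false true  = ℤₚ.≤-refl
      ν≤β-bool false false = ℤₚ.≤-refl

      β≤Kν-bool : ∀ b c → (if b then K else if c then 1ℤ else 0ℤ) ≤ K * (if b ∨ c then 1ℤ else 0ℤ)
      β≤Kν-bool true  c     = ℤₚ.≤-reflexive (sym (ℤₚ.*-identityʳ K))
      β≤Kν-bool false true  = subst (1ℤ ≤_) (sym (ℤₚ.*-identityʳ K)) (ℤ.+≤+ (ℕ.s≤s ℕ.z≤n))
      β≤Kν-bool false false = ℤₚ.≤-reflexive (sym (ℤₚ.*-zeroʳ K))

    0≤ν : ∀ x y → 0ℤ ≤ ν x y
    0≤ν x y = indicator (does (near? x y))

    0≤ν̄ : ∀ x y → 0ℤ ≤ ν̄ x y
    0≤ν̄ x y = co-indicator (does (near? x y))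

    ν+ν̄ : ∀ x y → ν x y + ν̄ x y ≡ 1ℤ
    ν+ν̄ x y = complementary (does (near? x y))

    ν≤β : ∀ x y → ν x y ≤ β x y
    ν≤β x y = ν≤β-bool (does (x ≟ y)) (does (adj? G x y))

    β≤Kν : ∀ x y → β x y ≤ K * ν x y
    β≤Kν x y = β≤Kν-bool (does (x ≟ y)) (does (adj? G x y))

    0≤β : ∀ x y → 0ℤ ≤ β x y
    0≤β x y = ℤₚ.≤-trans (0≤ν x y) (ν≤β x y)

    near⇒ν̄≡0 : ∀ {x y} → Near x y → ν̄ x y ≡ 0ℤ
    near⇒ν̄≡0 {x} {y} p = cong (λ b → if b then 0ℤ else 1ℤ) (dec-true (near? x y) p)

    far⇒ν≡0 : ∀ {x y} → ¬ Near x y → ν x y ≡ 0ℤ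
    far⇒ν≡0 {x} {y} p = cong (λ b → if b then 1ℤ else 0ℤ) (dec-false (near? x y) p)

    β-self : ∀ x → β x x ≡ K
    β-self x = cong (λ b → if b then K else if does (adj? G x x) then 1ℤ else 0ℤ) (dec-true (x ≟ x) refl)

    β-distinct : ∀ {x y} → x ≢ y → β x y ≡ (if does (adj? G x y) then 1ℤ else 0ℤ)
    β-distinct {x} {y} x≢y =
      cong (λ b → if b then K else if does (adj? G x y) then 1ℤ else 0ℤ) (dec-false (x ≟ y) x≢y)

    β-adjacent : ∀ {x y} → Adj G x y → β x y ≡ 1ℤ
    β-adjacent {x} {y} x∼y = trans (β-distinct λ x≡y → irrefl G x≡y x∼y)
      (cong (λ b → if b then 1ℤ else 0ℤ) (dec-true (adj? G x y) x∼y))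

    β-far : ∀ {x y} → x ≢ y → ¬ Adj G x y → β x y ≡ 0ℤ
    β-far {x} {y} x≢y x≁y = trans (β-distinct x≢y)
      (cong (λ b → if b then 1ℤ else 0ℤ) (dec-false (adj? G x y) x≁y))

    β-sym : ∀ x y → β x y ≡ β y x
    β-sym x y = cong₂ (λ b c → if b then K else if c then 1ℤ else 0ℤ)
      (does-⇔ (mk⇔ sym sym) (x ≟ y) (y ≟ x))
      (does-⇔ (mk⇔ (symm G) (symm G)) (adj? G x y) (adj? G y x))

    ⟨⟩-sym : ∀ S T → ⟨ S , T ⟩ ≡ ⟨ T , S ⟩
    ⟨⟩-sym S T = trans (∑-swap S T β) (∑-cong T λ y → ∑-cong S λ x → β-sym x y)

    ⟨⟩-point : ∀ z S → ⟨ z ∷ [] , S ⟩ ≡ ∑ S (β z)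
    ⟨⟩-point z S = ℤₚ.+-identityʳ _

    -- Positivity at a z + b Σ S + c Σ T, the shape in which every later argument uses it.
    psd₃ : ∀ a b c z S T → 0ℤ ≤ K * (a * a) + b * b * ⟨ S , S ⟩ + c * c * ⟨ T , T ⟩
      + (a * b * ∑ S (β z) + a * b * ∑ S (β z)) + (a * c * ∑ T (β z) + a * c * ∑ T (β z))
      + (b * c * ⟨ S , T ⟩ + b * c * ⟨ S , T ⟩)
    psd₃ a b c z S T = by eq (psd a b c Z S T)
      where
      Z = z ∷ []
      expand : ∀ a b c k x y s t w →
        row a b c (row a b c k x y) (row a b c x s w) (row a b c y w t) ≡
        k * (a * a) + b * b * s + c * c * t + (a * b * x + a * b * x) + (a * c * y + a * c * y)
          + (b * c * w + b * c * w)
      expand = unfolded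
        where
        unfolded : ∀ a b c k x y s t w →
          a * (a * k + (b * x + c * y)) + (b * (a * x + (b * s + c * w)) + c * (a * y + (b * w + c * t))) ≡
          k * (a * a) + b * b * s + c * c * t + (a * b * x + a * b * x) + (a * c * y + a * c * y)
            + (b * c * w + b * c * w)
        unfolded = solve-∀
      ZS = ⟨⟩-point z S
      ZT = ⟨⟩-point z T
      ZZ : ⟨ Z , Z ⟩ ≡ K
      ZZ = trans (⟨⟩-point z Z) (trans (ℤₚ.+-identityʳ _) (β-self z))
      cong₃ : ∀ (f : ℤ → ℤ → ℤ → ℤ) {x x′ y y′ z z′} → x ≡ x′ → y ≡ y′ → z ≡ z′ → f x y z ≡ f x′ y′ z′
      cong₃ f refl refl refl = refl
      eq = trans (cong₃ (row a b c)
          (cong₃ (row a b c) ZZ ZS ZT)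
          (cong₃ (row a b c) (trans (⟨⟩-sym S Z) ZS) refl refl)
          (cong₃ (row a b c) (trans (⟨⟩-sym T Z) ZT) (⟨⟩-sym T S) refl))
        (expand a b c K (∑ S (β z)) (∑ T (β z)) ⟨ S , S ⟩ ⟨ T , T ⟩ ⟨ S , T ⟩)

    ∑ν+∑ν̄ : ∀ z S → ∑ S (ν z) + ∑ S (ν̄ z) ≡ + length S
    ∑ν+∑ν̄ z S = trans (sym (∑-distrib-+ S (ν z) (ν̄ z)))
      (trans (∑-cong S (ν+ν̄ z)) (trans (∑-const S 1ℤ) (ℤₚ.*-identityʳ _)))

    ∑β-lower : ∀ z S {c} → ∑ S (ν̄ z) ≤ c → + length S - c ≤ ∑ S (β z)
    ∑β-lower z S {c} few = ℤₚ.≤-trans (0≤-⇒≤ (by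
        (trans (eq c (∑ S (ν̄ z)) (∑ S (ν z))) (cong (λ l → ∑ S (ν z) - (l - c)) (∑ν+∑ν̄ z S)))
        (≤⇒0≤- few)))
      (∑-mono′ S (ν≤β z))
      where
      eq : ∀ c m n → c - m ≡ n - (n + m - c)
      eq = solve-∀

    ∑β-upper : ∀ z S {c} → ∑ S (ν z) ≤ c → ∑ S (β z) ≤ K * c
    ∑β-upper z S few = ℤₚ.≤-trans (∑-mono′ S (β≤Kν z))
      (subst (_≤ _) (sym (∑-*ˡ S K (ν z))) (ℤₚ.*-monoˡ-≤-nonNeg K few))

    Clique : List (V G) → Set
    Clique = AllPairs (Adj G)

    clique-near : ∀ {S} → Clique S → All (λ x → All (Near x) S) S
    clique-near []       = []
    clique-near (a ∷ as) = (inj₁ refl ∷ All.map inj₂ a) ∷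
      All.zipWith (λ (x∼s , ss) → inj₂ (symm G x∼s) ∷ ss) (a , clique-near as)

    ∑-adjacent : ∀ {x T} → All (Adj G x) T → ∑ T (β x) ≡ + length T
    ∑-adjacent []                   = refl
    ∑-adjacent {x} {y ∷ T} (x∼y ∷ rest) = cong₂ _+_ (β-adjacent x∼y) (∑-adjacent rest)

    clique-form : ∀ {S} → Clique S → ⟨ S , S ⟩ ≡ + length S * + length S + (K - 1ℤ) * + length S
    clique-form []                 = sym (eq (K - 1ℤ))
      where
      eq : ∀ k → 0ℤ * 0ℤ + k * 0ℤ ≡ 0ℤ
      eq = solve-∀
    clique-form {x ∷ S} (a ∷ as) = trans
      (cong₂ _+_ (cong₂ _+_ (β-self x) ∑≡m)
        (trans (∑-distrib-+ S (λ s → β s x) (λ s → ∑ S (β s)))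
          (cong₂ _+_ (trans (∑-cong S λ s → β-sym s x) ∑≡m) (clique-form as))))
      (eq K (+ length S))
      where
      ∑≡m = ∑-adjacent a
      eq : ∀ k m → k + m + (m + (m * m + (k - 1ℤ) * m)) ≡ (1ℤ + m) * (1ℤ + m) + (k - 1ℤ) * (1ℤ + m)
      eq = solve-∀

    -- Two large cliques that are almost completely joined have almost the same
    -- average in the Gram space, so no vertex is near one and far from the other:
    -- the form would be negative on (K + c) z − Σ S + Σ T.
    core : ∀ c {m S T z} → Clique S → Clique T → length S ≡ m → length T ≡ m → threshold c ℕ.≤ m →
      + m - + c ≤ ∑ S (β z) → ∑ T (β z) ≤ K * + c → + m * + m - + c * + m ≤ ⟨ S , T ⟩ → ⊥
    core c {m} {S} {T} {z} S-clique T-clique refl refl′ large p q r = 0≰-1 (by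
        (trans (cong₂ (λ ss tt → K * (a * a) + - 1ℤ * - 1ℤ * ss + 1ℤ * 1ℤ * tt
              + (a * - 1ℤ * X + a * - 1ℤ * X) + (a * 1ℤ * Y + a * 1ℤ * Y)
              + (- 1ℤ * 1ℤ * W + - 1ℤ * 1ℤ * W)
              + ((a + a) * (X - (M′ - C′)) + (a + a) * (K * C′ - Y) + ((W - (M′ * M′ - C′ * M′)) + (W - (M′ * M′ - C′ * M′)))
                + (M′ + (M′ - excess C′ - 1ℤ))))
            (clique-form S-clique)
            (trans (clique-form T-clique) (cong (λ l → + l * + l + (K - 1ℤ) * + l) refl′)))
          (eq K C′ M′ X Y W))
        (psd₃ a (- 1ℤ) 1ℤ z S T
          ⊕ ((0≤a ⊕ 0≤a) ⊗ ≤⇒0≤- p ⊕ (0≤a ⊕ 0≤a) ⊗ ≤⇒0≤- q ⊕ (≤⇒0≤- r ⊕ ≤⇒0≤- r)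
            ⊕ (0≤+ _ ⊕ threshold-bound {c} large))))
      where
      C′ = + c
      M′ = + length S
      a = K + C′
      0≤a = 0≤K ⊕ 0≤+ c
      X = ∑ S (β z)
      Y = ∑ T (β z)
      W = ⟨ S , T ⟩
      eq : ∀ k c m x y w →
        k * ((k + c) * (k + c)) + - 1ℤ * - 1ℤ * (m * m + (k - 1ℤ) * m) + 1ℤ * 1ℤ * (m * m + (k - 1ℤ) * m)
          + ((k + c) * - 1ℤ * x + (k + c) * - 1ℤ * x) + ((k + c) * 1ℤ * y + (k + c) * 1ℤ * y)
          + (- 1ℤ * 1ℤ * w + - 1ℤ * 1ℤ * w)
          + (((k + c) + (k + c)) * (x - (m - c)) + ((k + c) + (k + c)) * (k * c - y)
            + ((w - (m * m - c * m)) + (w - (m * m - c * m)))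
            + (m + (m - (k * ((k + c) * (k + c)) + (1ℤ + 1ℤ) * ((k + c) * (c * (1ℤ + k)))) - 1ℤ))) ≡ - 1ℤ
      eq = solve-∀

    joined : ∀ {S T c} → All (λ s → ∑ T (ν̄ s) ≤ c) S → + length S * (+ length T - c) ≤ ⟨ S , T ⟩
    joined {S} {T} few = ∑-lower (All.map (λ {s} → ∑β-lower s T) few)

    module _ (c : ℕ) where
      Attached Detached : V G → List (V G) → Set
      Attached z F = ∑ F (ν̄ z) ≤ + c
      Detached z F = ∑ F (ν z) ≤ + c

    attached-⊆ : ∀ {c z S T} → S ⊆ T → Attached c z T → Attached c z S
    attached-⊆ {z = z} S⊆T = ℤₚ.≤-trans (∑-⊆ (0≤ν̄ z) S⊆T)

    detached-⊆ : ∀ {c z S T} → S ⊆ T → Detached c z T → Detached c z S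
    detached-⊆ {z = z} S⊆T = ℤₚ.≤-trans (∑-⊆ (0≤ν z) S⊆T)

    module _ {c m : ℕ} {S T : List (V G)} {z : V G} (large : threshold c ℕ.≤ m) (S-clique : Clique S) (T-clique : Clique T)
      (m≤S : m ℕ.≤ length S) (m≤T : m ℕ.≤ length T) (S-T : All (λ s → Attached c s T) S) where
      private
        S′ = take m S
        T′ = take m T
        S⊆ : S′ ⊆ S
        S⊆ = take-⊆ m S
        T⊆ : T′ ⊆ T
        T⊆ = take-⊆ m T
        ∣S′∣ = length-take′ {xs = S} m≤S
        ∣T′∣ = length-take′ {xs = T} m≤T
        S′-clique = AllPairs-⊆ S⊆ S-clique
        T′-clique = AllPairs-⊆ T⊆ T-clique
        almost : + m * + m - + c * + m ≤ ⟨ S′ , T′ ⟩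
        almost = subst (_≤ ⟨ S′ , T′ ⟩)
          (trans (cong₂ (λ x y → + x * (+ y - + c)) ∣S′∣ ∣T′∣) (eq (+ m) (+ c)))
          (joined {S′} {T′} (All.map (λ {s} → attached-⊆ {c} {s} {T′} {T} T⊆) (All-resp-⊆ S⊆ S-T)))
          where
          eq : ∀ m c → m * (m - c) ≡ m * m - c * m
          eq = solve-∀

      -- `core` wants cliques of equal length, hence source and target are cut to m vertices, which
      -- preserves attachment and detachment.
      attached-source⇒¬detached-target : Attached c z S → Detached c z T → ⊥
      attached-source⇒¬detached-target att det = core c {m} {S′} {T′} {z} S′-clique T′-clique ∣S′∣ ∣T′∣ large
        (subst (λ l → + l - + c ≤ ∑ S′ (β z)) ∣S′∣ (∑β-lower z S′ (attached-⊆ {c} {z} {S′} {S} S⊆ att)))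
        (∑β-upper z T′ (detached-⊆ {c} {z} {T′} {T} T⊆ det)) almost

      -- The form is symmetric, so `core` applies with S and T exchanged although attachment is
      -- assumed in one direction only.
      detached-source⇒¬attached-target : Detached c z S → Attached c z T → ⊥
      detached-source⇒¬attached-target det att = core c {m} {T′} {S′} {z} T′-clique S′-clique ∣T′∣ ∣S′∣ large
        (subst (λ l → + l - + c ≤ ∑ T′ (β z)) ∣T′∣ (∑β-lower z T′ (attached-⊆ {c} {z} {T′} {T} T⊆ att)))
        (∑β-upper z S′ (detached-⊆ {c} {z} {S′} {S} S⊆ det))
        (subst (λ w → + m * + m - + c * + m ≤ w) (⟨⟩-sym S′ T′) almost)

    Att Det : V G → List (V G) → Set
    Att = Attached c₀
    Det = Detached c₀

    att? : ∀ z F → Dec (Att z F)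
    att? z F = ∑ F (ν̄ z) ℤₚ.≤? + c₀

    length-near : ∀ z F → + length (filter (near? z) F) ≡ ∑ F (ν z)
    length-near z F = length-filter-∑ (near? z) F

    length-far : ∀ z F → + length (filter (¬? ∘ near? z) F) ≡ ∑ F (ν̄ z)
    length-far z F = trans (length-filter-∑ (¬? ∘ near? z) F) (∑-cong F λ x → negate (does (near? z x)))
      where
      negate : ∀ b → (if not b then 1ℤ else 0ℤ) ≡ (if b then 0ℤ else 1ℤ)
      negate true  = refl
      negate false = refl

    near⇒attached-0 : ∀ {z F} → All (Near z) F → Attached 0 z F
    near⇒attached-0 {z} {F} near = subst (_≤ 0ℤ) refl (ℤₚ.≤-trans
      (∑-upper (All.map (λ p → ℤₚ.≤-reflexive (near⇒ν̄≡0 p)) near)) (ℤₚ.≤-reflexive (ℤₚ.*-zeroʳ (+ length F))))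

    far⇒detached-0 : ∀ {z F} → All (¬_ ∘ Near z) F → Detached 0 z F
    far⇒detached-0 {z} {F} far = ℤₚ.≤-trans
      (∑-upper (All.map (λ p → ℤₚ.≤-reflexive (far⇒ν≡0 p)) far)) (ℤₚ.≤-reflexive (ℤₚ.*-zeroʳ (+ length F)))

    -- If the near part and the far part both had `c₀` vertices, they would be cliques joined
    -- without exception, with `z` attached to one and detached from the other with constant 0.
    -- Hence `c₀` is `threshold 0`.
    attached-or-detached : ∀ {F} z → Clique F → Att z F ⊎ Det z F
    attached-or-detached {F} z clique
      with c₀ ℕₚ.≤? length (filter (near? z) F) | c₀ ℕₚ.≤? length (filter (¬? ∘ near? z) F)
    ... | no few | _ = inj₂ (subst (_≤ + c₀) (length-near z F) (ℤ.+≤+ (ℕₚ.<⇒≤ (ℕₚ.≰⇒> few))))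
    ... | yes _ | no few = inj₁ (subst (_≤ + c₀) (length-far z F) (ℤ.+≤+ (ℕₚ.<⇒≤ (ℕₚ.≰⇒> few))))
    ... | yes p | yes q = ⊥-elim (attached-source⇒¬detached-target {0} {c₀} {S} {T} {z} ℕₚ.≤-refl
        (AllPairs-⊆ S⊆ clique) (AllPairs-⊆ T⊆ clique) p q
        (All.map (λ near → near⇒attached-0 (All-resp-⊆ T⊆ near)) (All-resp-⊆ S⊆ (clique-near clique)))
        (near⇒attached-0 (Allₚ.all-filter (near? z) F))
        (far⇒detached-0 (Allₚ.all-filter (¬? ∘ near? z) F)))
      where
      S = filter (near? z) F
      T = filter (¬? ∘ near? z) F
      S⊆ = filter-⊆ (near? z) F
      T⊆ = filter-⊆ (¬? ∘ near? z) F

-- Frames: almost unjoined large cliques around a vertex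

module Frames where

  open Cliques
  open IntegerSums
  open GramForms using (module Weights)
  open import Data.Empty using (⊥-elim)
  open import Data.Fin.Base using (Fin; zero; suc)
  open import Data.Fin.Properties using (_≟_; any?)
  open import Data.Integer.Base as ℤ using (ℤ; +_; 1ℤ; 0ℤ; _+_; _-_; _*_; -_; _≤_)
  import Data.Integer.Properties as ℤₚ
  open import Data.Integer.Tactic.RingSolver using (solve-∀)
  open import Data.List.Base using (List; []; _∷_; _++_; length; filter)
  open import Data.List.Relation.Binary.Sublist.Propositional using (_⊆_; []; _∷_; ⊆-refl; ⊆-trans)
  open import Data.List.Relation.Binary.Sublist.Propositional.Properties using (All-resp-⊆; filter-⊆)
  open import Data.List.Relation.Unary.All as All using (All; []; _∷_)
  import Data.List.Relation.Unary.All.Properties as Allₚ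
  open import Data.List.Relation.Unary.AllPairs as AllPairs using (AllPairs; []; _∷_)
  open import Data.List.Relation.Unary.Unique.Propositional using (Unique)
  open import Data.Nat.Base as ℕ using (ℕ; zero; suc)
  import Data.Nat.Properties as ℕₚ
  open import Data.Product.Base using (∃-syntax; _×_; _,_)
  open import Data.Sum.Base using (inj₁; inj₂)
  open import Function.Base using (_∘_)
  open import Relation.Binary.PropositionalEquality using (_≡_; _≢_; refl; sym; trans; cong; cong₂; subst; subst₂)
  open import Relation.Nullary using (¬_; yes; no)
  open import Relation.Nullary.Decidable using (¬?)
  open import Data.Vec.Base using (Vec; []; _∷_; lookup)

  module FrameTheory (G : Graph) (t : ℕ) (psd : Weights.PositiveSemidefinite G (suc t)) where
    open Weights G (suc t) using (β; ⟨_,_⟩)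
    open Constants t
    open Geometry G t psd

    ⟨⟩-++ˡ : ∀ S S′ T → ⟨ S ++ S′ , T ⟩ ≡ ⟨ S , T ⟩ + ⟨ S′ , T ⟩
    ⟨⟩-++ˡ S S′ T = ∑-++ S S′ (λ x → ∑ T (β x))

    ⟨⟩-++ʳ : ∀ S T T′ → ⟨ S , T ++ T′ ⟩ ≡ ⟨ S , T ⟩ + ⟨ S , T′ ⟩
    ⟨⟩-++ʳ S T T′ = trans (⟨⟩-sym S (T ++ T′)) (trans (⟨⟩-++ˡ T T′ S) (cong₂ _+_ (⟨⟩-sym T S) (⟨⟩-sym T′ S)))

    ⟨⟩-square : ∀ S T → ⟨ S ++ T , S ++ T ⟩ ≡ ⟨ S , S ⟩ + (⟨ S , T ⟩ + ⟨ S , T ⟩) + ⟨ T , T ⟩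
    ⟨⟩-square S T = trans (⟨⟩-++ˡ S T (S ++ T))
      (trans (cong₂ _+_ (⟨⟩-++ʳ S S T) (trans (⟨⟩-++ʳ T S T) (cong (_+ ⟨ T , T ⟩) (⟨⟩-sym T S))))
        (eq ⟨ S , S ⟩ ⟨ S , T ⟩ ⟨ T , T ⟩))
      where
      eq : ∀ a b c → a + b + (b + c) ≡ a + (b + b) + c
      eq = solve-∀

    Independent : List (V G) → Set
    Independent = AllPairs λ x y → ¬ Near x y

    independent-form : ∀ {I} → Independent I → ⟨ I , I ⟩ ≡ + length I * K
    independent-form []                = sym (ℤₚ.*-zeroˡ K)
    independent-form {x ∷ I} (a ∷ as) = trans
      (cong₂ _+_ (cong₂ _+_ (β-self x) ∑≡0)
        (trans (∑-distrib-+ I (λ s → β s x) (λ s → ∑ I (β s)))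
          (cong₂ _+_ (trans (∑-cong I λ s → β-sym s x) ∑≡0) (independent-form as))))
      (eq K (+ length I))
      where
      ∑-far : ∀ {T} → All (λ y → ¬ Near x y) T → ∑ T (β x) ≡ 0ℤ
      ∑-far []           = refl
      ∑-far (far ∷ rest) = cong₂ _+_ (β-far (far ∘ inj₁) (far ∘ inj₂)) (∑-far rest)
      ∑≡0 = ∑-far a
      eq : ∀ k m → k + 0ℤ + (0ℤ + m * k) ≡ (1ℤ + m) * k
      eq = solve-∀

    -- A star with k² + 1 leaves has smallest eigenvalue below -k: the form at K x - Σ I is K³ + (K²
    -- + 1) K - 2 K (K² + 1) = -K.
    claw-free : ∀ {x I} → Independent I → All (Adj G x) I → length I ≢ suc (suc t ℕ.* suc t)
    claw-free {x} {I} independent adjacent len = 0≰-1 (by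
      (trans (cong₂ (λ ii X → K * (K * K) + - 1ℤ * - 1ℤ * ii + 0ℤ * 0ℤ * 0ℤ
            + (K * - 1ℤ * X + K * - 1ℤ * X) + (K * 0ℤ * 0ℤ + K * 0ℤ * 0ℤ)
            + (- 1ℤ * 0ℤ * ⟨ I , [] ⟩ + - 1ℤ * 0ℤ * ⟨ I , [] ⟩) + (K - 1ℤ))
          (trans (independent-form independent) (cong (_* K) m≡)) (trans (∑-adjacent adjacent) m≡))
        (eq K ⟨ I , [] ⟩))
      (psd₃ K (- 1ℤ) 0ℤ x I [] ⊕ 0≤K-1))
      where
      m≡ : + length I ≡ 1ℤ + K * K
      m≡ = trans (cong +_ len) (cong (λ z → 1ℤ + z) (ℤₚ.pos-* (suc t) (suc t)))
      eq : ∀ k w → k * (k * k) + - 1ℤ * - 1ℤ * ((1ℤ + k * k) * k) + 0ℤ * 0ℤ * 0ℤ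
            + (k * - 1ℤ * (1ℤ + k * k) + k * - 1ℤ * (1ℤ + k * k)) + (k * 0ℤ * 0ℤ + k * 0ℤ * 0ℤ)
            + (- 1ℤ * 0ℤ * w + - 1ℤ * 0ℤ * w) + (k - 1ℤ) ≡ - 1ℤ
      eq = solve-∀

    large-clique : ∀ {x U} → Unique U → All (Adj G x) U → R ℕ.≤ length U →
      ∃[ F ] F ⊆ U × Clique F × length F ≡ M
    large-clique {x} {U} unique adjacent le
      with Ramsey.ramsey near? M (suc (suc t ℕ.* suc t)) U (subst (ℕ._≤ length U) R-def le)
    ... | inj₁ (F , F⊆U , near , len) = F , F⊆U ,
            AllPairs.zipWith (λ { (inj₁ x≡y , x≢y) → ⊥-elim (x≢y x≡y) ; (inj₂ x∼y , _) → x∼y })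
              (near , AllPairs-⊆ F⊆U unique) , len
    ... | inj₂ (I , I⊆U , far , len) = ⊥-elim (claw-free far (All-resp-⊆ I⊆U adjacent) len)

    -- A block need only be detached from those already present; the symmetry of the form turns this
    -- into a bound on all cross terms.
    data IsFrame (x : V G) : ∀ {r} → Vec (List (V G)) r → Set where
      []    : IsFrame x []
      block : ∀ {r F} {Fs : Vec (List (V G)) r} → Clique F → length F ≡ M → All (Adj G x) F →
              All (λ f → ∀ i → Det f (lookup Fs i)) F → IsFrame x Fs → IsFrame x (F ∷ Fs)

    module _ {x : V G} where

      clique-at : ∀ {r} {Fs : Vec _ r} → IsFrame x Fs → ∀ i → Clique (lookup Fs i)
      clique-at (block c _ _ _ _)  zero    = c
      clique-at (block _ _ _ _ fr) (suc i) = clique-at fr i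

      length-at : ∀ {r} {Fs : Vec _ r} → IsFrame x Fs → ∀ i → length (lookup Fs i) ≡ M
      length-at (block _ l _ _ _)  zero    = l
      length-at (block _ _ _ _ fr) (suc i) = length-at fr i

      adjacent-at : ∀ {r} {Fs : Vec _ r} → IsFrame x Fs → ∀ i → All (Adj G x) (lookup Fs i)
      adjacent-at (block _ _ a _ _)  zero    = a
      adjacent-at (block _ _ _ _ fr) (suc i) = adjacent-at fr i

    support : ∀ {r} → Vec (List (V G)) r → List (V G)
    support []       = []
    support (F ∷ Fs) = F ++ support Fs

    0≤∑β : ∀ y S → 0ℤ ≤ ∑ S (β y)
    0≤∑β y S = subst (_≤ ∑ S (β y)) (∑-zero S) (∑-mono′ S (0≤β y))

    ∑-support-detached : ∀ {r} (Fs : Vec _ r) y → (∀ i → Det y (lookup Fs i)) →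
      ∑ (support Fs) (β y) ≤ + r * (K * C)
    ∑-support-detached [] y det = ℤₚ.≤-reflexive (sym (ℤₚ.*-zeroˡ (K * C)))
    ∑-support-detached {suc r} (F ∷ Fs) y det = subst₂ _≤_
      (sym (∑-++ F (support Fs) (β y))) (eq (K * C) (+ r))
      (ℤₚ.+-mono-≤ (∑β-upper y F (det zero)) (∑-support-detached Fs y (λ i → det (suc i))))
      where
      eq : ∀ c r → c + r * c ≡ (1ℤ + r) * c
      eq = solve-∀

    ∑-block-attached : ∀ F y → length F ≡ M → Att y F → + M - C ≤ ∑ F (β y)
    ∑-block-attached F y len att = subst (λ l → + l - C ≤ ∑ F (β y)) len (∑β-lower y F att)

    module _ {x : V G} where

      ∑-support-center : ∀ {r} {Fs : Vec _ r} → IsFrame x Fs → ∑ (support Fs) (β x) ≡ + r * + M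
      ∑-support-center [] = refl
      ∑-support-center {suc r} (block {F = F} {Fs} _ len adj _ fr) = trans (∑-++ F (support Fs) (β x))
        (trans (cong₂ _+_ (trans (∑-adjacent adj) (cong +_ len)) (∑-support-center fr)) (eq (+ M) (+ r)))
        where
        eq : ∀ m r → m + r * m ≡ (1ℤ + r) * m
        eq = solve-∀

      ∑-support-attached : ∀ {r} {Fs : Vec _ r} → IsFrame x Fs → ∀ {y} i → Att y (lookup Fs i) →
        + M - C ≤ ∑ (support Fs) (β y)
      ∑-support-attached (block {F = F} {Fs} _ len _ _ fr) {y} zero att =
        subst (+ M - C ≤_) (sym (∑-++ F (support Fs) (β y)))
          (subst (_≤ ∑ F (β y) + ∑ (support Fs) (β y)) (ℤₚ.+-identityʳ (+ M - C))
            (ℤₚ.+-mono-≤ (∑-block-attached F y len att) (0≤∑β y (support Fs))))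
      ∑-support-attached (block {F = F} {Fs} _ len _ _ fr) {y} (suc i) att =
        subst (+ M - C ≤_) (sym (∑-++ F (support Fs) (β y)))
          (subst (_≤ ∑ F (β y) + ∑ (support Fs) (β y)) (ℤₚ.+-identityˡ (+ M - C))
            (ℤₚ.+-mono-≤ (0≤∑β y F) (∑-support-attached fr i att)))

      ∑-support-doubly-attached : ∀ {r} {Fs : Vec _ r} → IsFrame x Fs → ∀ {y} i j → i ≢ j →
        Att y (lookup Fs i) → Att y (lookup Fs j) → (+ M - C) + (+ M - C) ≤ ∑ (support Fs) (β y)
      ∑-support-doubly-attached fr zero zero i≢j p q = ⊥-elim (i≢j refl)
      ∑-support-doubly-attached (block {F = F} {Fs} _ len _ _ fr) {y} zero (suc j) i≢j p q =
        subst ((+ M - C) + (+ M - C) ≤_) (sym (∑-++ F (support Fs) (β y)))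
          (ℤₚ.+-mono-≤ (∑-block-attached F y len p) (∑-support-attached fr j q))
      ∑-support-doubly-attached (block {F = F} {Fs} _ len _ _ fr) {y} (suc i) zero i≢j p q =
        subst ((+ M - C) + (+ M - C) ≤_) (sym (∑-++ F (support Fs) (β y)))
          (ℤₚ.+-mono-≤ (∑-block-attached F y len q) (∑-support-attached fr i p))
      ∑-support-doubly-attached (block {F = F} {Fs} _ len _ _ fr) {y} (suc i) (suc j) i≢j p q =
        subst ((+ M - C) + (+ M - C) ≤_) (sym (∑-++ F (support Fs) (β y)))
          (subst (_≤ ∑ F (β y) + ∑ (support Fs) (β y)) (ℤₚ.+-identityˡ _)
            (ℤₚ.+-mono-≤ (0≤∑β y F) (∑-support-doubly-attached fr i j (i≢j ∘ cong suc) p q)))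

      support-form : ∀ {r} {Fs : Vec _ r} → IsFrame x Fs →
        ⟨ support Fs , support Fs ⟩ ≤ + r * (+ M * + M) + frameExcess (+ r) * + M
      support-form [] = ℤₚ.≤-reflexive refl
      support-form {suc r} (block {F = F} {Fs} clique len _ det fr) = 0≤-⇒≤ (by
        (trans (cong (λ ff → ((+ M * (+ r * (K * C)) - ⟨ F , Φ ⟩) + (+ M * (+ r * (K * C)) - ⟨ F , Φ ⟩))
              + (+ r * (+ M * + M) + frameExcess (+ r) * + M - ⟨ Φ , Φ ⟩)
              + (K * C) * + M + ((+ M * + M + (K - 1ℤ) * + M) - ff)) FF)
          (trans (eq K C (+ M) (+ r) ⟨ F , F ⟩ ⟨ F , Φ ⟩ ⟨ Φ , Φ ⟩)
            (cong (λ z → (1ℤ + + r) * (+ M * + M) + frameExcess (1ℤ + + r) * + M - z) (sym (⟨⟩-square F Φ)))))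
        -- The two cross terms supply 2 r of the increment (1 + r)² - r² in `frameExcess`; the term
        -- K C M supplies the remaining 1.
        ((cross ⊕ cross) ⊕ ≤⇒0≤- (support-form fr) ⊕ 0≤KC ⊗ 0≤+ M
          ⊕ by (sym (ℤₚ.+-inverseʳ (+ M * + M + (K - 1ℤ) * + M))) ℤₚ.≤-refl))
        where
        Φ = support Fs
        FF : + M * + M + (K - 1ℤ) * + M ≡ ⟨ F , F ⟩
        FF = sym (trans (clique-form clique) (cong (λ l → + l * + l + (K - 1ℤ) * + l) len))
        cross : 0ℤ ≤ + M * (+ r * (K * C)) - ⟨ F , Φ ⟩
        cross = ≤⇒0≤- (subst (λ l → ⟨ F , Φ ⟩ ≤ + l * (+ r * (K * C))) len
          (∑-upper (All.map (λ {f} → ∑-support-detached Fs f) det)))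
        eq : ∀ k c m r ff fp pp →
          ((m * (r * (k * c)) - fp) + (m * (r * (k * c)) - fp))
            + (r * (m * m) + (r * (k - 1ℤ) + r * (r * (k * c))) * m - pp)
            + (k * c) * m + ((m * m + (k - 1ℤ) * m) - ff) ≡
          (1ℤ + r) * (m * m) + ((1ℤ + r) * (k - 1ℤ) + (1ℤ + r) * ((1ℤ + r) * (k * c))) * m
            - (ff + (fp + fp) + pp)
        eq = solve-∀

    -- Adds one class of size z: the square (t z - d)² replaces the division by the number of
    -- classes in Cauchy-Schwarz.
    linearised : ∀ t d z x r wz wx w → z * z ≤ wz →
      0ℤ ≤ t * t * wx - ((1ℤ + 1ℤ) * t * d * x - r * (d * d)) → wz + wx ≤ w →
      0ℤ ≤ t * t * w - ((1ℤ + 1ℤ) * t * d * (z + x) - (1ℤ + r) * (d * d))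
    linearised t d z x r wz wx w p q u = by (eq t d z x r wz wx w)
      (0≤square (t * z - d) ⊕ 0≤square t ⊗ ≤⇒0≤- p ⊕ q ⊕ 0≤square t ⊗ ≤⇒0≤- u)
      where
      eq : ∀ t d z x r wz wx w → (t * z - d) * (t * z - d) + t * t * (wz - z * z)
          + (t * t * wx - ((1ℤ + 1ℤ) * t * d * x - r * (d * d))) + t * t * (w - (wz + wx)) ≡
        t * t * w - ((1ℤ + 1ℤ) * t * d * (z + x) - (1ℤ + r) * (d * d))
      eq = solve-∀

    module _ {x : V G} where

      module FullFrame {Fs : Vec (List (V G)) (suc t)} (fr : IsFrame x Fs) where

        Φ = support Fs

        -- The Gram product of y with M x - Σ F. That vector has small norm, so the product stays
        -- small, although each of its two parts may be of order M.
        defect : V G → ℤ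
        defect y = + M * β x y - ∑ Φ (β y)

        -- Positivity of the form on M x − Σ F + a y.
        defect-inequality : ∀ a y → 0ℤ ≤ E * + M + (a * defect y + a * defect y) + K * (a * a)
        defect-inequality a y = by
          (trans (cong₂ (λ X W → K * (+ M * + M) + - 1ℤ * - 1ℤ * ⟨ Φ , Φ ⟩ + a * a * ⟨ Y , Y ⟩
                + (+ M * - 1ℤ * X + + M * - 1ℤ * X) + (+ M * a * ∑ Y (β x) + + M * a * ∑ Y (β x))
                + (- 1ℤ * a * W + - 1ℤ * a * W)
                + (K * (+ M * + M) + E * + M - ⟨ Φ , Φ ⟩)) (∑-support-center fr) (trans (⟨⟩-sym Φ Y) (⟨⟩-point y Φ)))
            (trans (cong₂ (λ Z B → K * (+ M * + M) + - 1ℤ * - 1ℤ * ⟨ Φ , Φ ⟩ + a * a * Z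
                + (+ M * - 1ℤ * (K * + M) + + M * - 1ℤ * (K * + M)) + (+ M * a * B + + M * a * B)
                + (- 1ℤ * a * ∑ Φ (β y) + - 1ℤ * a * ∑ Φ (β y))
                + (K * (+ M * + M) + E * + M - ⟨ Φ , Φ ⟩))
                (trans (⟨⟩-point y Y) (trans (ℤₚ.+-identityʳ _) (β-self y))) (ℤₚ.+-identityʳ (β x y)))
              (eq K (+ M) ⟨ Φ , Φ ⟩ a (β x y) (∑ Φ (β y)) E)))
          (psd₃ (+ M) (- 1ℤ) a x Φ Y ⊕ ≤⇒0≤- (support-form fr))
          where
          Y = y ∷ []
          eq : ∀ k m b a x w f → k * (m * m) + - 1ℤ * - 1ℤ * b + a * a * k
            + (m * - 1ℤ * (k * m) + m * - 1ℤ * (k * m)) + (m * a * x + m * a * x)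
            + (- 1ℤ * a * w + - 1ℤ * a * w)
            + (k * (m * m) + f * m - b) ≡ f * m + (a * (m * x - w) + a * (m * x - w)) + k * (a * a)
          eq = solve-∀

        private
          -- With weight ±s on y and a defect of size at least M - e, the form is at most E M - 2 s
          -- (M - e) + K s². As s = E + 1, this is -(E + 2) M up to an error that `M` exceeds.
          defect-bounded : ∀ {d} → 0ℤ ≤ E * + M + (d + d) + K * (s * s) → ¬ 0ℤ ≤ - (s * (+ M - e)) - d
          defect-bounded {d} p q = 0≰-1 (by (eq K (+ M) E e d)
              (p ⊕ (q ⊕ q) ⊕ error<M ⊕ 0≤s ⊗ 0≤+ M))
            where
            eq : ∀ k m f e d → f * m + (d + d) + k * ((f + 1ℤ) * (f + 1ℤ))
              + ((- ((f + 1ℤ) * (m - e)) - d) + (- ((f + 1ℤ) * (m - e)) - d))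
              + (m - (((f + 1ℤ) + (f + 1ℤ)) * e + k * ((f + 1ℤ) * (f + 1ℤ))) - 1ℤ) + (f + 1ℤ) * m ≡ - 1ℤ
            eq = solve-∀

        ¬low-defect : ∀ {y} → ¬ 0ℤ ≤ - (+ M - e) - defect y
        ¬low-defect {y} low = defect-bounded {s * defect y} (defect-inequality s y)
          (by (eq s (+ M - e) (defect y)) (0≤s ⊗ low))
          where
          eq : ∀ s m d → s * (- m - d) ≡ - (s * m) - s * d
          eq = solve-∀

        ¬high-defect : ∀ {y} → ¬ 0ℤ ≤ defect y - (+ M - e)
        ¬high-defect {y} high = defect-bounded { - s * defect y}
          (by (cong (λ z → E * + M + (- s * defect y + - s * defect y) + K * z) (eq′ s)) (defect-inequality (- s) y))
          (by (eq s (+ M - e) (defect y)) (0≤s ⊗ high))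
          where
          eq : ∀ s m d → s * (d - m) ≡ - (s * m) - (- s * d)
          eq = solve-∀
          eq′ : ∀ s → - s * - s ≡ s * s
          eq′ = solve-∀

        -- A non-neighbour has β = 0, so an attached block pushes its defect down to -(M - C).
        -- Likewise two blocks push that of a neighbour down to -(M - 2 C), and with no block it is
        -- at least M - K² C; `e` covers all three errors.
        non-neighbour-unattached : ∀ {y} → x ≢ y → ¬ Adj G x y → ∀ i → ¬ Att y (lookup Fs i)
        non-neighbour-unattached {y} x≢y x≁y i att = ¬low-defect (by
          (trans (eq (+ M) C (K * (K * C)) (∑ Φ (β y)))
            (cong (λ b → - (+ M - e) - (+ M * b - ∑ Φ (β y))) (sym (β-far x≢y x≁y))))
          (≤⇒0≤- (∑-support-attached fr i att) ⊕ (0≤+ c₀ ⊕ 0≤K ⊗ 0≤KC)))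
          where
          eq : ∀ m c k w → w - (m - c) + (c + k) ≡ - (m - (c + c + k)) - (m * 0ℤ - w)
          eq = solve-∀

        neighbour-attached : ∀ {y} → Adj G x y → ∃[ i ] Att y (lookup Fs i)
        neighbour-attached {y} x∼y with any? (λ i → att? y (lookup Fs i))
        ... | yes found = found
        ... | no none = ⊥-elim (¬high-defect (by
            (trans (eq (+ M) C (K * (K * C)) (∑ Φ (β y)))
              (cong (λ b → + M * b - ∑ Φ (β y) - (+ M - e)) (sym (β-adjacent x∼y))))
            (≤⇒0≤- (∑-support-detached Fs y detached) ⊕ (0≤+ c₀ ⊕ 0≤+ c₀))))
          where
          detached : ∀ i → Det y (lookup Fs i)
          detached i with attached-or-detached y (clique-at fr i)
          ... | inj₁ att = ⊥-elim (none (i , att))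
          ... | inj₂ det = det
          eq : ∀ m c k w → k - w + (c + c) ≡ m * 1ℤ - w - (m - (c + c + k))
          eq = solve-∀

        neighbour-attached-once : ∀ {y} → Adj G x y → ∀ i j → Att y (lookup Fs i) → Att y (lookup Fs j) → i ≡ j
        neighbour-attached-once {y} x∼y i j p q with i ≟ j
        ... | yes i≡j = i≡j
        ... | no i≢j = ⊥-elim (¬low-defect (by
            (trans (eq (+ M) C (K * (K * C)) (∑ Φ (β y)))
              (cong (λ b → - (+ M - e) - (+ M * b - ∑ Φ (β y))) (sym (β-adjacent x∼y))))
            (≤⇒0≤- (∑-support-doubly-attached fr i j i≢j p q) ⊕ 0≤K ⊗ 0≤KC)))
          where
          eq : ∀ m c k w → w - ((m - c) + (m - c)) + k ≡ - (m - (c + c + k)) - (m * 1ℤ - w)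
          eq = solve-∀

      -- If y missed R vertices of Z, Ramsey's theorem would give a large clique D among them. All
      -- of D is attached to F and y is detached from D, so y could not be attached to F.
      block-dense : ∀ {F Z} → Clique F → length F ≡ M → Unique Z → All (Adj G x) Z → All (λ z → Att z F) Z →
        All (λ y → + length Z ≤ + R + ∑ Z (ν y)) Z
      block-dense {F} {Z} clique len unique adj atts = All.map dense atts
        where
        dense : ∀ {y} → Att y F → + length Z ≤ + R + ∑ Z (ν y)
        dense {y} att with R ℕₚ.≤? length (filter (¬? ∘ near? y) Z)
        ... | no few = 0≤-⇒≤ (by
                (trans (eq (+ R) (∑ Z (ν y)) (∑ Z (ν̄ y))) (cong (λ l → + R + ∑ Z (ν y) - l) (∑ν+∑ν̄ y Z)))
                (≤⇒0≤- (subst (_≤ + R) (length-far y Z) (ℤ.+≤+ (ℕₚ.<⇒≤ (ℕₚ.≰⇒> few))))))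
          where
          eq : ∀ r n m → r - m ≡ r + n - (n + m)
          eq = solve-∀
        ... | yes many with D , D⊆ , D-clique , D-len ← large-clique {x}
                (AllPairs-⊆ (filter-⊆ (¬? ∘ near? y) Z) unique)
                (All-resp-⊆ (filter-⊆ (¬? ∘ near? y) Z) adj) many =
          ⊥-elim (detached-source⇒¬attached-target {c₀} {m₁} {D} {F} {y} ℕₚ.≤-refl D-clique clique
            (subst (m₁ ℕ.≤_) (sym D-len) m₁≤M) (subst (m₁ ℕ.≤_) (sym len) m₁≤M)
            (All-resp-⊆ (⊆-trans D⊆ (filter-⊆ (¬? ∘ near? y) Z)) atts)
            (ℤₚ.≤-trans (far⇒detached-0 {y} {D} (All-resp-⊆ D⊆ (Allₚ.all-filter (¬? ∘ near? y) Z))) (0≤+ c₀))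
            att)

      -- Counts near pairs, with R added per row for the vertices missed in `block-dense`, so that a
      -- class of size z has weight at least z².
      weight : List (V G) → List (V G) → ℤ
      weight X Y = ∑ X λ y → + R + ∑ Y (ν y)

      weight-mono : ∀ {X X′ Y Y′} → X ⊆ X′ → Y ⊆ Y′ → weight X Y ≤ weight X′ Y′
      weight-mono {X} {X′} {Y} {Y′} p q = ℤₚ.≤-trans
        (∑-mono′ X λ y → ℤₚ.+-monoʳ-≤ (+ R) (∑-⊆ (0≤ν y) q))
        (∑-⊆ (λ y → 0≤+ R ⊕ subst (_≤ ∑ Y′ (ν y)) (∑-zero Y′) (∑-mono′ Y′ (0≤ν y))) p)

      -- A Cauchy–Schwarz inequality for the class sizes z₁, …, z_r, linearised as
      -- T² z² ≥ 2 T z d − d².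
      frame-weight : ∀ {r} {Fs : Vec _ r} → IsFrame x Fs → ∀ T d X → Unique X → All (Adj G x) X →
        All (λ y → ∃[ i ] Att y (lookup Fs i)) X →
        0ℤ ≤ T * T * weight X X - ((1ℤ + 1ℤ) * T * d * + length X - + r * (d * d))
      frame-weight [] T d [] _ _ _ = ℤₚ.≤-reflexive (sym (eq T d))
        where
        eq : ∀ t d → t * t * 0ℤ - ((1ℤ + 1ℤ) * t * d * 0ℤ - 0ℤ * (d * d)) ≡ 0ℤ
        eq = solve-∀
      frame-weight [] T d (y ∷ X) _ _ ((() , _) ∷ _)
      frame-weight {suc r} (block {F = F} {Fs} clique len _ _ fr) T d X unique adj atts =
        subst (λ l → 0ℤ ≤ T * T * weight X X - ((1ℤ + 1ℤ) * T * d * l - + suc r * (d * d))) lengths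
          (linearised T d (+ length Z) (+ length X′) (+ r) (weight Z Z) (weight X′ X′) (weight X X)
            Z-dense (frame-weight fr T d X′ (AllPairs-⊆ X′⊆ unique) (All-resp-⊆ X′⊆ adj) rest) parts)
        where
        att-F? = λ y → att? y F
        Z = filter att-F? X
        X′ = filter (¬? ∘ att-F?) X
        Z⊆ : Z ⊆ X
        Z⊆ = filter-⊆ att-F? X
        X′⊆ : X′ ⊆ X
        X′⊆ = filter-⊆ (¬? ∘ att-F?) X
        Z-dense : + length Z * + length Z ≤ weight Z Z
        Z-dense = ∑-lower (block-dense clique len (AllPairs-⊆ Z⊆ unique) (All-resp-⊆ Z⊆ adj) (Allₚ.all-filter att-F? X))
        parts : weight Z Z + weight X′ X′ ≤ weight X X
        parts = subst (weight Z Z + weight X′ X′ ≤_) (sym (∑-partition att-F? X (λ y → + R + ∑ X (ν y))))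
          (ℤₚ.+-mono-≤ (weight-mono {Z} {Z} {Z} {X} ⊆-refl Z⊆) (weight-mono {X′} {X′} {X′} {X} ⊆-refl X′⊆))
        rest : All (λ y → ∃[ i ] Att y (lookup Fs i)) X′
        rest = All.zipWith (λ { ((zero , p) , ¬p) → ⊥-elim (¬p p) ; ((suc i , p) , _) → i , p })
          (All-resp-⊆ X′⊆ atts , Allₚ.all-filter (¬? ∘ att-F?) X)
        lengths : + length Z + + length X′ ≡ + length X
        lengths = trans (sym (ℤₚ.pos-+ (length Z) (length X′))) (cong +_ (sym (length-partition att-F? X)))

-- Full frames from the sparsity of the local graph

module FrameExistence where

  open Cliques
  open Frames
  open IntegerSums
  open GramForms using (module Weights)
  open import Data.Bool.Base using (true; false; if_then_else_; _∨_)
  open import Data.Empty using (⊥-elim)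
  open import Data.Fin.Base using (Fin; zero; suc)
  open import Data.Fin.Properties using (_≟_; any?)
  open import Data.Integer.Base as ℤ using (ℤ; +_; 1ℤ; 0ℤ; _+_; _-_; _*_; -_; _≤_)
  import Data.Integer.Properties as ℤₚ
  open import Data.Integer.Tactic.RingSolver using (solve-∀)
  open import Data.List.Base using (List; []; _∷_; length; filter; allFin)
  open import Data.List.Relation.Binary.Sublist.Propositional using ([]; _∷_; ⊆-trans)
  open import Data.List.Relation.Binary.Sublist.Propositional.Properties using (All-resp-⊆; filter-⊆)
  open import Data.List.Relation.Unary.All as All using (All; []; _∷_)
  import Data.List.Relation.Unary.All.Properties as Allₚ
  open import Data.List.Relation.Unary.AllPairs using ([]; _∷_)
  open import Data.List.Relation.Unary.Unique.Propositional using (Unique)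
  open import Data.Nat.Base as ℕ using (ℕ; zero; suc)
  import Data.Nat.Properties as ℕₚ
  open import Data.Product.Base using (∃-syntax; _,_)
  open import Data.Sum.Base using (inj₁; inj₂)
  open import Function.Base using (_∘_)
  open import Relation.Binary.PropositionalEquality using (_≡_; _≢_; refl; sym; trans; cong; cong₂; subst; subst₂)
  open import Relation.Nullary using (Dec; ¬_; yes; no; does)
  open import Relation.Nullary.Decidable using (¬?; dec-false)
  open import Data.Vec.Base using (Vec; []; _∷_; lookup)
  import Data.List.Base as List
  import Data.List.Relation.Unary.Unique.Propositional.Properties as Uniqueₚ
  import Data.List.Properties as Listₚ
  open import Data.Nat.ListAction using (sum)
  import Data.Rational.Base as ℚ
  import Data.Rational.Properties as ℚₚ
  import Data.Rational.Unnormalised.Base as ℚᵘ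
  import Data.Rational.Unnormalised.Properties as ℚᵘₚ
  open import Function.Base using (id)

  /-mono⁻ : ∀ a m b n → a ℚ./ suc m ℚ.≤ b ℚ./ suc n → a * + suc n ≤ b * + suc m
  /-mono⁻ a m b n a/m≤b/n with ℚᵘₚ.≤-respˡ-≃ (ℚₚ.toℚᵘ-fromℚᵘ (ℚᵘ.mkℚᵘ a m))
    (ℚᵘₚ.≤-respʳ-≃ (ℚₚ.toℚᵘ-fromℚᵘ (ℚᵘ.mkℚᵘ b n)) (ℚₚ.toℚᵘ-mono-≤ a/m≤b/n))
  ... | ℚᵘ.*≤* le = le

  averageDegree-bound : ∀ G xs z t → averageDegree (inducedOn G xs) ℚ.≤ z ℚ./ suc t →
    + degreeSum (inducedOn G xs) * + suc t ≤ z * + length xs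
  averageDegree-bound G []       z t _  = ℤₚ.≤-reflexive (trans (ℤₚ.*-zeroˡ (+ suc t)) (sym (ℤₚ.*-zeroʳ z)))
  averageDegree-bound G (x ∷ xs) z t le = /-mono⁻ (+ degreeSum (inducedOn G (x ∷ xs))) (length xs) z t le

  ∑-map : ∀ {A B : Set} (g : A → B) xs f → ∑ (List.map g xs) f ≡ ∑ xs (f ∘ g)
  ∑-map g []       f = refl
  ∑-map g (x ∷ xs) f = cong (λ s → f (g x) + s) (∑-map g xs f)

  ∑-lookup : ∀ {A : Set} (xs : List A) f → ∑ (allFin (length xs)) (f ∘ List.lookup xs) ≡ ∑ xs f
  ∑-lookup xs f = trans (sym (∑-map (List.lookup xs) (allFin (length xs)) f))
    (cong (λ ys → ∑ ys f) (trans (Listₚ.map-tabulate id (List.lookup xs)) (Listₚ.tabulate-lookup xs)))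

  sum-∑ : ∀ {A : Set} (f : A → ℕ) xs → + sum (List.map f xs) ≡ ∑ xs (λ x → + f x)
  sum-∑ f []       = refl
  sum-∑ f (x ∷ xs) = trans (ℤₚ.pos-+ (f x) (sum (List.map f xs))) (cong (λ s → + f x + s) (sum-∑ f xs))

  module LocalDegrees (G : Graph) where

    α : V G → V G → ℤ
    α x y = if does (adj? G x y) then 1ℤ else 0ℤ

    -- The induced graph lives on positions; its degrees are pulled back to sums over the list
    -- itself.
    degreeSum-∑ : ∀ xs → + degreeSum (inducedOn G xs) ≡ ∑ xs (λ y → ∑ xs (α y))
    degreeSum-∑ xs = trans (sum-∑ (degree (inducedOn G xs)) (allFin (length xs)))
      (trans (∑-cong (allFin (length xs)) λ i →
          trans (length-filter-∑ (adj? (inducedOn G xs) i) (allFin (length xs)))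
            (∑-lookup xs (α (List.lookup xs i))))
        (∑-lookup xs (λ y → ∑ xs (α y))))

  -- Here the `t` of the theorem is `suc t`, and k is `suc (suc t)`.
  module Existence (G : Graph) (t : ℕ) (psd : Weights.PositiveSemidefinite G (suc (suc t))) where
    open Constants (suc t)
    open Geometry G (suc t) psd
    open FrameTheory G (suc t) psd
    open LocalDegrees G

    ν-distinct : ∀ {x y} → x ≢ y → ν x y ≡ α x y
    ν-distinct {x} {y} x≢y = cong (λ b → if b ∨ does (adj? G x y) then 1ℤ else 0ℤ) (dec-false (x ≟ y) x≢y)

    ν≤1 : ∀ x y → ν x y ≤ 1ℤ
    ν≤1 x y = subst (ν x y ≤_) (ν+ν̄ x y)
      (subst (_≤ ν x y + ν̄ x y) (ℤₚ.+-identityʳ (ν x y)) (ℤₚ.+-monoʳ-≤ (ν x y) (0≤ν̄ x y)))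

    0≤α : ∀ x y → 0ℤ ≤ α x y
    0≤α x y = indicator (does (adj? G x y))
      where
      indicator : ∀ b → 0ℤ ≤ (if b then 1ℤ else 0ℤ)
      indicator true  = 0≤+ 1
      indicator false = 0≤+ 0

    -- `ν` and `α` can differ only at `y` itself, which a list without repetitions contains at most
    -- once.
    ∑ν≤∑α+1 : ∀ y {N} → Unique N → ∑ N (ν y) ≤ ∑ N (α y) + 1ℤ
    ∑ν≤∑α+1 y [] = 0≤+ 1
    ∑ν≤∑α+1 y {z ∷ N} (z∉N ∷ unique) = by-cases (y ≟ z)
      where
      eq : ∀ a s → a ≡ a + s + 1ℤ - (1ℤ + s)
      eq = solve-∀
      by-cases : Dec (y ≡ z) → ν y z + ∑ N (ν y) ≤ α y z + ∑ N (α y) + 1ℤ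
      by-cases (no y≢z) = subst₂ _≤_ (cong (λ v → v + ∑ N (ν y)) (sym (ν-distinct y≢z)))
        (sym (ℤₚ.+-assoc (α y z) (∑ N (α y)) 1ℤ)) (ℤₚ.+-monoʳ-≤ (α y z) (∑ν≤∑α+1 y unique))
      by-cases (yes refl) = ℤₚ.≤-trans
        (ℤₚ.+-mono-≤ (ν≤1 y y) (∑-mono (All.map (λ y≢ → ℤₚ.≤-reflexive (ν-distinct y≢)) z∉N)))
        (0≤-⇒≤ (by (eq (α y y) (∑ N (α y))) (0≤α y y)))

    -- The frame weight makes t w at least 2 d (d - ρ) - d², while sparsity makes it at most t d ρ +
    -- t d + d² - κ d with κ = 1 + 2 ρ + t ρ + t. Comparing the two leaves d ≤ 0.
    counting : ∀ t r ρ d S l w → 1ℤ ≤ t → 1ℤ ≤ d → r ≤ t → d ≤ l + ρ → w ≤ d * ρ + (S + d) →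
      S * t ≤ (d - (1ℤ + (ρ + ρ + t * ρ + t))) * d →
      ¬ 0ℤ ≤ t * t * w - ((1ℤ + 1ℤ) * t * d * l - r * (d * d))
    counting t r ρ d S l w 1≤t 1≤d r≤t d≤l+ρ w≤ S≤ p = 0≰-1 (by (eq₂ t ρ d S w)
        (0≤u ⊕ 0≤t ⊗ ≤⇒0≤- w≤ ⊕ ≤⇒0≤- S≤ ⊕ ≤⇒0≤- 1≤d))
      where
      0≤t = ℤₚ.≤-trans (0≤+ 1) 1≤t
      0≤d = ℤₚ.≤-trans (0≤+ 1) 1≤d
      u = t * w - (1ℤ + 1ℤ) * d * (d - ρ) + d * d
      0≤tu : 0ℤ ≤ t * u
      0≤tu = by (eq₁ t r ρ d l w)
        (p ⊕ (0≤t ⊗ 0≤d ⊗ ≤⇒0≤- d≤l+ρ ⊕ 0≤t ⊗ 0≤d ⊗ ≤⇒0≤- d≤l+ρ) ⊕ ≤⇒0≤- r≤t ⊗ 0≤square d)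
        where
        eq₁ : ∀ t r ρ d l w → t * t * w - ((1ℤ + 1ℤ) * t * d * l - r * (d * d))
            + (t * d * (l + ρ - d) + t * d * (l + ρ - d)) + (t - r) * (d * d) ≡
          t * (t * w - (1ℤ + 1ℤ) * d * (d - ρ) + d * d)
        eq₁ = solve-∀
      cancel : ∀ t {u} → 1ℤ ≤ t → 0ℤ ≤ t * u → 0ℤ ≤ u
      cancel (+ suc t) {u} _ q = ℤₚ.*-cancelˡ-≤-pos 0ℤ u (+ suc t) (subst (_≤ + suc t * u) (sym (ℤₚ.*-zeroʳ (+ suc t))) q)
      cancel (+ 0) (ℤ.+≤+ ()) q
      0≤u : 0ℤ ≤ u
      0≤u = cancel t 1≤t 0≤tu
      eq₂ : ∀ t ρ d S w → t * w - (1ℤ + 1ℤ) * d * (d - ρ) + d * d + t * (d * ρ + (S + d) - w)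
          + ((d - (1ℤ + (ρ + ρ + t * ρ + t))) * d - S * t) + (d - 1ℤ) ≡ - 1ℤ
      eq₂ = solve-∀

    module _ (x : V G) (κ<d : κ ℕ.< degree G x)
      (sparse : averageDegree (localGraph G x) ℚ.≤ (+ degree G x - + κ) ℚ./ suc t) where

      private
        N : List (V G)
        N = neighbours G x

        N-unique : Unique N
        N-unique = Uniqueₚ.filter⁺ (adj? G x) (Uniqueₚ.allFin⁺ (order G))

        N-adjacent : All (Adj G x) N
        N-adjacent = Allₚ.all-filter (adj? G x) (allFin (order G))

        S : ℤ
        S = ∑ N (λ y → ∑ N (α y))

        S-bound : S * + suc t ≤ (+ length N - + κ) * + length N
        S-bound = subst (λ s → s * + suc t ≤ (+ length N - + κ) * + length N) (degreeSum-∑ N)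
          (averageDegree-bound G N (+ length N - + κ) t sparse)

        κ-ℤ : + κ ≡ 1ℤ + (+ R + + R + + suc t * + R + + suc t)
        κ-ℤ = cong (λ z → 1ℤ + z) (trans (ℤₚ.pos-+ (R ℕ.+ R ℕ.+ suc t ℕ.* R) (suc t))
          (cong (_+ + suc t) (trans (ℤₚ.pos-+ (R ℕ.+ R) (suc t ℕ.* R)) (cong₂ _+_ (ℤₚ.pos-+ R R) (ℤₚ.pos-* (suc t) R)))))

        weight-upper : weight {x} N N ≤ + length N * + R + (S + + length N)
        weight-upper = subst (weight {x} N N ≤_) (trans (∑-distrib-+ N (λ _ → + R) (λ y → ∑ N (α y) + 1ℤ))
            (cong₂ _+_ (∑-const N (+ R)) (trans (∑-distrib-+ N (λ y → ∑ N (α y)) (λ _ → 1ℤ))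
              (cong (λ z → S + z) (trans (∑-const N 1ℤ) (ℤₚ.*-identityʳ (+ length N)))))))
          (∑-mono′ N λ y → ℤₚ.+-monoʳ-≤ (+ R) (∑ν≤∑α+1 y N-unique))

      private
        found? : ∀ {r} (Fs : Vec (List (V G)) r) y → Dec (∃[ i ] Att y (lookup Fs i))
        found? Fs y = any? λ i → att? y (lookup Fs i)

      extend : ∀ {r} {Fs : Vec (List (V G)) r} → r ℕ.≤ suc t → IsFrame x Fs → ∃[ F ] IsFrame x (F ∷ Fs)
      extend {r} {Fs} r≤t fr with R ℕₚ.≤? length (filter (¬? ∘ found? Fs) N)
      ... | yes many =
        let F , F⊆U , clique , len = large-clique {x} (AllPairs-⊆ U⊆N N-unique) (All-resp-⊆ U⊆N N-adjacent) many
        in F , block clique len (All-resp-⊆ (⊆-trans F⊆U U⊆N) N-adjacent)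
             (All.map detached (All-resp-⊆ F⊆U (Allₚ.all-filter (¬? ∘ found? Fs) N))) fr
        where
        U⊆N = filter-⊆ (¬? ∘ found? Fs) N
        detached : ∀ {y} → ¬ (∃[ i ] Att y (lookup Fs i)) → ∀ i → Det y (lookup Fs i)
        detached {y} none i with attached-or-detached y (clique-at fr i)
        ... | inj₁ att = ⊥-elim (none (i , att))
        ... | inj₂ det = det
      ... | no few = ⊥-elim (counting (+ suc t) (+ r) (+ R) (+ length N) S (+ length X) (weight {x} X X)
          (ℤ.+≤+ (ℕ.s≤s ℕ.z≤n)) (ℤ.+≤+ (ℕₚ.≤-trans (ℕ.s≤s ℕ.z≤n) κ<d)) (ℤ.+≤+ r≤t)
          (subst (+ length N ≤_) (ℤₚ.pos-+ (length X) R) (ℤ.+≤+ N≤X+R))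
          (ℤₚ.≤-trans (weight-mono {x} X⊆N X⊆N) weight-upper)
          (subst (λ z → S * + suc t ≤ (+ length N - z) * + length N) κ-ℤ S-bound)
          (frame-weight fr (+ suc t) (+ length N) X (AllPairs-⊆ X⊆N N-unique) (All-resp-⊆ X⊆N N-adjacent)
            (Allₚ.all-filter (found? Fs) N)))
        where
        X = filter (found? Fs) N
        X⊆N = filter-⊆ (found? Fs) N
        N≤X+R : length N ℕ.≤ length X ℕ.+ R
        N≤X+R = subst (ℕ._≤ length X ℕ.+ R) (sym (length-partition (found? Fs) N))
          (ℕₚ.+-monoʳ-≤ (length X) (ℕₚ.<⇒≤ (ℕₚ.≰⇒> few)))

      full-frame : ∃[ Fs ] IsFrame x {suc (suc t)} Fs
      full-frame = build (suc (suc t)) ℕₚ.≤-refl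
        where
        build : ∀ r → r ℕ.≤ suc (suc t) → ∃[ Fs ] IsFrame x {r} Fs
        build zero    _         = [] , []
        -- Stripping one successor from the bound on the number of blocks gives exactly the bound on
        -- r that `extend` asks for.
        build (suc r) (ℕ.s≤s p) =
          let Fs , fr = build r (ℕₚ.m≤n⇒m≤1+n p)
              F , fr′ = extend p fr
          in F ∷ Fs , fr′

-- Line systems and the hypergraph of their lines

module Lines where

  open Cliques
  open Frames
  open IntegerSums
  open GramForms using (module Weights)
  open import Data.Bool.Base using (true; false)
  open import Data.Empty using (⊥-elim)
  open import Data.Fin.Base using (Fin; zero; suc)
  open import Data.Fin.Properties using (_≟_)
  open import Data.Integer.Base using (+_; _+_; _-_; _*_; -_; _≤_)
  import Data.Integer.Properties as ℤₚ
  open import Data.Integer.Tactic.RingSolver using (solve-∀)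
  open import Data.List.Base using (List; _∷_; length; filter)
  open import Data.List.Relation.Binary.Sublist.Propositional using (_⊆_; _∷_; ⊆-trans)
  open import Data.List.Relation.Binary.Sublist.Propositional.Properties using (filter-⊆)
  open import Data.List.Relation.Unary.All as All using (All; _∷_)
  import Data.List.Relation.Unary.All.Properties as Allₚ
  open import Data.List.Relation.Unary.AllPairs using (_∷_)
  open import Data.List.Relation.Unary.Unique.Propositional using (Unique)
  open import Data.Nat.Base as ℕ using (ℕ; zero; suc)
  import Data.Nat.Properties as ℕₚ
  open import Data.Product.Base using (∃-syntax; _×_; _,_; proj₁; proj₂)
  open import Data.Sum.Base using (inj₁; inj₂)
  open import Function.Base using (_∘_)
  open import Relation.Binary.PropositionalEquality using (_≡_; _≢_; refl; sym; trans; cong; cong₂; subst; subst₂)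
  open import Relation.Nullary using (Dec; yes; no)
  open import Function.Bundles using (mk⇔)

  open import Data.Fin.Base as Fin using (combine; cast)
  open import Data.Fin.Properties as Finₚ using (combine-injective; cast-involutive)
  open import Data.Fin.Subset using (Subset; Nonempty; _∩_; _∪_; ⁅_⁆; ∣_∣; ⊥) renaming (_∈_ to _∈ₛ_; _∉_ to _∉ₛ_)
  import Data.Fin.Subset.Properties as Subsetₚ
  import Data.List.Base as List
  import Data.List.Properties as Listₚ
  import Data.List.Membership.Propositional.Properties as Memberₚ
  import Data.List.Relation.Unary.Unique.Propositional.Properties as Uniqueₚ
  open import Data.Vec.Base using (_∷_; lookup; here; there)
  open import Function.Bundles using (_⇔_; mk↔ₛ′)

  least : ∀ {n} {P : Fin n → Set} → (∀ x → Dec (P x)) → ∃[ x ] P x → ∃[ x ] P x × (∀ y → P y → x Fin.≤ y)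
  least {suc n} P? (x , p) with P? zero
  least {suc n} P? (x , p)     | yes p₀ = zero , p₀ , λ _ _ → ℕ.z≤n
  least {suc n} P? (zero , p)  | no ¬p₀ = ⊥-elim (¬p₀ p)
  least {suc n} {P} P? (suc x , p) | no ¬p₀ =
    let y , q , minimal = least (P? ∘ suc) (x , p)
        above : ∀ z → P z → suc y Fin.≤ z
        above = λ { zero p₀ → ⊥-elim (¬p₀ p₀) ; (suc z) r → ℕ.s≤s (minimal z r) }
    in suc y , q , above

  ∣⁅x⁆∪p∣ : ∀ {n} (x : Fin n) (p : Subset n) → x ∉ₛ p → ∣ ⁅ x ⁆ ∪ p ∣ ≡ suc ∣ p ∣
  ∣⁅x⁆∪p∣ zero    (true ∷ p)  x∉p = ⊥-elim (x∉p here)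
  ∣⁅x⁆∪p∣ zero    (false ∷ p) x∉p = cong (suc ∘ ∣_∣) (Subsetₚ.∪-identityˡ p)
  ∣⁅x⁆∪p∣ (suc x) (true ∷ p)  x∉p = cong suc (∣⁅x⁆∪p∣ x p (x∉p ∘ there))
  ∣⁅x⁆∪p∣ (suc x) (false ∷ p) x∉p = ∣⁅x⁆∪p∣ x p (x∉p ∘ there)

  image : ∀ {k n} → (Fin k → Fin n) → Subset n
  image {zero}  f = ⊥
  image {suc k} f = ⁅ f zero ⁆ ∪ image (f ∘ suc)

  ∈-image⁺ : ∀ {k n} (f : Fin k → Fin n) i → f i ∈ₛ image f
  ∈-image⁺ f zero    = Subsetₚ.x∈p∪q⁺ (inj₁ (Subsetₚ.x∈⁅x⁆ (f zero)))
  ∈-image⁺ f (suc i) = Subsetₚ.x∈p∪q⁺ {p = ⁅ f zero ⁆} (inj₂ (∈-image⁺ (f ∘ suc) i))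

  ∈-image⁻ : ∀ {k n} (f : Fin k → Fin n) {x} → x ∈ₛ image f → ∃[ i ] f i ≡ x
  ∈-image⁻ {zero} f x∈ = ⊥-elim (Subsetₚ.∉⊥ x∈)
  ∈-image⁻ {suc k} f x∈ with Subsetₚ.x∈p∪q⁻ ⁅ f zero ⁆ (image (f ∘ suc)) x∈
  ... | inj₁ p = zero , sym (Subsetₚ.x∈⁅y⁆⇒x≡y (f zero) p)
  ... | inj₂ p = let i , eq = ∈-image⁻ (f ∘ suc) p in suc i , eq

  ∣image∣ : ∀ {k n} (f : Fin k → Fin n) → (∀ {i j} → f i ≡ f j → i ≡ j) → ∣ image f ∣ ≡ k
  ∣image∣ {zero} {n} f injective = Subsetₚ.∣⊥∣≡0 n
  ∣image∣ {suc k} f injective = trans (∣⁅x⁆∪p∣ (f zero) (image (f ∘ suc)) fresh)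
    (cong suc (∣image∣ (f ∘ suc) λ eq → Finₚ.suc-injective (injective eq)))
    where
    fresh : f zero ∉ₛ image (f ∘ suc)
    fresh p = let i , eq = ∈-image⁻ (f ∘ suc) p in Finₚ.0≢1+n (injective (sym eq))

  -- On x i is the i-th of the k lines through x.
  record LineSystem (G : Graph) (k : ℕ) : Set₁ where
    field
      On        : V G → Fin k → V G → Set
      on?       : ∀ x i y → Dec (On x i y)
      on-self   : ∀ x i → On x i x
      companion : ∀ x i → ∃[ y ] x ≢ y × On x i y
      on⇒adj    : ∀ {x i y} → x ≢ y → On x i y → Adj G x y
      adj⇒on    : ∀ {x y} → Adj G x y → ∃[ i ] On x i y
      on-unique : ∀ {x i j y} → x ≢ y → On x i y → On x j y → i ≡ j
      transfer  : ∀ {x i y} → On x i y → ∃[ j ] (∀ z → On x i z → On y j z)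

  module LineHypergraph {G : Graph} {k : ℕ} (lines : LineSystem G (suc (suc k))) where
    open LineSystem lines

    record SameLine (x : V G) (i : Fin (suc (suc k))) (y : V G) (j : Fin (suc (suc k))) : Set where
      constructor same
      field
        to   : ∀ z → On x i z → On y j z
        from : ∀ z → On y j z → On x i z
    open SameLine

    same-sym : ∀ {x i y j} → SameLine x i y j → SameLine y j x i
    same-sym (same f g) = same g f

    same-trans : ∀ {x i y j z l} → SameLine x i y j → SameLine y j z l → SameLine x i z l
    same-trans (same f g) (same f′ g′) = same (λ w → f′ w ∘ f w) (λ w → g w ∘ g′ w)

    -- The companion excludes a line consisting of x alone, about which `on-unique` would say
    -- nothing.
    same-index : ∀ {x i j} → (∀ z → On x i z → On x j z) → i ≡ j
    same-index {x} {i} sub = let y , x≢y , on = companion x i in on-unique x≢y on (sub y on)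

    -- `transfer` is one-sided. Going from x to y and back yields a line through x that contains the
    -- first one; by `same-index` the two coincide, so the inclusions are equalities.
    line-through : ∀ {x i y} → On x i y → ∃[ j ] SameLine x i y j
    line-through {x} {i} {y} on =
      let j , sub = transfer on
          i′ , sub′ = transfer (sub x (on-self x i))
          i≡i′ = same-index λ z → sub′ z ∘ sub z
      in j , same sub λ z → subst (λ l → On x l z) (sym i≡i′) ∘ sub′ z

    -- Every line is represented by its least vertex.
    base : ∀ x i → ∃[ y ] On x i y × (∀ z → On x i z → y Fin.≤ z)
    base x i = least (on? x i) (x , on-self x i)

    root : V G → Fin (suc (suc k)) → V G
    root x i = proj₁ (base x i)

    slot : V G → Fin (suc (suc k)) → Fin (suc (suc k))
    slot x i = proj₁ (line-through (proj₁ (proj₂ (base x i))))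

    same-root : ∀ x i → SameLine x i (root x i) (slot x i)
    same-root x i = proj₂ (line-through (proj₁ (proj₂ (base x i))))

    -- A line is coded by its least vertex and its index there, so equality of lines becomes
    -- equality of numbers. Pairs that code no line remain as vertices in no edge.
    point : V G → Fin (suc (suc k)) → Fin (order G ℕ.* suc (suc k))
    point x i = combine (root x i) (slot x i)

    point≡⇒same : ∀ {x i y j} → point x i ≡ point y j → SameLine x i y j
    point≡⇒same {x} {i} {y} {j} eq =
      let root≡ , slot≡ = combine-injective (root x i) (slot x i) (root y j) (slot y j) eq
      in same-trans (subst₂ (SameLine x i) root≡ slot≡ (same-root x i)) (same-sym (same-root y j))

    same⇒point≡ : ∀ {x i y j} → SameLine x i y j → point x i ≡ point y j
    same⇒point≡ {x} {i} {y} {j} xi≡yj = cong₂ combine root≡ slot≡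
      where
      root≡ : root x i ≡ root y j
      root≡ = Finₚ.≤-antisym
        (proj₂ (proj₂ (base x i)) (root y j) (from xi≡yj _ (proj₁ (proj₂ (base y j)))))
        (proj₂ (proj₂ (base y j)) (root x i) (to xi≡yj _ (proj₁ (proj₂ (base x i)))))
      slot≡ : slot x i ≡ slot y j
      slot≡ = same-index (to (subst (λ r → SameLine r (slot x i) (root y j) (slot y j)) root≡
        (same-trans (same-sym (same-root x i)) (same-trans xi≡yj (same-root y j)))))

    point-injective : ∀ {x i j} → point x i ≡ point x j → i ≡ j
    point-injective eq = same-index (to (point≡⇒same eq))

    edge : V G → Subset (order G ℕ.* suc (suc k))
    edge x = image (point x)

    meeting⇒on : ∀ {x i y j} → point x i ≡ point y j → On x i y
    meeting⇒on {x} {i} {y} {j} eq = from (point≡⇒same eq) y (on-self y j)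

    common-point : ∀ {x y p q} → x ≢ y → p ∈ₛ edge x → q ∈ₛ edge x → p ∈ₛ edge y → q ∈ₛ edge y → p ≡ q
    common-point {x} {y} x≢y p∈x q∈x p∈y q∈y
      with i , refl ← ∈-image⁻ (point x) p∈x
      with j , refl ← ∈-image⁻ (point x) q∈x
      with i′ , eq ← ∈-image⁻ (point y) p∈y
      with j′ , eq′ ← ∈-image⁻ (point y) q∈y =
      cong (point x) (on-unique x≢y (meeting⇒on (sym eq)) (meeting⇒on (sym eq′)))

    -- Equal edges of distinct vertices would share two points, against `common-point`; this is
    -- where at least two lines through each vertex are used.
    edge-injective : ∀ {x y} → edge x ≡ edge y → x ≡ y
    edge-injective {x} {y} eq with x ≟ y
    ... | yes x≡y = x≡y
    ... | no x≢y = ⊥-elim (Finₚ.0≢1+n (point-injective {x} {zero} {suc zero}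
      (common-point x≢y (∈-image⁺ (point x) zero) (∈-image⁺ (point x) (suc zero))
        (subst (point x zero ∈ₛ_) eq (∈-image⁺ (point x) zero))
        (subst (point x (suc zero) ∈ₛ_) eq (∈-image⁺ (point x) (suc zero))))))

    hypergraph : Hypergraph
    hypergraph = record
      { size     = order G ℕ.* suc (suc k)
      ; edges    = List.tabulate edge
      ; distinct = Uniqueₚ.tabulate⁺ edge-injective
      ; nonempty = Allₚ.tabulate⁺ λ x → point x zero , ∈-image⁺ (point x) zero
      }

    linear : Linear hypergraph
    linear p q p≢q e∈ e′∈ p∈e q∈e p∈e′ q∈e′
      with x , refl ← Memberₚ.∈-tabulate⁻ e∈
      with y , refl ← Memberₚ.∈-tabulate⁻ e′∈
      with x ≟ y
    ... | yes refl = refl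
    ... | no x≢y = ⊥-elim (p≢q (common-point x≢y p∈e q∈e p∈e′ q∈e′))

    uniform : Uniform hypergraph (suc (suc k))
    uniform = Allₚ.tabulate⁺ λ x → ∣image∣ (point x) point-injective

    adj⇔meet : ∀ x y → Adj G x y ⇔ (x ≢ y × Nonempty (edge x ∩ edge y))
    adj⇔meet x y = mk⇔ forward backward
      where
      forward : Adj G x y → x ≢ y × Nonempty (edge x ∩ edge y)
      forward x∼y =
        let i , on = adj⇒on x∼y
            j , xi≡yj = line-through on
        in (λ x≡y → irrefl G x≡y x∼y) , point x i , Subsetₚ.x∈p∩q⁺
             (∈-image⁺ (point x) i , subst (_∈ₛ edge y) (sym (same⇒point≡ xi≡yj)) (∈-image⁺ (point y) j))
      backward : x ≢ y × Nonempty (edge x ∩ edge y) → Adj G x y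
      backward (x≢y , p , p∈) with p∈x , p∈y ← Subsetₚ.x∈p∩q⁻ (edge x) (edge y) p∈
        with i , refl ← ∈-image⁻ (point x) p∈x
        with j , eq ← ∈-image⁻ (point y) p∈y = on⇒adj x≢y (meeting⇒on (sym eq))

    -- The edges are tabulated over the vertices, so the bijection is only a cast along the length
    -- of the list.
    isomorphism : G ≅ intersectionGraph hypergraph
    isomorphism = record
      { bijection = mk↔ₛ′ index (cast n≡) (cast-involutive (sym n≡) n≡) (cast-involutive n≡ (sym n≡))
      ; adj⇔adj   = λ x y → mk⇔ (forward x y) (backward x y)
      }
      where
      n≡ : length (List.tabulate edge) ≡ order G
      n≡ = Listₚ.length-tabulate edge
      index : V G → Fin (length (List.tabulate edge))
      index = cast (sym n≡)
      edge-at : ∀ x → List.lookup (List.tabulate edge) (index x) ≡ edge x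
      edge-at = Listₚ.lookup-tabulate edge
      index-injective : ∀ {x y} → index x ≡ index y → x ≡ y
      index-injective {x} {y} eq = trans (sym (cast-involutive n≡ (sym n≡) x))
        (trans (cong (cast n≡) eq) (cast-involutive n≡ (sym n≡) y))
      forward : ∀ x y → Adj G x y → Adj (intersectionGraph hypergraph) (index x) (index y)
      forward x y x∼y = let x≢y , meet = Function.Bundles.Equivalence.to (adj⇔meet x y) x∼y in
        x≢y ∘ index-injective , subst₂ (λ e f → Nonempty (e ∩ f)) (sym (edge-at x)) (sym (edge-at y)) meet
      backward : ∀ x y → Adj (intersectionGraph hypergraph) (index x) (index y) → Adj G x y
      backward x y (ix≢iy , meet) = Function.Bundles.Equivalence.from (adj⇔meet x y)
        (ix≢iy ∘ cong index , subst₂ (λ e f → Nonempty (e ∩ f)) (edge-at x) (edge-at y) meet)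

  module _ (G : Graph) (t : ℕ) (psd : Weights.PositiveSemidefinite G (suc t)) where
    open Constants t
    open Geometry G t psd
    open FrameTheory G t psd

    module _ (frame : ∀ x → ∃[ Fs ] IsFrame x {suc t} Fs) where

      private
        block-of : V G → Fin (suc t) → List (V G)
        block-of x i = lookup (proj₁ (frame x)) i

        On : V G → Fin (suc t) → V G → Set
        On x i y = Att y (block-of x i)

        clique : ∀ x i → Clique (block-of x i)
        clique x = clique-at (proj₂ (frame x))

        len : ∀ x i → length (block-of x i) ≡ M
        len x = length-at (proj₂ (frame x))

        near⇒att : ∀ {y F} → All (Near y) F → Att y F
        near⇒att {y} {F} near = ℤₚ.≤-trans (near⇒attached-0 {y} {F} near) (0≤+ c₀)

        on-self : ∀ x i → On x i x
        on-self x i = near⇒att (All.map inj₂ (adjacent-at (proj₂ (frame x)) i))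

        -- Any vertex of the block serves: being near to its whole clique, it is attached to the
        -- block.
        companion : ∀ x i → ∃[ y ] x ≢ y × On x i y
        companion x i = first (clique-near (clique x i)) (adjacent-at (proj₂ (frame x)) i)
            (subst (1 ℕ.≤_) (sym (len x i)) 1≤M)
          where
          first : ∀ {F} → All (λ y → All (Near y) (block-of x i)) F → All (Adj G x) F → 1 ℕ.≤ length F →
            ∃[ y ] x ≢ y × On x i y
          first {y ∷ _} (near ∷ _) (x∼y ∷ _) _ = y , (λ x≡y → irrefl G x≡y x∼y) , near⇒att near

        on⇒adj : ∀ {x i y} → x ≢ y → On x i y → Adj G x y
        on⇒adj {x} {i} {y} x≢y on with adj? G x y
        ... | yes x∼y = x∼y
        ... | no x≁y = ⊥-elim (FullFrame.non-neighbour-unattached (proj₂ (frame x)) x≢y x≁y i on)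

        near⇒on : ∀ {y s} → Near y s → ∃[ j ] On y j s
        -- A vertex lies on each of its own lines, so any index would do.
        near⇒on {y} (inj₁ refl) = zero , on-self y zero
        near⇒on {y} (inj₂ y∼s)  = FullFrame.neighbour-attached (proj₂ (frame y)) y∼s

        -- By pigeonhole many vertices of the block at x lie on one line through y,
        -- and this line then contains every vertex attached to the block at x.
        transfer : ∀ {x i y} → On x i y → ∃[ j ] (∀ z → On x i z → On y j z)
        transfer {x} {i} {y} y-on =
          let j , S , S⊆S₀ , S-on , m₁≤S = pigeonhole (suc t) m₁ (λ j s → att? s (block-of y j)) S₀
                (All.map near⇒on (Allₚ.all-filter (near? y) F)) many
          in j , λ z z-on → conclude j S (⊆-trans S⊆S₀ (filter-⊆ (near? y) F)) S-on m₁≤S z z-on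
          where
          F = block-of x i
          S₀ = filter (near? y) F
          many : suc t ℕ.* m₁ ℕ.< length S₀
          many = ℕₚ.+-cancelʳ-< c₀ (suc t ℕ.* m₁) (length S₀) (ℕₚ.<-≤-trans km₁+c₀<M
            (ℤₚ.drop‿+≤+ (subst (+ M ≤_) (sym (ℤₚ.pos-+ (length S₀) c₀)) (0≤-⇒≤ (by
              (trans (eq (∑ F (ν y)) (∑ F (ν̄ y)) (+ c₀))
                (cong₂ (λ a b → a + + c₀ - b) (sym (length-near y F)) (trans (∑ν+∑ν̄ y F) (cong +_ (len x i)))))
              (≤⇒0≤- y-on))))))
            where
            eq : ∀ n m c → c - m ≡ n + c - (n + m)
            eq = solve-∀
          conclude : ∀ j S → S ⊆ F → All (λ s → Att s (block-of y j)) S → m₁ ℕ.≤ length S →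
            ∀ z → On x i z → On y j z
          conclude j S S⊆F S-on m₁≤S z z-on with attached-or-detached z (clique y j)
          ... | inj₁ att = att
          ... | inj₂ det = ⊥-elim (attached-source⇒¬detached-target {c₀} {m₁} {S} {block-of y j} {z} ℕₚ.≤-refl
            (AllPairs-⊆ S⊆F (clique x i)) (clique y j) m₁≤S (subst (m₁ ℕ.≤_) (sym (len y j)) m₁≤M) S-on
            (attached-⊆ {c₀} {z} {S} {F} S⊆F z-on) det)

      lineSystem : LineSystem G (suc t)
      lineSystem = record
        { On        = On
        ; on?       = λ x i y → att? y (block-of x i)
        ; on-self   = on-self
        ; companion = companion
        ; on⇒adj    = λ {x} {i} → on⇒adj {x} {i}
        ; adj⇒on    = λ x∼y → near⇒on (inj₂ x∼y)
        ; on-unique = λ {x} {i} {j} x≢y p q →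
            FullFrame.neighbour-attached-once (proj₂ (frame x)) (on⇒adj {x} {i} x≢y p) i j p q
        ; transfer  = λ {x} {i} → transfer {x} {i}
        }

open import Data.Empty using (⊥-elim)
import Data.Nat.Properties as ℕₚ
open import Relation.Binary.PropositionalEquality using (refl; subst)

theorem1p3 : (t : ℕ) → .{{_ : NonZero t}} →
    ∃[ κ ] 0 ℕ.< κ ×
    ((G : Graph) →
    ((x : V G) → κ ℕ.< degree G x) →
    ((x : V G) → averageDegree (localGraph G x) ℚ.≤ (+ degree G x ℤ.- + κ) ℚ./ t) →
    ((μ : ℝ) → IsSmallestEigenvalue (adjacencyMatrix G) μ → fromℤ (ℤ.- + t ℤ.- 1ℤ) ≤ℝ μ) →
    ∃[ H ] Linear H × Uniform H (t ℕ.+ 1) × G ≅ intersectionGraph H)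
theorem1p3 ℕ.zero {{nonZero}} = ⊥-elim (ℕ.≢-nonZero⁻¹ 0 {{nonZero}} refl)
theorem1p3 (ℕ.suc t) = κ , ℕ.s≤s ℕ.z≤n , λ G κ<d sparse λmin →
  let psd   = gram-positive G (ℕ.suc t) λmin
      lines = lineSystem G (ℕ.suc t) psd λ x → full-frame G t psd x (κ<d x) (sparse x)
  in hypergraph lines , linear lines ,
     subst (Uniform (hypergraph lines)) (ℕₚ.+-comm 1 (ℕ.suc t)) (uniform lines) ,
     isomorphism lines
  where
  open Cliques.Constants (ℕ.suc t) using (κ)
  open GramForms using (gram-positive)
  open FrameExistence.Existence using (full-frame)
  open Lines using (lineSystem)
  open Lines.LineHypergraph using (hypergraph; linear; uniform; isomorphism)
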